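{- Let $\mathcal{G}_{10},\mathcal{G}_9,\mathcal{G}_8$ be the punctured ternary Golay codes and $\mathcal{G}_{10}^\perp,\mathcal{G}_9^\perp,\mathcal{G}_8^\perp$ their duals, as in the context, and for $m\ge1$ let $\mathcal{G}_{n,m}$, $\mathcal{G}_{n,m}^\perp$ ($n=10,9,8$) be the corresponding $m$-lifted codes over $\mathbb{F}_{3^m}$ ($\mathcal{G}_{n,1}=\mathcal{G}_n$, $\mathcal{G}_{n,1}^\perp=\mathcal{G}_n^\perp$). Then: (i) The following codes are all UPWS and NMDS: family $\mathcal{D}_3$: $\mathcal{G}_{10,1}=[10,6,4]_32$ and $\mathcal{G}_{10,m}=[10,6,4]_{3^m}4$ for all $m\ge3$; family $\mathcal{D}_4$: $\mathcal{G}_{9,1}=[9,6,3]_32$ and $\mathcal{G}_{9,m}=[9,6,3]_{3^m}3$ for all $m\ge2$; family $\mathcal{D}_5$: $\mathcal{G}_{8,1}=[8,6,2]_31$ and $\mathcal{G}_{8,m}=[8,6,2]_{3^m}2$ for all $m\ge2$ (the last number in each parameter list being the covering radius). (ii) All codes of the family $\mathcal{D}_5$ are completely regular NMDS codes; the code $\mathcal{G}_{9,1}=[9,6,3]_32$ is a completely regular NMDS code; the code $\mathcal{G}_{10}^\perp=[10,4,6]_35$ is $2$-regular. (iii) The following NMDS codes are not UPWS: $\mathcal{G}_{10,1}^\perp=[10,4,6]_35$ and $\mathcal{G}_{10,m}^\perp=[10,4,6]_{3^m}6$ for $m\ge2$; $\mathcal{G}_{9,1}^\perp=[9,3,6]_35$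 and $\mathcal{G}_{9,m}^\perp=[9,3,6]_{3^m}6$ for $m\ge2$; $\mathcal{G}_{8,1}^\perp=[8,2,6]_35$ and $\mathcal{G}_{8,m}^\perp=[8,2,6]_{3^m}6$ for $m\ge2$; and $\mathcal{G}_{10,2}=[10,6,4]_{3^2}3$. (iv) For every $m\ge1$, the codes $\mathcal{G}_{10,m}^\perp=[10,4,6]_{3^m}$, $\mathcal{G}_{9,m}^\perp=[9,3,6]_{3^m}$, $\mathcal{G}_{8,m}^\perp=[8,2,6]_{3^m}$ have the maximum possible number (for NMDS codes) of codewords of minimum weight $6$, namely $A^{\max}_6(10,4,3^m)$, $A^{\max}_6(9,3,3^m)$, $A^{\max}_6(8,2,3^m)$ respectively. Also, the punctured Golay codes $\mathcal{G}_{10}=[10,6,4]_3$, $\mathcal{G}_9=[9,6,3]_3$, $\mathcal{G}_8=[8,6,2]_3$ have the minimal possible number (among all codes with the same length, dimension and minimum distance) of codewords of their minimum weight $d=4,3,2$ respectively. (v) For every $m\ge1$, the codes $\mathcal{G}_{10,m}^\perp$, $\mathcal{G}_{9,m}^\perp$, $\mathcal{G}_{8,m}^\perp$ have no codewords of weight $7$.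
   Context: $\mathbb{F}_q$ is the field with $q$ elements. An $[n,k,d]_qR$ code is a $k$-dimensional linear subspace of $\mathbb{F}_q^n$ with minimum Hamming distance $d$ and covering radius $R$ (the least integer such that every vector of $\mathbb{F}_q^n$ is within Hamming distance $R$ of a codeword). $C^\perp$ is the dual code. $A_i(C)$ is the number of codewords of weight $i$. For a linear code $C$ over $\mathbb{F}_q$ with parity check matrix $H$ and $m\ge1$, the $m$-lifted code $C_m$ is the linear code over $\mathbb{F}_{q^m}$ with the same parity check matrix, $C_m=\{x\in\mathbb{F}_{q^m}^n: Hx^T=0\}$ (the $\mathbb{F}_{q^m}$-span of $C$); it has the same length, dimension and minimum distance. A linear $[n,k,d]_q$ code is near-MDS (NMDS) if $d=n-k$ and $d(C)+d(C^\perp)=n$. For NMDS $[n,k,d]_q$ codes, $A_d(C)\le A^{\max}_d(n,k,q):=\binom{n}{k-1}\frac{q-1}{k}$. $B_j(v,C)$ is the number of codewords at distance $j$ from $v$. A code with covering radius $R$ is UPWS (uniformly packed in the wide sense) if there exist rationals $\beta_0,\dots,\beta_R$ with $\sum_{j=0}^R\beta_jB_j(v,C)=1$ for all $v$. A code with covering radius $R$ is $t$-regular ($0\le t\le R$) if for all $v$ with $d(v,C)\le t$ and all $j=0,\dots,R$, $B_j(v,C)$ depends only on $j$ and $d(v,C)$; it is completely regular if it is $R$-regular. $\mathcal{G}_{11}$ is the ternary $[11,6,5]_3$ Golay code with generator matrix $[I_6\mid M_{11}]$, $M_{11}=\begin{pmatrix}2&2&2&2&2\\2&2&1&1&0\\2&1&2&0&1\\1&2&0&2&1\\1&0&2&1&2\\0&1&1&2&2\end{pmatrix}$.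 $\mathcal{G}_{10}$, $\mathcal{G}_9$, $\mathcal{G}_8$ are obtained from $\mathcal{G}_{11}$ by deleting coordinate $11$, coordinates $\{10,11\}$, and coordinates $\{9,10,11\}$ respectively (i.e. generator matrices $[I_6\mid M]$ with $M$ the first $4$, $3$, $2$ columns of $M_{11}$); $\mathcal{G}_n^\perp$ is the dual of $\mathcal{G}_n$. -}

module Defs where

open import Level using (0ℓ)
open import Data.Nat as ℕ using (ℕ; zero; suc; _≤_; _∸_; _^_; z≤n; s≤s)
import Data.Nat.Combinatorics as Comb
open import Data.Fin as Fin using (Fin; zero; suc; splitAt; inject≤; #_)
open import Data.Fin.Properties using (all?; any?)
open import Data.Integer using (+_)
open import Data.Rational as ℚ using (ℚ; 0ℚ; 1ℚ)
open import Data.List using (List; []; _∷_; _++_; map; filter; length)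
open import Data.List.Membership.Propositional using (_∈_)
open import Data.List.Relation.Unary.Unique.Propositional using (Unique)
open import Data.List.Relation.Unary.Any as Any using (Any; here; there)
open import Data.List.Relation.Unary.Any.Properties using (++⁺ˡ; ++⁺ʳ; map⁺)
open import Data.List.Relation.Unary.All as All using (All)
open import Data.Product using (Σ; ∃; _×_; _,_; proj₁; proj₂)
open import Data.Sum using (inj₁; inj₂)
open import Data.Bool using (if_then_else_)
open import Data.Empty using (⊥)
open import Function using (_∘_)
open import Relation.Nullary using (¬_; Dec; yes; no; does; _×-dec_; _→-dec_; ¬?)
open import Relation.Nullary.Decidable using (map′)
open import Relation.Binary.Definitions using (DecidableEquality)
open import Relation.Binary.PropositionalEquality using (_≡_; _≢_; refl; sym; trans; cong; cong₂; subst)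
open import Algebra.Structures using (IsCommutativeRing)

record FiniteField : Set₁ where
  infixl 6 _+_
  infixl 7 _*_
  field
    Carrier  : Set
    _+_ _*_  : Carrier → Carrier → Carrier
    -_       : Carrier → Carrier
    0# 1#    : Carrier
    isCommutativeRing : IsCommutativeRing _≡_ _+_ _*_ -_ 0# 1#
    0≢1      : 0# ≢ 1#
    inverse  : ∀ x → x ≢ 0# → ∃ λ y → x * y ≡ 1#
    _≟_      : DecidableEquality Carrier
    elements : List Carrier
    complete : ∀ x → x ∈ elements
    unique   : Unique elements

  order : ℕ
  order = length elements

  -- characteristic 3 (every field with 3^m elements has it)
  Char3 : Set
  Char3 = 1# + 1# + 1# ≡ 0#

  emb : Fin 3 → Carrier
  emb zero = 0#
  emb (suc zero) = 1#
  emb (suc (suc zero)) = 1# + 1#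

open FiniteField public using (order; Char3)

sumℚ : ∀ r → (Fin r → ℚ) → ℚ
sumℚ zero f = 0ℚ
sumℚ (suc r) f = f zero ℚ.+ sumℚ r (f ∘ suc)

toℚ : ℕ → ℚ
toℚ k = + k ℚ./ 1

module _ (F : FiniteField) where
  open FiniteField F hiding (order; Char3)

  Vect : ℕ → Set
  Vect n = Fin n → Carrier

  _≋_ : ∀ {n} → Vect n → Vect n → Set
  u ≋ v = ∀ i → u i ≡ v i

  _≋?_ : ∀ {n} (u v : Vect n) → Dec (u ≋ v)
  u ≋? v = all? (λ i → u i ≟ v i)

  zeroV : ∀ {n} → Vect n
  zeroV _ = 0#

  sumF : ∀ n → (Fin n → Carrier) → Carrier
  sumF zero f = 0#
  sumF (suc n) f = f zero + sumF n (f ∘ suc)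

  sumF-cong : ∀ n {f g : Fin n → Carrier} → (∀ i → f i ≡ g i) → sumF n f ≡ sumF n g
  sumF-cong zero eq = refl
  sumF-cong (suc n) eq = cong₂ _+_ (eq zero) (sumF-cong n (eq ∘ suc))

  dot : ∀ {n} → Vect n → Vect n → Carrier
  dot {n} u v = sumF n (λ i → u i * v i)

  dist : ∀ {n} → Vect n → Vect n → ℕ
  dist {zero} u v = 0
  dist {suc n} u v =
    (if does (u zero ≟ v zero) then 0 else 1) ℕ.+ dist (u ∘ suc) (v ∘ suc)

  weight : ∀ {n} → Vect n → ℕ
  weight v = dist v zeroV

  consV : ∀ {n} → Carrier → Vect n → Vect (suc n)
  consV a v zero = a
  consV a v (suc i) = v i

  extendVecs : ∀ {n} → List (Vect n) → List Carrier → List (Vect (suc n))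
  extendVecs ws [] = []
  extendVecs ws (a ∷ as) = map (consV a) ws ++ extendVecs ws as

  allVecs : ∀ n → List (Vect n)
  allVecs zero = (λ ()) ∷ []
  allVecs (suc n) = extendVecs (allVecs n) elements

  allVecs-complete : ∀ n (v : Vect n) → Any (v ≋_) (allVecs n)
  allVecs-complete zero v = here (λ ())
  allVecs-complete (suc n) v = go-complete elements (complete (v zero))
    where
    tl : Any ((v ∘ suc) ≋_) (allVecs n)
    tl = allVecs-complete n (v ∘ suc)
    go-complete : ∀ as → v zero ∈ as → Any (v ≋_) (extendVecs (allVecs n) as)
    go-complete (a ∷ as) (here refl) =
      ++⁺ˡ (map⁺ (Any.map (λ eq → λ { zero → refl ; (suc i) → eq i }) tl))
    go-complete (a ∷ as) (there p) = ++⁺ʳ _ (go-complete as p)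

  Resp : ∀ {n} → (Vect n → Set) → Set
  Resp P = ∀ {u v} → u ≋ v → P u → P v

  dec∃ : ∀ n (P : Vect n → Set) → Resp P → (∀ v → Dec (P v)) → Dec (∃ P)
  dec∃ n P resp P? with Any.any? P? (allVecs n)
  ... | yes a = yes (Any.satisfied a)
  ... | no ¬a = no λ { (v , pv) → ¬a (Any.map (λ {w} eq → resp eq pv) (allVecs-complete n v)) }

  dec∀ : ∀ n (P : Vect n → Set) → Resp P → (∀ v → Dec (P v)) → Dec (∀ v → P v)
  dec∀ n P resp P? with All.all? P? (allVecs n)
  ... | no ¬a = no λ h → ¬a (All.tabulate (λ {w} _ → h w))
  ... | yes a = yes λ v → lemma v (allVecs-complete n v)
    where
    lemma : ∀ v → Any (v ≋_) (allVecs n) → P v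
    lemma v p with All.lookupAny a p
    ... | (pw , eq) = resp (λ i → sym (eq i)) pw

  record Code (n : ℕ) : Set₁ where
    field
      mem  : Vect n → Set
      mem? : ∀ v → Dec (mem v)
      resp : Resp mem

  open Code public

  IsLinear : ∀ {n} → Code n → Set
  IsLinear {n} C =
    mem C zeroV ×
    (∀ u v → mem C u → mem C v → mem C (λ i → u i + v i)) ×
    (∀ a v → mem C v → mem C (λ i → a * v i))

  lincomb : ∀ {k n} → (Fin k → Vect n) → Vect k → Vect n
  lincomb {k} g a j = sumF k (λ i → a i * g i j)

  HasDim : ∀ {n} → Code n → ℕ → Set
  HasDim {n} C k = Σ (Fin k → Vect n) λ g →
    (∀ x → mem C x → ∃ λ a → x ≋ lincomb g a) ×
    (∀ a → mem C (lincomb g a)) ×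
    (∀ a → lincomb g a ≋ zeroV → ∀ i → a i ≡ 0#)

  HasMinDist : ∀ {n} → Code n → ℕ → Set
  HasMinDist {n} C d =
    (Σ (Vect n) λ u → Σ (Vect n) λ v →
       mem C u × mem C v × ¬ (u ≋ v) × dist u v ≡ d) ×
    (∀ u v → mem C u → mem C v → ¬ (u ≋ v) → d ≤ dist u v)

  CoversWithin : ∀ {n} → Code n → ℕ → Set
  CoversWithin {n} C R = ∀ (v : Vect n) → ∃ λ c → mem C c × dist v c ≤ R

  HasCovRad : ∀ {n} → Code n → ℕ → Set
  HasCovRad C R = CoversWithin C R × (∀ R' → CoversWithin C R' → R ≤ R')

  DistToCode : ∀ {n} → Code n → Vect n → ℕ → Set
  DistToCode C v t = (∃ λ c → mem C c × dist v c ≡ t) × (∀ c → mem C c → t ≤ dist v c)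

  countVecs : ∀ n (P : Vect n → Set) → (∀ v → Dec (P v)) → ℕ
  countVecs n P P? = length (filter P? (allVecs n))

  A : ∀ {n} → ℕ → Code n → ℕ
  A {n} i C = countVecs n (λ c → mem C c × weight c ≡ i) (λ c → mem? C c ×-dec (weight c ℕ.≟ i))

  B : ∀ {n} → ℕ → Vect n → Code n → ℕ
  B {n} j v C = countVecs n (λ c → mem C c × dist v c ≡ j) (λ c → mem? C c ×-dec (dist v c ℕ.≟ j))

  private
    dot-congʳ : ∀ {n} (x : Vect n) {u v : Vect n} → u ≋ v → dot x u ≡ dot x v
    dot-congʳ {n} x eq = sumF-cong n (λ i → cong (x i *_) (eq i))
    dot-congˡ : ∀ {n} (x : Vect n) {u v : Vect n} → u ≋ v → dot u x ≡ dot v x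
    dot-congˡ {n} x eq = sumF-cong n (λ i → cong (_* x i) (eq i))

  Dual : ∀ {n} → Code n → Code n
  Dual {n} C = record
    { mem  = λ x → ∀ c → mem C c → dot x c ≡ 0#
    ; mem? = λ x → dec∀ n (λ c → mem C c → dot x c ≡ 0#)
                     (λ eq h mc → trans (sym (dot-congʳ x eq)) (h (resp C (λ i → sym (eq i)) mc)))
                     (λ c → mem? C c →-dec (dot x c ≟ 0#))
    ; resp = λ eq h c mc → trans (sym (dot-congˡ c eq)) (h c mc)
    }

  SpanCode : ∀ {k n} → (Fin k → Fin n → Fin 3) → Code n
  SpanCode {k} {n} G = record
    { mem  = λ x → ∃ λ a → x ≋ lincomb rows a
    ; mem? = λ x → dec∃ k (λ a → x ≋ lincomb rows a)
                     (λ eq h j → trans (h j) (sumF-cong k (λ i → cong (_* rows i j) (eq i))))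
                     (λ a → x ≋? lincomb rows a)
    ; resp = λ { eq (a , h) → a , λ j → trans (sym (eq j)) (h j) }
    }
    where
    rows : Fin k → Vect n
    rows i j = emb (G i j)

  KernelCode : ∀ {r n} → (Fin r → Fin n → Fin 3) → Code n
  KernelCode {r} {n} H = record
    { mem  = λ x → ∀ i → dot (λ j → emb (H i j)) x ≡ 0#
    ; mem? = λ x → all? (λ i → dot (λ j → emb (H i j)) x ≟ 0#)
    ; resp = λ eq h i → trans (sym (dot-congʳ _ eq)) (h i)
    }

  IsNMDS : ∀ {n} → Code n → Set
  IsNMDS {n} C = Σ ℕ λ k → Σ ℕ λ d → Σ ℕ λ d⊥ →
    HasDim C k × HasMinDist C d × HasMinDist (Dual C) d⊥ ×
    d ℕ.+ k ≡ n × d ℕ.+ d⊥ ≡ n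

  IsUPWS : ∀ {n} → Code n → Set
  IsUPWS {n} C = Σ ℕ λ R → HasCovRad C R × Σ (Fin (suc R) → ℚ) λ β →
    ∀ (v : Vect n) → sumℚ (suc R) (λ j → β j ℚ.* toℚ (B (Fin.toℕ j) v C)) ≡ 1ℚ

  Regular : ∀ {n} → Code n → (R t : ℕ) → Set
  Regular {n} C R t = ∀ s → s ≤ t → ∀ (v w : Vect n) →
    DistToCode C v s → DistToCode C w s → ∀ j → j ≤ R → B j v C ≡ B j w C

  IsTRegular : ∀ {n} → Code n → ℕ → Set
  IsTRegular C t = Σ ℕ λ R → HasCovRad C R × t ≤ R × Regular C R t

  IsCompletelyRegular : ∀ {n} → Code n → Set
  IsCompletelyRegular C = Σ ℕ λ R → HasCovRad C R × Regular C R R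

  Params : ∀ {n} → Code n → (k d R : ℕ) → Set
  Params C k d R = HasDim C k × HasMinDist C d × HasCovRad C R

Amax : (n k : ℕ) → .{{_ : ℕ.NonZero k}} → (q : ℕ) → ℚ
Amax n k q = + ((n Comb.C (k ∸ 1)) ℕ.* (q ∸ 1)) ℚ./ k

private
  M11 : Fin 6 → Fin 5 → Fin 3
  M11 i j = Data.Vec.lookup (Data.Vec.lookup table i) j
    where
    open import Data.Vec using (Vec; []; _∷_)
    import Data.Vec
    table : Vec (Vec (Fin 3) 5) 6
    table = ((# 2) ∷ (# 2) ∷ (# 2) ∷ (# 2) ∷ (# 2) ∷ [])
          ∷ ((# 2) ∷ (# 2) ∷ (# 1) ∷ (# 1) ∷ (# 0) ∷ [])
          ∷ ((# 2) ∷ (# 1) ∷ (# 2) ∷ (# 0) ∷ (# 1) ∷ [])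
          ∷ ((# 1) ∷ (# 2) ∷ (# 0) ∷ (# 2) ∷ (# 1) ∷ [])
          ∷ ((# 1) ∷ (# 0) ∷ (# 2) ∷ (# 1) ∷ (# 2) ∷ [])
          ∷ ((# 0) ∷ (# 1) ∷ (# 1) ∷ (# 2) ∷ (# 2) ∷ [])
          ∷ []

golayGen : (c : ℕ) → c ≤ 5 → Fin 6 → Fin (6 ℕ.+ c) → Fin 3
golayGen c c≤5 i j with splitAt 6 j
... | inj₁ j' = if does (i Fin.≟ j') then # 1 else # 0
... | inj₂ l  = M11 i (inject≤ l c≤5)

gen10 : Fin 6 → Fin 10 → Fin 3
gen10 = golayGen 4 (s≤s (s≤s (s≤s (s≤s z≤n))))

gen9 : Fin 6 → Fin 9 → Fin 3
gen9 = golayGen 3 (s≤s (s≤s (s≤s z≤n)))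

gen8 : Fin 6 → Fin 8 → Fin 3
gen8 = golayGen 2 (s≤s (s≤s z≤n))

-- G_{n,m}: the F-span of G_n (F a field with 3^m elements)
G10 G10⊥ : (F : FiniteField) → Code F 10
G9  G9⊥  : (F : FiniteField) → Code F 9
G8  G8⊥  : (F : FiniteField) → Code F 8
G10 F = SpanCode F gen10
G9  F = SpanCode F gen9
G8  F = SpanCode F gen8
-- G^⊥_{n,m}: the lifted dual, i.e. the code over F with parity check matrix
-- equal to the parity check matrix [I_6 | M] of G_n^⊥
G10⊥ F = KernelCode F gen10
G9⊥  F = KernelCode F gen9
G8⊥  F = KernelCode F gen8

{-# OPTIONS --safe #-}

-- Fix a parity check matrix over 𝔽₃ and a syndrome s over F, with q = |F|.  Summing over all
-- i-sets J of coordinates the number of vectors supported in J with syndrome s gives a moment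
-- S i.  The moments S 0, …, S i and the numbers B 0, …, B i of codewords at distance 0, …, i
-- determine each other through a triangular system of binomial coefficients, so covering
-- radius, UPWS property and regularity can all be read off the moments.  By elimination over
-- 𝔽₃, every summand is a power of q if s satisfies certain equations over 𝔽₃, and 0 otherwise.
-- Hence at s = Σ ω_k t_k, with ω independent over 𝔽₃ and t_k over 𝔽₃, the moments are found by
-- computing in 𝔽₃, for all F at once.
--
-- For r = 4, 3, 2 the columns of a parity check matrix of G₁₀, G₉, G₈ are an elliptic quadric of
-- PG(3,3), the points of AG(2,3), the points of PG(1,3) taken twice.  The hyperplanes spanned
-- by dependent r-sets of columns are those spanned by r - 1 columns, each occurring r times as
-- often in the latter role.  So r S r - q S (r - 1) is constant, which is the UPWS property when
-- R = r.  For the codes that are not UPWS, three points at distance R - 1 or R contradict the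
-- defining relation.  The minimality of the number of words of weight d is a linear programming bound:
-- double counting orthogonal pairs gives three moments of the weight distribution of the dual.
module Submission where

open import Defs
open import Data.Nat as ℕ using (ℕ; zero; suc; _^_; _∸_; _≤_; _<_; _≤?_; _<ᵇ_; _≡ᵇ_; z≤n; s≤s; s≤s⁻¹)
import Data.Nat.Combinatorics as Comb
import Data.Nat.Properties as ℕₚ
import Data.Nat.Solver as ℕ-Solver
import Data.Integer as ℤ
import Data.Integer.Properties as ℤₚ
open import Data.Rational as ℚ using (ℚ; 0ℚ; 1ℚ)
import Data.Rational.Properties as ℚₚ
open import Data.Rational.Solver using (module +-*-Solver)
open import Data.Rational.Unnormalised as ℚᵘ using (mkℚᵘ; *≡*)
import Data.Rational.Unnormalised.Properties as ℚᵘₚ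
open import Data.Bool using (Bool; true; false; if_then_else_; _∧_; not; T)
open import Data.Bool.ListAction using (all; any)
open import Data.Empty using (⊥; ⊥-elim)
open import Data.Unit using (tt)
open import Data.Fin as Fin using (Fin; zero; suc; toℕ; fromℕ; fromℕ<; inject₁; _↑ˡ_; _↑ʳ_; splitAt; join)
import Data.Fin.Properties as Finₚ
open import Data.List using (List; []; _∷_; map; _++_; length; filter; cartesianProductWith; null; allFin)
open import Data.List.Properties using (length-map; length-++)
open import Data.List.Membership.Propositional using (_∈_; _∉_; find)
open import Data.List.Membership.Propositional.Properties
  using (∈-map⁺; ∈-map⁻; ∈-cartesianProductWith⁺; ∈-allFin)
import Data.List.Membership.DecPropositional as DecMembership
open import Data.List.Relation.Unary.All as All using (All; []; _∷_)
open import Data.List.Relation.Unary.AllPairs using ([]; _∷_)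
open import Data.List.Relation.Unary.Any using (here; there)
open import Data.List.Relation.Unary.Unique.Propositional using (Unique)
import Data.List.Relation.Unary.Unique.Propositional.Properties as Uniqueₚ
open import Data.Maybe as Maybe using (Maybe; just; nothing; maybe′)
open import Data.Product using (∃; Σ; _×_; _,_; proj₁; proj₂)
open import Data.Sum using (inj₁; inj₂; [_,_]′)
open import Data.Vec as Vec using (Vec; []; _∷_; lookup; zipWith; replicate; tabulate)
open import Data.Vec.Properties using (≡-dec; ∷-injective; lookup∘tabulate; tabulate∘lookup)
open import Function using (_∘_)
open import Level using (Level)
open import Relation.Nullary using (¬_; Dec; yes; no; does; ¬?; _×-dec_)
open import Relation.Nullary.Decidable using (decidable-stable; toWitness)
open import Relation.Binary.Definitions using (DecidableEquality)
open import Relation.Binary.PropositionalEquality hiding (resp)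
open import Algebra.Bundles using (CommutativeRing)
import Algebra.Properties.AbelianGroup as AbelianGroupProperties
import Algebra.Properties.CommutativeSemigroup as CommutativeSemigroupProperties
import Algebra.Properties.Ring as RingProperties
open CommutativeSemigroupProperties ℕₚ.+-commutativeSemigroup using ()
  renaming (x∙yz≈y∙xz to m+[n+o]≡n+[m+o]; interchange to ℕ-interchange)
open CommutativeSemigroupProperties ℕₚ.*-commutativeSemigroup using ()
  renaming (x∙yz≈y∙xz to m*[n*o]≡n*[m*o])

-- The field is abstract and its order is any power of 3, so nothing can be enumerated over it; only
-- the finite configuration of columns over 𝔽₃ can. The numbers B j would need inclusion-exclusion
-- over supports, with signs; the moments are sums of powers of q and keep the counting in the
-- natural numbers. A syndrome enters only through the 𝔽₃-subspace spanned by its coordinate vectors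
-- t_k, and the thresholds on q come from there: a subspace of dimension l needs l independent field
-- elements. For G₁₀ a deep hole of distance 4 needs a tangent plane of the quadric, hence three
-- elements and q ≥ 27. Every line over 𝔽₃ lies in a plane spanned by points of the quadric, so for
-- q = 9 the radius drops to 3, below r, and the relation between S r and S (r - 1) involves
-- distance R + 1. For q = 3 and q = 9 one or two elements form a basis, and a check over all t_k
-- covers every syndrome. For larger q the upper bound on the radius is the rank of the parity check
-- matrix, and only a deep hole has to be exhibited.

module FiniteSums where

  open import Data.Nat
  open import Data.Nat.Properties

  -- Finite sums of natural numbers and indicators

  infix 3 ∑ Σ<
  syntax ∑ xs (λ x → e) = ∑[ x ∈ xs ] e
  syntax Σ< n (λ j → e) = Σ[ j < n ] e

  ∑ : {A : Set} → List A → (A → ℕ) → ℕ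
  ∑ [] f = 0
  ∑ (x ∷ xs) f = f x + ∑ xs f

  module _ {A : Set} where

    ∑-cong : ∀ (xs : List A) {f g} → (∀ x → f x ≡ g x) → ∑ xs f ≡ ∑ xs g
    ∑-cong [] eq = refl
    ∑-cong (x ∷ xs) eq = cong₂ _+_ (eq x) (∑-cong xs eq)

    ∑-++ : ∀ (xs ys : List A) {f} → ∑ (xs ++ ys) f ≡ ∑ xs f + ∑ ys f
    ∑-++ [] ys = refl
    ∑-++ (x ∷ xs) ys {f} = trans (cong (f x +_) (∑-++ xs ys)) (sym (+-assoc (f x) _ _))

    ∑-map : ∀ {B : Set} (h : B → A) xs {f} → ∑ (map h xs) f ≡ ∑ xs (f ∘ h)
    ∑-map h [] = refl
    ∑-map h (x ∷ xs) {f} = cong (f (h x) +_) (∑-map h xs)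

    ∑-+ : ∀ (xs : List A) f g → (∑[ x ∈ xs ] (f x + g x)) ≡ ∑ xs f + ∑ xs g
    ∑-+ [] f g = refl
    ∑-+ (x ∷ xs) f g = trans (cong (f x + g x +_) (∑-+ xs f g)) (ℕ-interchange (f x) (g x) _ _)

    ∑-*ˡ : ∀ c (xs : List A) f → (∑[ x ∈ xs ] (c * f x)) ≡ c * ∑ xs f
    ∑-*ˡ c [] f = sym (*-zeroʳ c)
    ∑-*ˡ c (x ∷ xs) f = trans (cong (c * f x +_) (∑-*ˡ c xs f)) (sym (*-distribˡ-+ c (f x) _))

    ∑-*ʳ : ∀ c (xs : List A) f → (∑[ x ∈ xs ] (f x * c)) ≡ ∑ xs f * c
    ∑-*ʳ c xs f = trans (∑-cong xs (λ x → *-comm (f x) c)) (trans (∑-*ˡ c xs f) (*-comm c _))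

    ∑-const : ∀ (xs : List A) c → (∑[ _ ∈ xs ] c) ≡ length xs * c
    ∑-const [] c = refl
    ∑-const (x ∷ xs) c = cong (c +_) (∑-const xs c)

    ∑-0 : ∀ (xs : List A) {f} → (∀ x → f x ≡ 0) → ∑ xs f ≡ 0
    ∑-0 xs eq = trans (∑-cong xs eq) (trans (∑-const xs 0) (*-zeroʳ (length xs)))

    ∑-mono : ∀ (xs : List A) {f g} → (∀ x → f x ≤ g x) → ∑ xs f ≤ ∑ xs g
    ∑-mono [] le = z≤n
    ∑-mono (x ∷ xs) le = +-mono-≤ (le x) (∑-mono xs le)

    ∑-term : ∀ {xs : List A} f {x} → x ∈ xs → f x ≤ ∑ xs f
    ∑-term f (here refl) = m≤m+n _ _
    ∑-term f (there p) = ≤-trans (∑-term f p) (m≤n+m _ _)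

    ∑≢0 : ∀ (xs : List A) f → ∑ xs f ≢ 0 → ∃ λ x → f x ≢ 0
    ∑≢0 [] f ne = ⊥-elim (ne refl)
    ∑≢0 (x ∷ xs) f ne with f x in eq
    ... | zero = ∑≢0 xs f ne
    ... | suc k = x , λ fx≡0 → 1+n≢0 (trans (sym eq) fx≡0)

  ∑-swap : ∀ {A B : Set} (xs : List A) (ys : List B) (f : A → B → ℕ) →
    (∑[ x ∈ xs ] ∑[ y ∈ ys ] f x y) ≡ (∑[ y ∈ ys ] ∑[ x ∈ xs ] f x y)
  ∑-swap [] ys f = sym (∑-0 ys (λ _ → refl))
  ∑-swap (x ∷ xs) ys f = trans (cong (∑ ys (f x) +_) (∑-swap xs ys f)) (sym (∑-+ ys (f x) _))

  ind : ∀ {a} {P : Set a} → Dec P → ℕ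
  ind d = if does d then 1 else 0

  module _ {a : Level} {P : Set a} where

    ind-yes : (d : Dec P) → P → ind d ≡ 1
    ind-yes (yes _) p = refl
    ind-yes (no ¬p) p = ⊥-elim (¬p p)

    ind-no : (d : Dec P) → ¬ P → ind d ≡ 0
    ind-no (yes p) ¬p = ⊥-elim (¬p p)
    ind-no (no _) ¬p = refl

    ind≢0 : (d : Dec P) → ind d ≢ 0 → P
    ind≢0 (yes p) ne = p
    ind≢0 (no _) ne = ⊥-elim (ne refl)

  ind-⇔ : ∀ {a b} {P : Set a} {Q : Set b} (d : Dec P) (e : Dec Q) → (P → Q) → (Q → P) → ind d ≡ ind e
  ind-⇔ (yes p) e to from = sym (ind-yes e (to p))
  ind-⇔ (no ¬p) e to from = sym (ind-no e (¬p ∘ from))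

  ind-× : ∀ {a b c} {P : Set a} {Q : Set b} {R : Set c} (d : Dec R) (e : Dec P) (f : Dec Q) →
    (R → P × Q) → (P → Q → R) → ind d ≡ ind e * ind f
  ind-× d (yes p) f to from = trans (ind-⇔ d f (λ r → let _ , q = to r in q) (from p)) (sym (+-identityʳ _))
  ind-× d (no ¬p) f to from = ind-no d (λ r → let p , _ = to r in ¬p p)

  length-filter : ∀ {A : Set} {P : A → Set} (P? : ∀ x → Dec (P x)) xs →
    length (filter P? xs) ≡ (∑[ x ∈ xs ] ind (P? x))
  length-filter P? [] = refl
  length-filter P? (x ∷ xs) with P? x
  ... | yes _ = cong suc (length-filter P? xs)
  ... | no _ = length-filter P? xs

  module _ {A : Set} (_≟′_ : DecidableEquality A) where

    ∑-point : ∀ {xs : List A} → Unique xs → ∀ {y} → y ∈ xs → (g : A → ℕ) →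
      (∑[ x ∈ xs ] (ind (x ≟′ y) * g x)) ≡ g y
    ∑-point {x ∷ xs} (x∉ ∷ u) (here refl) g =
      trans (cong₂ _+_ (cong (_* g x) (ind-yes (x ≟′ x) refl)) (absent xs x∉)) (lem (g x))
      where
      lem : ∀ a → 1 * a + 0 ≡ a
      lem a = trans (+-identityʳ (1 * a)) (*-identityˡ a)
      absent : ∀ ys → All (x ≢_) ys → (∑[ z ∈ ys ] (ind (z ≟′ x) * g z)) ≡ 0
      absent [] [] = refl
      absent (z ∷ ys) (ne ∷ nes) = cong₂ _+_ (cong (_* g z) (ind-no (z ≟′ x) (ne ∘ sym))) (absent ys nes)
    ∑-point {x ∷ xs} (x∉ ∷ u) {y} (there p) g =
      trans (cong (λ i → i * g x + _) (ind-no (x ≟′ y) (differs x∉ p))) (∑-point u p g)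
      where
      differs : ∀ {xs : List A} {x y} → All (x ≢_) xs → y ∈ xs → x ≢ y
      differs (ne ∷ nes) (here refl) = ne
      differs (ne ∷ nes) (there q) = differs nes q

  -- Splitting off the last term suits triangular systems: `Σ< (suc k)` is the part already known
  -- plus the diagonal term.
  Σ< : ℕ → (ℕ → ℕ) → ℕ
  Σ< zero f = 0
  Σ< (suc n) f = Σ< n f + f n

  Σ<-cong : ∀ n {f g} → (∀ j → j < n → f j ≡ g j) → Σ< n f ≡ Σ< n g
  Σ<-cong zero eq = refl
  Σ<-cong (suc n) eq = cong₂ _+_ (Σ<-cong n (λ j j<n → eq j (m<n⇒m<1+n j<n))) (eq n ≤-refl)

  Σ<-0 : ∀ n {f} → (∀ j → j < n → f j ≡ 0) → Σ< n f ≡ 0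
  Σ<-0 zero eq = refl
  Σ<-0 (suc n) eq = cong₂ _+_ (Σ<-0 n (λ j j<n → eq j (m<n⇒m<1+n j<n))) (eq n ≤-refl)

  Σ<-+ : ∀ n f g → (Σ[ j < n ] (f j + g j)) ≡ Σ< n f + Σ< n g
  Σ<-+ zero f g = refl
  Σ<-+ (suc n) f g = trans (cong (_+ (f n + g n)) (Σ<-+ n f g)) (ℕ-interchange (Σ< n f) (Σ< n g) (f n) (g n))

  Σ<-*ˡ : ∀ c n f → (Σ[ j < n ] (c * f j)) ≡ c * Σ< n f
  Σ<-*ˡ c zero f = sym (*-zeroʳ c)
  Σ<-*ˡ c (suc n) f = trans (cong (_+ c * f n) (Σ<-*ˡ c n f)) (sym (*-distribˡ-+ c _ _))

  Σ<-term : ∀ n f {j} → j < n → f j ≤ Σ< n f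
  Σ<-term (suc n) f {j} j<1+n with m≤n⇒m<n∨m≡n (s≤s⁻¹ j<1+n)
  ... | inj₁ j<n = ≤-trans (Σ<-term n f j<n) (m≤m+n _ _)
  ... | inj₂ refl = m≤n+m _ _

  Σ<-peel : ∀ n f → Σ< (suc n) f ≡ f 0 + Σ< n (f ∘ suc)
  Σ<-peel zero f = sym (+-identityʳ _)
  Σ<-peel (suc n) f = trans (cong (_+ f (suc n)) (Σ<-peel n f)) (+-assoc (f 0) _ _)

  ∑-Σ<-swap : ∀ {A : Set} (xs : List A) n (f : A → ℕ → ℕ) →
    (∑[ x ∈ xs ] Σ[ j < n ] f x j) ≡ (Σ[ j < n ] ∑[ x ∈ xs ] f x j)
  ∑-Σ<-swap xs zero f = ∑-0 xs (λ _ → refl)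
  ∑-Σ<-swap xs (suc n) f =
    trans (∑-+ xs _ _) (cong (_+ (∑[ x ∈ xs ] f x n)) (∑-Σ<-swap xs n f))

  Σ<-ind : ∀ n w (f : ℕ → ℕ) → w < n → (Σ[ j < n ] (f j * ind (w ≟ j))) ≡ f w
  Σ<-ind (suc n) w f w<1+n with w ≟ n
  ... | yes refl = cong₂ _+_
      (Σ<-0 w λ j j<w → trans (cong (f j *_) (ind-no (w ≟ j) (>⇒≢ j<w))) (*-zeroʳ (f j)))
      (trans (cong (f w *_) (ind-yes (w ≟ w) refl)) (*-identityʳ (f w)))
  ... | no w≢n = trans (cong₂ _+_ (Σ<-ind n w f (≤∧≢⇒< (s≤s⁻¹ w<1+n) w≢n))
      (trans (cong (f n *_) (ind-no (w ≟ n) w≢n)) (*-zeroʳ (f n)))) (+-identityʳ _)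

open FiniteSums

-- Linear systems over 𝔽₃

𝔽₃ : Set
𝔽₃ = Fin 3

pattern 0₃ = zero
pattern 1₃ = suc zero
pattern 2₃ = suc (suc zero)

infixl 6 _+₃_
infixl 7 _*₃_ _•_

-₃_ : 𝔽₃ → 𝔽₃
-₃ 0₃ = 0₃
-₃ 1₃ = 2₃
-₃ 2₃ = 1₃

_+₃_ : 𝔽₃ → 𝔽₃ → 𝔽₃
0₃ +₃ b  = b
1₃ +₃ 0₃ = 1₃
1₃ +₃ 1₃ = 2₃
1₃ +₃ 2₃ = 0₃
2₃ +₃ 0₃ = 2₃
2₃ +₃ 1₃ = 0₃
2₃ +₃ 2₃ = 1₃

_*₃_ : 𝔽₃ → 𝔽₃ → 𝔽₃
0₃ *₃ b = 0₃
1₃ *₃ b = b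
2₃ *₃ b = -₃ b

isZero : 𝔽₃ → Bool
isZero 0₃ = true
isZero (suc _) = false

Col : ℕ → Set
Col r = Vec 𝔽₃ r

_•_ : ∀ {r} → Col r → Col r → 𝔽₃
[] • [] = 0₃
(a ∷ x) • (b ∷ y) = a *₃ b +₃ x • y

_✚_ : ∀ {r} → Col r → Col r → Col r
_✚_ = zipWith _+₃_

_✶_ : ∀ {r} → 𝔽₃ → Col r → Col r
c ✶ y = Vec.map (c *₃_) y

-- The coordinate forms. They vanish together only at `s = 0`, the one syndrome that the empty set
-- of columns reaches.
units : ∀ r → List (Col r)
units zero = []
units (suc r) = (1₃ ∷ replicate r 0₃) ∷ map (0₃ ∷_) (units r)

-- A pair (k , L) stands for the function of s whose value is q^k if y · s = 0 for all y in L,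
-- and 0 otherwise.
System : ℕ → Set
System r = ℕ × List (Col r)

-- nothing if all linear forms in L vanish on h, otherwise generators of those combinations of
-- the forms in L that do.
sweep : ∀ {r} → Col r → List (Col r) → Maybe (List (Col r))
sweepAt : ∀ {r} → 𝔽₃ → Col r → Col r → List (Col r) → Maybe (List (Col r))
sweep h [] = nothing
sweep h (y ∷ L) = sweepAt (y • h) h y L
sweepAt 0₃ h y L = Maybe.map (y ∷_) (sweep h L)
-- The first form not vanishing on `h` is the pivot: it fixes the coefficient of `h` and is used up,
-- and multiples of it make the later forms vanish on `h`. Since `c` is 1 or -1, multiplying by `c`
-- is dividing by it.
sweepAt c@(suc _) h y L = just (map (λ z → z ✚ ((-₃ (z • h *₃ c)) ✶ y)) L)

-- If `h` depends on the columns chosen before, its coefficient is free and brings a factor `q`;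
-- otherwise the solvability conditions become fewer by one.
extend : ∀ {r} → Col r → System r → System r
extend h (k , L) = maybe′ (λ L′ → k , L′) (suc k , L) (sweep h L)

-- One pair for every i-subset J of the columns: the number of e in F^J with H e = s.
systems : ∀ {r n} → ℕ → Vec (Col r) n → List (System r)
systems {r} zero hs = (0 , units r) ∷ []
systems (suc i) [] = []
systems (suc i) (h ∷ hs) = map (extend h) (systems i hs) ++ systems (suc i) hs

-- An empty list of forms comes from a set of columns that spans the whole space, so every syndrome
-- is reached.
unconstrained : ∀ {r} → List (System r) → Bool
unconstrained = any (λ S → null (proj₂ S))

allZero : ∀ {l} → Col l → Bool
allZero [] = true
allZero (c ∷ cs) = isZero c ∧ allZero cs

sat : ∀ {r l} → Vec (Col r) l → List (Col r) → Bool
sat ts L = all (λ y → allZero (Vec.map (y •_) ts)) L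

evalAt : ∀ {r l} → ℕ → List (System r) → Vec (Col r) l → ℕ
evalAt q [] ts = 0
evalAt q ((k , L) ∷ T) ts = (if sat ts L then q ^ k else 0) ℕ.+ evalAt q T ts

-- The coefficient of `q ^ k` when the moment is read as a polynomial in the field size.
hits : ∀ {r l} → ℕ → List (System r) → Vec (Col r) l → ℕ
hits k [] ts = 0
hits k ((k′ , L) ∷ T) ts = (if sat ts L ∧ (k ≡ᵇ k′) then 1 else 0) ℕ.+ hits k T ts

allCols : ∀ r → List (Col r)
allCols zero = [] ∷ []
allCols (suc r) = cartesianProductWith _∷_ (0₃ ∷ 1₃ ∷ 2₃ ∷ []) (allCols r)

-- A hyperplane determines its form up to sign. Making the first nonzero entry 1 chooses a
-- representative, so hyperplanes can be compared as vectors.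
normalise : ∀ {r} → Col r → Col r
normalise [] = []
normalise (0₃ ∷ y) = 0₃ ∷ normalise y
normalise (1₃ ∷ y) = 1₃ ∷ y
normalise (2₃ ∷ y) = 2₃ ✶ (2₃ ∷ y)

-- No form means `r` independent columns; one form means columns spanning a hyperplane, `r - 1` of
-- them for exponent 0 and `r` for exponent 1. The codes at hand need no other shape.
classify : ∀ {r} → List (System r) → Maybe (ℕ × List (Col r) × List (Col r))
classify [] = just (0 , [] , [])
classify ((0 , []) ∷ T) = Maybe.map (λ (c , a , b) → suc c , a , b) (classify T)
classify ((0 , y ∷ []) ∷ T) = Maybe.map (λ (c , a , b) → c , normalise y ∷ a , b) (classify T)
classify ((1 , y ∷ []) ∷ T) = Maybe.map (λ (c , a , b) → c , a , normalise y ∷ b) (classify T)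
classify _ = nothing

delete : ∀ {r} → Col r → List (Col r) → Maybe (List (Col r))
delete y [] = nothing
delete y (z ∷ zs) = if does (≡-dec Fin._≟_ y z) then just zs else Maybe.map (z ∷_) (delete y zs)

isPermutation : ∀ {r} → List (Col r) → List (Col r) → Bool
isPermutation [] [] = true
isPermutation [] (_ ∷ _) = false
isPermutation (x ∷ xs) ys = maybe′ (isPermutation xs) false (delete x ys)

repeat : ∀ {A : Set} → ℕ → List A → List A
repeat zero xs = []
repeat (suc n) xs = xs ++ repeat n xs

-- Checks that T consists of hyperplanes, and T′ of constants and q times hyperplanes, each
-- hyperplane occurring μ times as often in T.  Returns the number of constants.
proportional : ∀ {r} → ℕ → List (System r) → List (System r) → Maybe ℕ
proportional μ T T′ with classify T | classify T′
... | just (0 , a , []) | just (c , [] , b) = if isPermutation a (repeat μ b) then just c else nothing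
... | _ | _ = nothing

columns : ∀ {r n} → (Fin r → Fin n → 𝔽₃) → Vec (Col r) n
columns H = tabulate (λ j → tabulate (λ i → H i j))

-- [ -Mᵀ | I ], a parity check matrix of the row space of [ I | M ].
dualColumns : ∀ {k c} → (Fin k → Fin (k ℕ.+ c) → 𝔽₃) → Vec (Col c) (k ℕ.+ c)
dualColumns {k} {c} G =
  tabulate (λ i → tabulate (λ l → -₃ G i (k ↑ʳ l))) Vec.++
  tabulate (λ j → tabulate (λ l → if does (l Fin.≟ j) then 1₃ else 0₃))

-- Vectors over a field of characteristic 3

module Field (F : FiniteField) where
  open FiniteField F public
    using (Carrier; elements; complete; unique; inverse; _≟_; emb; 0#; 1#; 0≢1; isCommutativeRing)
    renaming (_+_ to infixl 6 _+_; _*_ to infixl 7 _*_; -_ to infix 8 -_)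

  commutativeRing : CommutativeRing _ _
  commutativeRing = record { isCommutativeRing = isCommutativeRing }

  open CommutativeRing commutativeRing public
    using (+-assoc; +-comm; +-identityˡ; +-identityʳ; -‿inverseˡ; -‿inverseʳ; *-assoc; *-comm;
           *-identityˡ; *-identityʳ; distribˡ; distribʳ; zeroˡ; zeroʳ)
  open RingProperties (CommutativeRing.ring commutativeRing) public
    using (-‿distribˡ-*; -‿distribʳ-*)
  open AbelianGroupProperties (CommutativeRing.+-abelianGroup commutativeRing) public
    using () renaming (⁻¹-∙-comm to -‿+-comm; ⁻¹-involutive to -‿involutive; ε⁻¹≈ε to -0#≡0#;
                       x∙y⁻¹≈ε⇒x≈y to x-y≡0⇒x≡y; inverseˡ-unique to x+y≡0⇒x≡-y)
  open CommutativeSemigroupProperties (CommutativeRing.+-commutativeSemigroup commutativeRing) public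
    using () renaming (interchange to +-interchange)

  q : ℕ
  q = order F

  q≢0 : q ≢ 0
  q≢0 eq with elements | complete 0#
  q≢0 () | _ ∷ _ | _

  δ : Carrier → ℕ
  δ x = ind (x ≟ 0#)

  infixl 6 _-_
  _-_ : Carrier → Carrier → Carrier
  x - y = x + - y

  x-x≡0 : ∀ x → x - x ≡ 0#
  x-x≡0 = -‿inverseʳ

  x-0≡x : ∀ x → x - 0# ≡ x
  x-0≡x x = trans (cong (x +_) -0#≡0#) (+-identityʳ x)

  x-[x-y]≡y : ∀ x y → x - (x - y) ≡ y
  x-[x-y]≡y x y = begin
    x + - (x + - y)     ≡⟨ cong (x +_) (-‿+-comm x (- y)) ⟨
    x + (- x + - - y)   ≡⟨ +-assoc x (- x) _ ⟨
    x + - x + - - y     ≡⟨ cong₂ _+_ (x-x≡0 x) (-‿involutive y) ⟩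
    0# + y              ≡⟨ +-identityˡ y ⟩
    y                   ∎
    where open ≡-Reasoning

  -‿interchange : ∀ a b c d → (a - b) + (c - d) ≡ (a + c) - (b + d)
  -‿interchange a b c d = trans (+-interchange a (- b) c (- d)) (cong (a + c +_) (-‿+-comm b d))

  ∑-at : ∀ y (g : Carrier → ℕ) → (∑[ x ∈ elements ] (ind (x ≟ y) ℕ.* g x)) ≡ g y
  ∑-at y g = ∑-point _≟_ unique (complete y) g

  ∑-bijection : (φ ψ : Carrier → Carrier) → (∀ x → φ (ψ x) ≡ x) → (∀ x → ψ (φ x) ≡ x) →
    (f : Carrier → ℕ) → ∑ elements (f ∘ φ) ≡ ∑ elements f
  ∑-bijection φ ψ φψ ψφ f = begin
    (∑[ x ∈ elements ] f (φ x))
      ≡⟨ ∑-cong elements (λ x → sym (∑-at (φ x) f)) ⟩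
    (∑[ x ∈ elements ] ∑[ y ∈ elements ] (ind (y ≟ φ x) ℕ.* f y))
      ≡⟨ ∑-swap elements elements _ ⟩
    (∑[ y ∈ elements ] ∑[ x ∈ elements ] (ind (y ≟ φ x) ℕ.* f y))
      ≡⟨ ∑-cong elements (λ y → ∑-cong elements λ x → cong (ℕ._* f y)
           (ind-⇔ (y ≟ φ x) (x ≟ ψ y) (λ { refl → sym (ψφ x) }) (λ { refl → sym (φψ y) }))) ⟩
    (∑[ y ∈ elements ] ∑[ x ∈ elements ] (ind (x ≟ ψ y) ℕ.* f y))
      ≡⟨ ∑-cong elements (λ y → ∑-at (ψ y) (λ _ → f y)) ⟩
    ∑ elements f ∎
    where open ≡-Reasoning

  V : ℕ → Set
  V = Vect F

  _≈_ : ∀ {n} → V n → V n → Set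
  _≈_ = _≋_ F

  Respects : ∀ {n} → (V n → ℕ) → Set
  Respects f = ∀ {u v} → u ≈ v → f u ≡ f v

  vectors : ∀ n → List (V n)
  vectors = allVecs F

  ∑-extend : ∀ {n} (ws : List (V n)) as (f : V (suc n) → ℕ) →
    ∑ (extendVecs F ws as) f ≡ (∑[ a ∈ as ] ∑[ w ∈ ws ] f (consV F a w))
  ∑-extend ws [] f = refl
  ∑-extend ws (a ∷ as) f = trans (∑-++ (map (consV F a) ws) _)
    (cong₂ ℕ._+_ (∑-map (consV F a) ws) (∑-extend ws as f))

  ∑-vectors : ∀ n (f : V (suc n) → ℕ) →
    ∑ (vectors (suc n)) f ≡ (∑[ a ∈ elements ] ∑[ w ∈ vectors n ] f (consV F a w))
  ∑-vectors n f = ∑-extend (vectors n) elements f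

  consV-cong : ∀ {n} {a b} {u v : V n} → a ≡ b → u ≈ v → consV F a u ≈ consV F b v
  consV-cong a≡b u≈v zero = a≡b
  consV-cong a≡b u≈v (suc i) = u≈v i

  -- The map `w ↦ v - w` is its own inverse. It exchanges codewords near `v` with error vectors.
  ∑-reflect : ∀ {n} (v : V n) {f} → Respects f →
    (∑[ w ∈ vectors n ] f (λ i → v i - w i)) ≡ ∑ (vectors n) f
  ∑-reflect {zero} v resp = cong (ℕ._+ 0) (resp λ ())
  ∑-reflect {suc n} v {f} resp = begin
    (∑[ w ∈ vectors (suc n) ] f (λ i → v i - w i))
      ≡⟨ ∑-vectors n _ ⟩
    (∑[ a ∈ elements ] ∑[ w ∈ vectors n ] f (λ i → v i - consV F a w i))
      ≡⟨ ∑-cong elements (λ a → ∑-cong (vectors n) λ w → resp λ { zero → refl ; (suc i) → refl }) ⟩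
    (∑[ a ∈ elements ] ∑[ w ∈ vectors n ] f (consV F (v zero - a) (λ i → v (suc i) - w i)))
      ≡⟨ ∑-cong elements (λ a → ∑-reflect (v ∘ suc) (λ eq → resp (consV-cong refl eq))) ⟩
    (∑[ a ∈ elements ] ∑[ w ∈ vectors n ] f (consV F (v zero - a) w))
      ≡⟨ ∑-bijection (λ a → v zero - a) (λ a → v zero - a) (x-[x-y]≡y (v zero)) (x-[x-y]≡y (v zero)) _ ⟩
    (∑[ a ∈ elements ] ∑[ w ∈ vectors n ] f (consV F a w))
      ≡⟨ ∑-vectors n f ⟨
    ∑ (vectors (suc n)) f ∎
    where open ≡-Reasoning

  zro : ∀ {n} → V n → ℕ
  zro {zero} v = 1
  zro {suc n} v = δ (v zero) ℕ.* zro (v ∘ suc)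

  zro-cong : ∀ {n} → Respects (zro {n})
  zro-cong {zero} eq = refl
  zro-cong {suc n} eq = cong₂ ℕ._*_ (cong δ (eq zero)) (zro-cong (eq ∘ suc))

  zro-yes : ∀ {n} {v : V n} → v ≈ zeroV F → zro v ≡ 1
  zro-yes {zero} eq = refl
  zro-yes {suc n} {v} eq = cong₂ ℕ._*_ (ind-yes (v zero ≟ 0#) (eq zero)) (zro-yes (eq ∘ suc))

  zro≢0 : ∀ {n} {v : V n} → zro v ≢ 0 → v ≈ zeroV F
  zro≢0 {v = v} ne zero = ind≢0 (v zero ≟ 0#) (λ eq → ne (cong (ℕ._* zro (v ∘ suc)) eq))
  zro≢0 {v = v} ne (suc i) =
    zro≢0 (λ eq → ne (trans (cong (δ (v zero) ℕ.*_) eq) (ℕₚ.*-zeroʳ (δ (v zero))))) i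

  ind≡zro : ∀ {n} {P : Set} (d : Dec P) {v : V n} → (P → v ≈ zeroV F) → (v ≈ zeroV F → P) → ind d ≡ zro v
  ind≡zro (yes p) to from = sym (zro-yes (to p))
  ind≡zro (no ¬p) {v} to from with zro v in eq
  ... | zero = refl
  ... | suc k = ⊥-elim (¬p (from (zro≢0 (λ z → ℕₚ.1+n≢0 (trans (sym eq) z)))))

module Ternary (F : FiniteField) (char3 : Char3 F) where
  open Field F

  infixr 8 _·_
  infixl 7 _⊙_

  -- With negation in place of multiplication by `1# + 1#`, elimination only uses the additive group
  -- of the field; `emb-*` links this to the matrices of the codes.
  _·_ : 𝔽₃ → Carrier → Carrier
  0₃ · x = 0#
  1₃ · x = x
  2₃ · x = - x

  x+x≡-x : ∀ x → x + x ≡ - x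
  x+x≡-x x = x+y≡0⇒x≡-y (x + x) x (begin
    x + x + x                          ≡⟨ cong₂ _+_ (cong₂ _+_ (*-identityˡ x) (*-identityˡ x)) (*-identityˡ x) ⟨
    1# * x + 1# * x + 1# * x           ≡⟨ cong (_+ 1# * x) (distribʳ x 1# 1#) ⟨
    (1# + 1#) * x + 1# * x             ≡⟨ distribʳ x (1# + 1#) 1# ⟨
    (1# + 1# + 1#) * x                 ≡⟨ cong (_* x) char3 ⟩
    0# * x                             ≡⟨ zeroˡ x ⟩
    0#                                 ∎)
    where open ≡-Reasoning

  emb-* : ∀ c x → emb c * x ≡ c · x
  emb-* 0₃ x = zeroˡ x
  emb-* 1₃ x = *-identityˡ x
  emb-* 2₃ x = trans (distribʳ x 1# 1#) (trans (cong₂ _+_ (*-identityˡ x) (*-identityˡ x)) (x+x≡-x x))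

  ·-zeroʳ : ∀ c → c · 0# ≡ 0#
  ·-zeroʳ 0₃ = refl
  ·-zeroʳ 1₃ = refl
  ·-zeroʳ 2₃ = -0#≡0#

  ·-neg : ∀ c x → (-₃ c) · x ≡ - (c · x)
  ·-neg 0₃ x = sym -0#≡0#
  ·-neg 1₃ x = refl
  ·-neg 2₃ x = sym (-‿involutive x)

  ·-+₃ : ∀ c d x → (c +₃ d) · x ≡ c · x + d · x
  ·-+₃ 0₃ d x = sym (+-identityˡ _)
  ·-+₃ 1₃ 0₃ x = sym (+-identityʳ _)
  ·-+₃ 1₃ 1₃ x = sym (x+x≡-x x)
  ·-+₃ 1₃ 2₃ x = sym (-‿inverseʳ x)
  ·-+₃ 2₃ 0₃ x = sym (+-identityʳ _)
  ·-+₃ 2₃ 1₃ x = sym (-‿inverseˡ x)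
  ·-+₃ 2₃ 2₃ x = sym (trans (x+x≡-x (- x)) (-‿involutive x))

  ·-*₃ : ∀ c d x → (c *₃ d) · x ≡ c · d · x
  ·-*₃ 0₃ d x = refl
  ·-*₃ 1₃ d x = refl
  ·-*₃ 2₃ d x = ·-neg d x

  ·-distrib-+ : ∀ c x y → c · (x + y) ≡ c · x + c · y
  ·-distrib-+ 0₃ x y = sym (+-identityˡ _)
  ·-distrib-+ 1₃ x y = refl
  ·-distrib-+ 2₃ x y = sym (-‿+-comm x y)

  ·-neg-comm : ∀ c x → c · (- x) ≡ - (c · x)
  ·-neg-comm 0₃ x = sym -0#≡0#
  ·-neg-comm 1₃ x = refl
  ·-neg-comm 2₃ x = refl

  ·-*-assoc : ∀ c x y → c · (x * y) ≡ (c · x) * y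
  ·-*-assoc 0₃ x y = sym (zeroˡ y)
  ·-*-assoc 1₃ x y = refl
  ·-*-assoc 2₃ x y = -‿distribˡ-* x y

  _⊙_ : ∀ {r} → Col r → V r → Carrier
  [] ⊙ s = 0#
  (c ∷ y) ⊙ s = c · s zero + y ⊙ (s ∘ suc)

  ⊙-cong : ∀ {r} (y : Col r) {s t} → s ≈ t → y ⊙ s ≡ y ⊙ t
  ⊙-cong [] eq = refl
  ⊙-cong (c ∷ y) eq = cong₂ _+_ (cong (c ·_) (eq zero)) (⊙-cong y (eq ∘ suc))

  ⊙-✚ : ∀ {r} (y z : Col r) s → (y ✚ z) ⊙ s ≡ y ⊙ s + z ⊙ s
  ⊙-✚ [] [] s = sym (+-identityˡ _)
  ⊙-✚ (c ∷ y) (d ∷ z) s = trans (cong₂ _+_ (·-+₃ c d _) (⊙-✚ y z (s ∘ suc))) (+-interchange _ _ _ _)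

  ⊙-✶ : ∀ {r} c (y : Col r) s → (c ✶ y) ⊙ s ≡ c · (y ⊙ s)
  ⊙-✶ c [] s = sym (·-zeroʳ c)
  ⊙-✶ c (d ∷ y) s = trans (cong₂ _+_ (·-*₃ c d _) (⊙-✶ c y (s ∘ suc))) (sym (·-distrib-+ c _ _))

  ⊙-0₃ : ∀ {r} (s : V r) → replicate r 0₃ ⊙ s ≡ 0#
  ⊙-0₃ {zero} s = refl
  ⊙-0₃ {suc r} s = trans (+-identityˡ _) (⊙-0₃ (s ∘ suc))

  shift : ∀ {r} → V r → Col r → Carrier → V r
  shift s h a i = s i - lookup h i · a

  ⊙-shift : ∀ {r} (y : Col r) s h a → y ⊙ shift s h a ≡ y ⊙ s - (y • h) · a
  ⊙-shift [] s [] a = sym (x-0≡x 0#)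
  ⊙-shift (c ∷ y) s (d ∷ h) a = begin
    c · (s zero - d · a) + y ⊙ shift (s ∘ suc) h a
      ≡⟨ cong₂ _+_ (·-distrib-+ c _ _) (⊙-shift y (s ∘ suc) h a) ⟩
    (c · s zero + c · (- (d · a))) + (y ⊙ (s ∘ suc) - (y • h) · a)
      ≡⟨ cong (λ z → (c · s zero + z) + _) (trans (·-neg-comm c _) (cong -_ (sym (·-*₃ c d a)))) ⟩
    (c · s zero - (c *₃ d) · a) + (y ⊙ (s ∘ suc) - (y • h) · a)
      ≡⟨ -‿interchange _ _ _ _ ⟩
    (c · s zero + y ⊙ (s ∘ suc)) - ((c *₃ d) · a + (y • h) · a)
      ≡⟨ cong (λ z → (c · s zero + y ⊙ (s ∘ suc)) - z) (sym (·-+₃ (c *₃ d) (y • h) a)) ⟩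
    (c · s zero + y ⊙ (s ∘ suc)) - (c *₃ d +₃ y • h) · a ∎
    where open ≡-Reasoning

  ∏δ : ∀ {r} → List (Col r) → V r → ℕ
  ∏δ [] s = 1
  ∏δ (y ∷ L) s = δ (y ⊙ s) ℕ.* ∏δ L s

  ∏δ-cong : ∀ {r} (L : List (Col r)) → Respects (∏δ L)
  ∏δ-cong [] eq = refl
  ∏δ-cong (y ∷ L) eq = cong₂ ℕ._*_ (cong δ (⊙-cong y eq)) (∏δ-cong L eq)

  ⊙-shift-⊥ : ∀ {r} (y : Col r) s h a → y • h ≡ 0₃ → y ⊙ shift s h a ≡ y ⊙ s
  ⊙-shift-⊥ y s h a eq = trans (⊙-shift y s h a) (trans (cong (λ c → y ⊙ s - c · a) eq) (x-0≡x _))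

  sweep-nothing : ∀ {r} (h : Col r) L → sweep h L ≡ nothing → ∀ s a → ∏δ L (shift s h a) ≡ ∏δ L s
  sweep-nothing h [] eq s a = refl
  sweep-nothing h (y ∷ L) eq s a with y • h in yh
  sweep-nothing h (y ∷ L) eq s a | 0₃ with sweep h L in sw
  ... | nothing = cong₂ ℕ._*_ (cong δ (⊙-shift-⊥ y s h a yh)) (sweep-nothing h L sw s a)

  ·-invol : ∀ i x → suc i · suc i · x ≡ x
  ·-invol 0₃ x = refl
  ·-invol 1₃ x = -‿involutive x

  ·-solve : ∀ i x a → ind ((x - suc i · a) ≟ 0#) ≡ ind (a ≟ (suc i · x))
  ·-solve i x a = ind-⇔ ((x - suc i · a) ≟ 0#) (a ≟ (suc i · x))
    (λ eq → sym (trans (cong (suc i ·_) (x-y≡0⇒x≡y _ _ eq)) (·-invol i a)))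
    (λ { refl → trans (cong (λ z → x - z) (·-invol i x)) (x-x≡0 x) })

  ⊙-eliminate : ∀ {r} (z y h : Col r) c s →
    z ⊙ shift s h (c · (y ⊙ s)) ≡ (z ✚ ((-₃ (z • h *₃ c)) ✶ y)) ⊙ s
  ⊙-eliminate z y h c s = begin
    z ⊙ shift s h (c · (y ⊙ s))                 ≡⟨ ⊙-shift z s h _ ⟩
    z ⊙ s - (z • h) · c · (y ⊙ s)                ≡⟨ cong (λ w → z ⊙ s - w) (·-*₃ (z • h) c _) ⟨
    z ⊙ s - (z • h *₃ c) · (y ⊙ s)               ≡⟨ cong (z ⊙ s +_) (·-neg (z • h *₃ c) _) ⟨
    z ⊙ s + (-₃ (z • h *₃ c)) · (y ⊙ s)          ≡⟨ cong (z ⊙ s +_) (⊙-✶ (-₃ (z • h *₃ c)) y s) ⟨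
    z ⊙ s + ((-₃ (z • h *₃ c)) ✶ y) ⊙ s          ≡⟨ ⊙-✚ z _ s ⟨
    (z ✚ ((-₃ (z • h *₃ c)) ✶ y)) ⊙ s ∎
    where open ≡-Reasoning

  ∏δ-eliminate : ∀ {r} (L : List (Col r)) y h c s →
    ∏δ L (shift s h (c · (y ⊙ s))) ≡ ∏δ (map (λ z → z ✚ ((-₃ (z • h *₃ c)) ✶ y)) L) s
  ∏δ-eliminate [] y h c s = refl
  ∏δ-eliminate (z ∷ L) y h c s = cong₂ ℕ._*_ (cong δ (⊙-eliminate z y h c s)) (∏δ-eliminate L y h c s)

  -- Forms before the pivot do not see `a`. The pivot leaves a single `a` in the sum, and
  -- substituting that value into the later forms is the elimination step.
  sweep-just : ∀ {r} (h : Col r) L {L′} → sweep h L ≡ just L′ → ∀ s →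
    (∑[ a ∈ elements ] ∏δ L (shift s h a)) ≡ ∏δ L′ s
  sweep-just h (y ∷ L) eq s with y • h in yh
  sweep-just h (y ∷ L) refl s | suc i = begin
    (∑[ a ∈ elements ] (δ (y ⊙ shift s h a) ℕ.* ∏δ L (shift s h a)))
      ≡⟨ ∑-cong elements (λ a → cong (ℕ._* ∏δ L (shift s h a))
           (trans (cong δ (trans (⊙-shift y s h a) (cong (λ c → y ⊙ s - c · a) yh))) (·-solve i (y ⊙ s) a))) ⟩
    (∑[ a ∈ elements ] (ind (a ≟ (suc i · (y ⊙ s))) ℕ.* ∏δ L (shift s h a)))
      ≡⟨ ∑-at (suc i · (y ⊙ s)) (λ a → ∏δ L (shift s h a)) ⟩
    ∏δ L (shift s h (suc i · (y ⊙ s)))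
      ≡⟨ ∏δ-eliminate L y h (suc i) s ⟩
    ∏δ (map (λ z → z ✚ ((-₃ (z • h *₃ suc i)) ✶ y)) L) s ∎
    where open ≡-Reasoning
  sweep-just h (y ∷ L) eq s | 0₃ with sweep h L in sw
  sweep-just h (y ∷ L) refl s | 0₃ | just L′ = begin
    (∑[ a ∈ elements ] (δ (y ⊙ shift s h a) ℕ.* ∏δ L (shift s h a)))
      ≡⟨ ∑-cong elements (λ a → cong (λ z → δ z ℕ.* ∏δ L (shift s h a)) (⊙-shift-⊥ y s h a yh)) ⟩
    (∑[ a ∈ elements ] (δ (y ⊙ s) ℕ.* ∏δ L (shift s h a)))
      ≡⟨ ∑-*ˡ (δ (y ⊙ s)) elements _ ⟩
    δ (y ⊙ s) ℕ.* (∑[ a ∈ elements ] ∏δ L (shift s h a))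
      ≡⟨ cong (δ (y ⊙ s) ℕ.*_) (sweep-just h L sw s) ⟩
    δ (y ⊙ s) ℕ.* ∏δ L′ s ∎
    where open ≡-Reasoning

  value : ∀ {r} → System r → V r → ℕ
  value (k , L) s = q ^ k ℕ.* ∏δ L s

  -- Enlarging `J` by a column means summing over its coefficient `a`; this is the correctness of
  -- `extend`.
  ∑-value-shift : ∀ {r} (h : Col r) S s →
    (∑[ a ∈ elements ] value S (shift s h a)) ≡ value (extend h S) s
  ∑-value-shift h (k , L) s with sweep h L in sw
  ... | just L′ = trans (∑-*ˡ (q ^ k) elements _) (cong (q ^ k ℕ.*_) (sweep-just h L sw s))
  ... | nothing = begin
    (∑[ a ∈ elements ] (q ^ k ℕ.* ∏δ L (shift s h a)))
      ≡⟨ ∑-cong elements (λ a → cong (q ^ k ℕ.*_) (sweep-nothing h L sw s a)) ⟩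
    (∑[ _ ∈ elements ] (q ^ k ℕ.* ∏δ L s))   ≡⟨ ∑-const elements _ ⟩
    q ℕ.* (q ^ k ℕ.* ∏δ L s)                 ≡⟨ ℕₚ.*-assoc q (q ^ k) _ ⟨
    q ^ suc k ℕ.* ∏δ L s                     ∎
    where open ≡-Reasoning

  ∏δ-units : ∀ {r} (s : V r) → ∏δ (units r) s ≡ zro s
  ∏δ-units {zero} s = refl
  ∏δ-units {suc r} s = cong₂ ℕ._*_
    (cong δ (trans (cong (s zero +_) (⊙-0₃ (s ∘ suc))) (+-identityʳ _)))
    (trans (lifted (units r)) (∏δ-units (s ∘ suc)))
    where
    lifted : ∀ L → ∏δ (map (0₃ ∷_) L) s ≡ ∏δ L (s ∘ suc)
    lifted [] = refl
    lifted (y ∷ L) = cong₂ ℕ._*_ (cong δ (+-identityˡ _)) (lifted L)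

-- Moments of a parity check matrix

binomial : ℕ → ℕ → ℕ
binomial z zero = 1
binomial zero (suc i) = 0
binomial (suc z) (suc i) = binomial z i ℕ.+ binomial z (suc i)

-- The number of i-subsets of a (w + z)-set that contain a given w-subset.
coverings : ℕ → ℕ → ℕ → ℕ
coverings zero z i = binomial z i
coverings (suc w) z zero = 0
coverings (suc w) z (suc i) = coverings w z i

coverings-zero : ∀ w z → coverings w (suc z) 0 ≡ coverings w z 0
coverings-zero zero z = refl
coverings-zero (suc w) z = refl

-- Pascal's rule for an element outside the given `w`-subset, which is either taken or not.
coverings-suc : ∀ w z i → coverings w (suc z) (suc i) ≡ coverings w z i ℕ.+ coverings w z (suc i)
coverings-suc zero z i = refl
coverings-suc (suc w) z zero = coverings-zero w z
coverings-suc (suc w) z (suc i) = coverings-suc w z i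

coverings-> : ∀ {w} z {i} → i < w → coverings w z i ≡ 0
coverings-> {suc w} z {zero} i<w = refl
coverings-> {suc w} z {suc i} i<w = coverings-> {w} z (s≤s⁻¹ i<w)

coverings-diag : ∀ w z → coverings w z w ≡ 1
coverings-diag zero z = refl
coverings-diag (suc w) z = coverings-diag w z

binomial-pos : ∀ {z i} → i ≤ z → binomial z i ≢ 0
binomial-pos {z} {zero} i≤z ()
binomial-pos {suc z} {suc i} i≤z eq = binomial-pos (s≤s⁻¹ i≤z) (ℕₚ.m+n≡0⇒m≡0 _ eq)

coverings-pos : ∀ {j n i} → j ≤ i → i ≤ n → coverings j (n ∸ j) i ≢ 0
coverings-pos {zero} j≤i i≤n = binomial-pos i≤n
coverings-pos {suc j} {suc n} {suc i} j≤i i≤n = coverings-pos (s≤s⁻¹ j≤i) (s≤s⁻¹ i≤n)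

Σ<≢0 : ∀ n f → Σ< n f ≢ 0 → ∃ λ j → j < n × f j ≢ 0
Σ<≢0 zero f ne = ⊥-elim (ne refl)
Σ<≢0 (suc n) f ne with f n ℕ.≟ 0
... | no fn≢0 = n , ℕₚ.≤-refl , fn≢0
... | yes fn≡0 with j , j<n , fj≢0 ← Σ<≢0 n f (λ eq → ne (cong₂ ℕ._+_ eq fn≡0)) =
  j , ℕₚ.m<n⇒m<1+n j<n , fj≢0

module Syndromes (F : FiniteField) (char3 : Char3 F) where
  open Field F
  open Ternary F char3

  shift-cong : ∀ {r} {s t : V r} h a → s ≈ t → shift s h a ≈ shift t h a
  shift-cong h a eq i = cong (_- lookup h i · a) (eq i)

  shift-0 : ∀ {r} (s : V r) h → shift s h 0# ≈ s
  shift-0 s h i = trans (cong (λ z → s i - z) (·-zeroʳ (lookup h i))) (x-0≡x (s i))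

  -- The difference of `s` and the syndrome of `e`, accumulated column by column so that it follows
  -- the recursion of `systems`.
  residual : ∀ {r n} → Vec (Col r) n → V r → V n → V r
  residual [] s e = s
  residual (h ∷ hs) s e = residual hs (shift s h (e zero)) (e ∘ suc)

  residual-cong : ∀ {r n} (hs : Vec (Col r) n) {s t e} → s ≈ t → residual hs s e ≈ residual hs t e
  residual-cong [] eq = eq
  residual-cong (h ∷ hs) {e = e} eq = residual-cong hs (shift-cong h (e zero) eq)

  -- The number of `i`-sets that contain the support of `e`, by recursion on coordinates;
  -- `covers≡coverings` shows that only the weight matters.
  covers : ∀ {n} → V n → ℕ → ℕ
  covers {zero} e zero = 1
  covers {zero} e (suc i) = 0
  covers {suc n} e zero = δ (e zero) ℕ.* covers (e ∘ suc) zero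
  covers {suc n} e (suc i) = covers (e ∘ suc) i ℕ.+ δ (e zero) ℕ.* covers (e ∘ suc) (suc i)

  -- Counts the pairs (J, e) where J is an i-set of coordinates and the vector e,
  -- supported in J, has syndrome s.
  moment : ∀ {r n} → ℕ → Vec (Col r) n → V r → ℕ
  moment {n = n} i hs s = ∑[ e ∈ vectors n ] (zro (residual hs s e) ℕ.* covers e i)

  moment-cong : ∀ {r n} i (hs : Vec (Col r) n) → Respects (moment i hs)
  moment-cong {n = n} i hs eq =
    ∑-cong (vectors n) (λ e → cong (ℕ._* covers e i) (zro-cong (residual-cong hs eq)))

  ∑-δ-moment : ∀ {r n} i h (hs : Vec (Col r) n) s →
    (∑[ a ∈ elements ] (δ a ℕ.* moment i hs (shift s h a))) ≡ moment i hs s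
  ∑-δ-moment i h hs s = trans (∑-at 0# (λ a → moment i hs (shift s h a))) (moment-cong i hs (shift-0 s h))

  private
    expand : ∀ a b c d → a ℕ.* (b ℕ.+ c ℕ.* d) ≡ a ℕ.* b ℕ.+ c ℕ.* (a ℕ.* d)
    expand = solve 4 (λ a b c d → a :* (b :+ c :* d) := a :* b :+ c :* (a :* d)) refl
      where open ℕ-Solver.+-*-Solver

  moment-zero : ∀ {r n} h (hs : Vec (Col r) n) s → moment 0 (h ∷ hs) s ≡ moment 0 hs s
  moment-zero {n = n} h hs s = begin
    moment 0 (h ∷ hs) s
      ≡⟨ ∑-vectors n _ ⟩
    (∑[ a ∈ elements ] ∑[ w ∈ vectors n ] (zro (residual hs (shift s h a) w) ℕ.* (δ a ℕ.* covers w 0)))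
      ≡⟨ ∑-cong elements (λ a → trans (∑-cong (vectors n) λ w → m*[n*o]≡n*[m*o] (zro (residual hs (shift s h a) w)) (δ a) _)
           (∑-*ˡ (δ a) (vectors n) _)) ⟩
    (∑[ a ∈ elements ] (δ a ℕ.* moment 0 hs (shift s h a)))
      ≡⟨ ∑-δ-moment 0 h hs s ⟩
    moment 0 hs s ∎
    where open ≡-Reasoning

  -- If the first coordinate is in `J`, its entry `a` is arbitrary; if not, the entry must be 0.
  moment-suc : ∀ {r n} i h (hs : Vec (Col r) n) s →
    moment (suc i) (h ∷ hs) s ≡ (∑[ a ∈ elements ] moment i hs (shift s h a)) ℕ.+ moment (suc i) hs s
  moment-suc {n = n} i h hs s = begin
    moment (suc i) (h ∷ hs) s
      ≡⟨ ∑-vectors n _ ⟩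
    (∑[ a ∈ elements ] ∑[ w ∈ vectors n ]
      (zro (residual hs (shift s h a) w) ℕ.* (covers w i ℕ.+ δ a ℕ.* covers w (suc i))))
      ≡⟨ ∑-cong elements (λ a → trans
           (∑-cong (vectors n) λ w → expand (zro (residual hs (shift s h a) w)) (covers w i) (δ a) _)
           (trans (∑-+ (vectors n) _ _) (cong (moment i hs (shift s h a) ℕ.+_) (∑-*ˡ (δ a) (vectors n) _)))) ⟩
    (∑[ a ∈ elements ] (moment i hs (shift s h a) ℕ.+ δ a ℕ.* moment (suc i) hs (shift s h a)))
      ≡⟨ ∑-+ elements _ _ ⟩
    (∑[ a ∈ elements ] moment i hs (shift s h a)) ℕ.+
      (∑[ a ∈ elements ] (δ a ℕ.* moment (suc i) hs (shift s h a)))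
      ≡⟨ cong ((∑[ a ∈ elements ] moment i hs (shift s h a)) ℕ.+_) (∑-δ-moment (suc i) h hs s) ⟩
    (∑[ a ∈ elements ] moment i hs (shift s h a)) ℕ.+ moment (suc i) hs s ∎
    where open ≡-Reasoning

  total : ∀ {r} → List (System r) → V r → ℕ
  total T s = ∑[ S ∈ T ] value S s

  -- Both sides satisfy the same recursion in the first column, the left by `moment-suc` and the
  -- right by `∑-value-shift`.
  moment≡total : ∀ {r n} i (hs : Vec (Col r) n) s → moment i hs s ≡ total (systems i hs) s
  moment≡total zero [] s = cong (ℕ._+ 0) (trans (ℕₚ.*-identityʳ (zro s))
    (trans (sym (∏δ-units s)) (sym (ℕₚ.+-identityʳ _))))
  moment≡total (suc i) [] s = trans (ℕₚ.+-identityʳ _) (ℕₚ.*-zeroʳ (zro s))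
  moment≡total zero (h ∷ hs) s = trans (moment-zero h hs s) (moment≡total zero hs s)
  moment≡total (suc i) (h ∷ hs) s = begin
    moment (suc i) (h ∷ hs) s
      ≡⟨ moment-suc i h hs s ⟩
    (∑[ a ∈ elements ] moment i hs (shift s h a)) ℕ.+ moment (suc i) hs s
      ≡⟨ cong₂ ℕ._+_ (∑-cong elements λ a → moment≡total i hs (shift s h a)) (moment≡total (suc i) hs s) ⟩
    (∑[ a ∈ elements ] total (systems i hs) (shift s h a)) ℕ.+ total (systems (suc i) hs) s
      ≡⟨ cong (ℕ._+ _) (∑-swap elements (systems i hs) _) ⟩
    (∑[ S ∈ systems i hs ] ∑[ a ∈ elements ] value S (shift s h a)) ℕ.+ total (systems (suc i) hs) s
      ≡⟨ cong (ℕ._+ _) (∑-cong (systems i hs) λ S → ∑-value-shift h S s) ⟩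
    (∑[ S ∈ systems i hs ] value (extend h S) s) ℕ.+ total (systems (suc i) hs) s
      ≡⟨ cong (ℕ._+ _) (∑-map (extend h) (systems i hs)) ⟨
    total (map (extend h) (systems i hs)) s ℕ.+ total (systems (suc i) hs) s
      ≡⟨ ∑-++ (map (extend h) (systems i hs)) _ ⟨
    total (systems (suc i) (h ∷ hs)) s ∎
    where open ≡-Reasoning

  wt : ∀ {n} → V n → ℕ
  wt = weight F

  wt≤n : ∀ {n} (e : V n) → wt e ≤ n
  wt≤n {zero} e = z≤n
  wt≤n {suc n} e with e zero ≟ 0#
  ... | yes _ = ℕₚ.m≤n⇒m≤1+n (wt≤n (e ∘ suc))
  ... | no _ = s≤s (wt≤n (e ∘ suc))

  covers≡coverings : ∀ {n} (e : V n) i → covers e i ≡ coverings (wt e) (n ∸ wt e) i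
  covers≡coverings {zero} e zero = refl
  covers≡coverings {zero} e (suc i) = refl
  covers≡coverings {suc n} e zero with e zero ≟ 0#
  ... | yes _ = trans (ℕₚ.+-identityʳ _) (trans (covers≡coverings (e ∘ suc) 0)
    (trans (sym (coverings-zero w _)) (cong (λ z → coverings w z 0) (sym (ℕₚ.+-∸-assoc 1 (wt≤n (e ∘ suc)))))))
    where w = wt (e ∘ suc)
  ... | no _ = refl
  covers≡coverings {suc n} e (suc i) with e zero ≟ 0#
  ... | yes _ = trans (cong₂ ℕ._+_ (covers≡coverings (e ∘ suc) i)
      (trans (ℕₚ.+-identityʳ _) (covers≡coverings (e ∘ suc) (suc i))))
    (trans (sym (coverings-suc w _ i)) (cong (λ z → coverings w z (suc i)) (sym (ℕₚ.+-∸-assoc 1 (wt≤n (e ∘ suc))))))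
    where w = wt (e ∘ suc)
  ... | no _ = trans (ℕₚ.+-identityʳ _) (covers≡coverings (e ∘ suc) i)

  syndrome : ∀ {r n} → Vec (Col r) n → V n → V r
  syndrome [] v i = 0#
  syndrome (h ∷ hs) v i = lookup h i · v zero + syndrome hs (v ∘ suc) i

  residual-syndrome : ∀ {r n} (hs : Vec (Col r) n) s e → residual hs s e ≈ λ i → s i - syndrome hs e i
  residual-syndrome [] s e i = sym (x-0≡x (s i))
  residual-syndrome (h ∷ hs) s e i = begin
    residual hs (shift s h (e zero)) (e ∘ suc) i
      ≡⟨ residual-syndrome hs _ (e ∘ suc) i ⟩
    s i - lookup h i · e zero - syndrome hs (e ∘ suc) i
      ≡⟨ +-assoc (s i) _ _ ⟩
    s i + (- (lookup h i · e zero) - syndrome hs (e ∘ suc) i)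
      ≡⟨ cong (s i +_) (-‿+-comm _ _) ⟩
    s i - (lookup h i · e zero + syndrome hs (e ∘ suc) i) ∎
    where open ≡-Reasoning

  syndrome-cong : ∀ {r n} (hs : Vec (Col r) n) {u v} → u ≈ v → syndrome hs u ≈ syndrome hs v
  syndrome-cong [] eq i = refl
  syndrome-cong (h ∷ hs) eq i = cong₂ _+_ (cong (lookup h i ·_) (eq zero)) (syndrome-cong hs (eq ∘ suc) i)

  syndrome-- : ∀ {r n} (hs : Vec (Col r) n) u v i →
    syndrome hs (λ k → u k - v k) i ≡ syndrome hs u i - syndrome hs v i
  syndrome-- [] u v i = sym (x-0≡x 0#)
  syndrome-- (h ∷ hs) u v i = trans
    (cong₂ _+_ (trans (·-distrib-+ (lookup h i) _ _) (cong (lookup h i · u zero +_) (·-neg-comm (lookup h i) _)))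
               (syndrome-- hs (u ∘ suc) (v ∘ suc) i))
    (-‿interchange _ _ _ _)

  dist≡wt : ∀ {n} (u v : V n) → dist F u v ≡ wt (λ i → u i - v i)
  dist≡wt {zero} u v = refl
  dist≡wt {suc n} u v with u zero ≟ v zero | (u zero - v zero) ≟ 0#
  ... | yes _ | yes _ = dist≡wt (u ∘ suc) (v ∘ suc)
  ... | no _ | no _ = cong suc (dist≡wt (u ∘ suc) (v ∘ suc))
  ... | yes eq | no ne = ⊥-elim (ne (trans (cong (_- v zero) eq) (x-x≡0 _)))
  ... | no ne | yes eq = ⊥-elim (ne (x-y≡0⇒x≡y _ _ eq))

  wt-cong : ∀ {n} → Respects (wt {n})
  wt-cong {zero} eq = refl
  wt-cong {suc n} {u} {v} eq rewrite eq zero = cong (_ ℕ.+_) (wt-cong (eq ∘ suc))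

  dist-cong : ∀ {n} {u u′ v v′ : V n} → u ≈ u′ → v ≈ v′ → dist F u v ≡ dist F u′ v′
  dist-cong {u = u} {u′} {v} {v′} eq eq′ =
    trans (dist≡wt u v) (trans (wt-cong (λ i → cong₂ _-_ (eq i) (eq′ i))) (sym (dist≡wt u′ v′)))

  B≢0⇒close : ∀ {n} (C : Code F n) j v → B F j v C ≢ 0 → ∃ λ c → mem C c × dist F v c ≡ j
  B≢0⇒close {n} C j v ne with w , p ← ∑≢0 (vectors n) _ (λ eq → ne (trans (length-filter _ (vectors n)) eq)) =
    w , ind≢0 (mem? C w ×-dec (dist F v w ℕ.≟ j)) p

  close⇒B≢0 : ∀ {n} (C : Code F n) v {c} → mem C c → B F (dist F v c) v C ≢ 0
  close⇒B≢0 {n} C v {c} c∈C eq with w , w∈ , c≈w ← find (allVecs-complete F n c) =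
    ℕₚ.1+n≰n (begin
      1                         ≡⟨ ind-yes (P? w) (resp C c≈w c∈C , dist-cong (λ _ → refl) (sym ∘ c≈w)) ⟨
      ind (P? w)                ≤⟨ ∑-term (ind ∘ P?) w∈ ⟩
      ∑ (vectors n) (ind ∘ P?)  ≡⟨ length-filter P? (vectors n) ⟨
      B F (dist F v c) v C      ≡⟨ eq ⟩
      0                         ∎)
    where
    open ℕₚ.≤-Reasoning
    P? = λ w → mem? C w ×-dec (dist F v w ℕ.≟ dist F v c)

  record ParityCheck {r n : ℕ} (C : Code F n) (hs : Vec (Col r) n) : Set where
    field
      annihilates : ∀ {c} → mem C c → syndrome hs c ≈ zeroV F
      detects     : ∀ {c} → syndrome hs c ≈ zeroV F → mem C c

  module Parity {r n : ℕ} {C : Code F n} {hs : Vec (Col r) n} (check : ParityCheck C hs) where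
    open ParityCheck check

    -- Substitute `e = v - c`: then `c` is a codeword exactly when `e` has the syndrome of `v`, and
    -- the distance becomes a weight.
    B≡∑ : ∀ j v → B F j v C ≡
      (∑[ e ∈ vectors n ] (zro (residual hs (syndrome hs v) e) ℕ.* ind (wt e ℕ.≟ j)))
    B≡∑ j v = begin
      B F j v C
        ≡⟨ length-filter _ (vectors n) ⟩
      (∑[ c ∈ vectors n ] ind (mem? C c ×-dec (dist F v c ℕ.≟ j)))
        ≡⟨ ∑-cong (vectors n) (λ c → trans
             (ind-× (mem? C c ×-dec (dist F v c ℕ.≟ j)) (mem? C c) (dist F v c ℕ.≟ j) (λ p → p) _,_)
             (cong₂ ℕ._*_
               (trans (ind≡zro (mem? C c) annihilates detects) (zro-cong (λ i → sym (residual-difference c i))))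
               (cong (λ d → ind (d ℕ.≟ j)) (dist≡wt v c)))) ⟩
      (∑[ c ∈ vectors n ] f (λ i → v i - c i))
        ≡⟨ ∑-reflect v f-cong ⟩
      ∑ (vectors n) f ∎
      where
      open ≡-Reasoning
      f : V n → ℕ
      f e = zro (residual hs (syndrome hs v) e) ℕ.* ind (wt e ℕ.≟ j)
      f-cong : Respects f
      f-cong {e} {e′} eq = cong₂ ℕ._*_
        (zro-cong λ i → trans (residual-syndrome hs _ e i)
          (trans (cong (λ x → syndrome hs v i - x) (syndrome-cong hs eq i)) (sym (residual-syndrome hs _ e′ i))))
        (cong (λ d → ind (d ℕ.≟ j)) (wt-cong eq))
      residual-difference : ∀ c → residual hs (syndrome hs v) (λ i → v i - c i) ≈ syndrome hs c
      residual-difference c i = trans (residual-syndrome hs _ _ i)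
        (trans (cong (λ x → syndrome hs v i - x) (syndrome-- hs v c i)) (x-[x-y]≡y _ _))

    S : ℕ → V n → ℕ
    S i v = total (systems i hs) (syndrome hs v)

    -- Sort the pairs (J, e) by the weight `j` of `e`, which alone decides how many `J` contain its
    -- support. Weights above `i` contribute nothing, so any `R` from `i` on may bound the sum.
    S≡ΣB : ∀ {i R} → i ≤ R → ∀ v →
      S i v ≡ (Σ[ j < suc R ] (coverings j (n ∸ j) i ℕ.* B F j v C))
    S≡ΣB {i} {R} i≤R v = begin
      S i v
        ≡⟨ moment≡total i hs (syndrome hs v) ⟨
      (∑[ e ∈ vectors n ] (z e ℕ.* covers e i))
        ≡⟨ ∑-cong (vectors n) (λ e → cong (z e ℕ.*_) (trans (covers≡coverings e i) (sym (split (wt e))))) ⟩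
      (∑[ e ∈ vectors n ] (z e ℕ.* (Σ[ j < suc R ] (g j ℕ.* ind (wt e ℕ.≟ j)))))
        ≡⟨ ∑-cong (vectors n) (λ e → sym (Σ<-*ˡ (z e) (suc R) _)) ⟩
      (∑[ e ∈ vectors n ] Σ[ j < suc R ] (z e ℕ.* (g j ℕ.* ind (wt e ℕ.≟ j))))
        ≡⟨ ∑-Σ<-swap (vectors n) (suc R) _ ⟩
      (Σ[ j < suc R ] ∑[ e ∈ vectors n ] (z e ℕ.* (g j ℕ.* ind (wt e ℕ.≟ j))))
        ≡⟨ Σ<-cong (suc R) (λ j _ → trans (∑-cong (vectors n) λ e → m*[n*o]≡n*[m*o] (z e) (g j) _) (∑-*ˡ (g j) (vectors n) _)) ⟩
      (Σ[ j < suc R ] (g j ℕ.* (∑[ e ∈ vectors n ] (z e ℕ.* ind (wt e ℕ.≟ j)))))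
        ≡⟨ Σ<-cong (suc R) (λ j _ → cong (g j ℕ.*_) (sym (B≡∑ j v))) ⟩
      (Σ[ j < suc R ] (g j ℕ.* B F j v C)) ∎
      where
      open ≡-Reasoning
      z : V n → ℕ
      z e = zro (residual hs (syndrome hs v) e)
      g : ℕ → ℕ
      g w = coverings w (n ∸ w) i
      split : ∀ w → (Σ[ j < suc R ] (g j ℕ.* ind (w ℕ.≟ j))) ≡ g w
      split w with w ≤? R
      ... | yes w≤R = Σ<-ind (suc R) w g (s≤s w≤R)
      ... | no w≰R = trans
        (Σ<-0 (suc R) (λ j j<1+R → trans
          (cong (g j ℕ.*_) (ind-no (w ℕ.≟ j) λ { refl → w≰R (s≤s⁻¹ j<1+R) })) (ℕₚ.*-zeroʳ (g j))))
        (sym (coverings-> (n ∸ w) (ℕₚ.≤-<-trans i≤R (ℕₚ.≰⇒> w≰R))))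

    -- Together with `close⇒S≢0` this makes the distance of `v` from the code the first index with a
    -- nonzero moment.
    S≢0⇒close : ∀ i v → S i v ≢ 0 → ∃ λ c → mem C c × dist F v c ≤ i
    S≢0⇒close i v ne
      with j , j<1+i , p ← Σ<≢0 (suc i) (λ j → coverings j (n ∸ j) i ℕ.* B F j v C)
                             (λ eq → ne (trans (S≡ΣB {i} ℕₚ.≤-refl v) eq))
      with c , c∈C , d≡j ← B≢0⇒close C j v
                             (λ eq → p (trans (cong (coverings j (n ∸ j) i ℕ.*_) eq) (ℕₚ.*-zeroʳ (coverings j (n ∸ j) i)))) =
      c , c∈C , subst (_≤ i) (sym d≡j) (s≤s⁻¹ j<1+i)

    close⇒S≢0 : ∀ {i v c} → i ≤ n → mem C c → dist F v c ≤ i → S i v ≢ 0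
    close⇒S≢0 {i} {v} {c} i≤n c∈C d≤i eq with ℕₚ.m*n≡0⇒m≡0∨n≡0 (coverings (dist F v c) _ i)
      (ℕₚ.n≤0⇒n≡0 (ℕₚ.≤-trans (Σ<-term (suc i) (λ j → coverings j (n ∸ j) i ℕ.* B F j v C) (s≤s d≤i))
        (ℕₚ.≤-reflexive (trans (sym (S≡ΣB {i} ℕₚ.≤-refl v)) eq))))
    ... | inj₁ p = coverings-pos d≤i i≤n p
    ... | inj₂ p = close⇒B≢0 C v c∈C p

-- Moments at points given by coordinates over 𝔽₃

∈-allCols : ∀ {r} (y : Col r) → y ∈ allCols r
∈-allCols [] = here refl
∈-allCols (c ∷ y) = ∈-cartesianProductWith⁺ _∷_ (digit c) (∈-allCols y)
  where
  digit : ∀ c → c ∈ 0₃ ∷ 1₃ ∷ 2₃ ∷ []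
  digit 0₃ = here refl
  digit 1₃ = there (here refl)
  digit 2₃ = there (there (here refl))

allCols-unique : ∀ r → Unique (allCols r)
allCols-unique zero = [] ∷ []
allCols-unique (suc r) = Uniqueₚ.cartesianProductWith⁺ _∷_ ∷-injective
  (((λ ()) ∷ (λ ()) ∷ []) ∷ ((λ ()) ∷ []) ∷ [] ∷ []) (allCols-unique r)

length-allCols : ∀ r → length (allCols r) ≡ 3 ^ r
length-allCols zero = refl
length-allCols (suc r) = trans (length-++ (map (0₃ ∷_) cs))
  (cong₂ ℕ._+_ (l 0₃) (trans (length-++ (map (1₃ ∷_) cs))
    (cong₂ ℕ._+_ (l 1₃) (trans (length-++ (map (2₃ ∷_) cs)) (cong (ℕ._+ 0) (l 2₃))))))
  where
  cs = allCols r
  l : ∀ c → length (map (c ∷_) cs) ≡ 3 ^ r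
  l c = trans (length-map (c ∷_) cs) (length-allCols r)

-₃-injective : ∀ {c d} → c +₃ (-₃ d) ≡ 0₃ → c ≡ d
-₃-injective {0₃} {0₃} eq = refl
-₃-injective {0₃} {1₃} ()
-₃-injective {0₃} {2₃} ()
-₃-injective {1₃} {1₃} eq = refl
-₃-injective {1₃} {2₃} ()
-₃-injective {2₃} {2₃} eq = refl

✚-injective : ∀ {r} (y z : Col r) → y ✚ (2₃ ✶ z) ≡ replicate r 0₃ → y ≡ z
✚-injective [] [] eq = refl
✚-injective (c ∷ y) (d ∷ z) eq =
  cong₂ _∷_ (-₃-injective (proj₁ (∷-injective eq))) (✚-injective y z (proj₂ (∷-injective eq)))

allZero-sound : ∀ {l} (c : Col l) → allZero c ≡ true → c ≡ replicate l 0₃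
allZero-sound [] eq = refl
allZero-sound (0₃ ∷ c) eq = cong (0₃ ∷_) (allZero-sound c eq)

allZero-replicate : ∀ l → allZero (replicate l 0₃) ≡ true
allZero-replicate zero = refl
allZero-replicate (suc l) = allZero-replicate l

evalAt-linear : ∀ {r l} q (T : List (System r)) (ts : Vec (Col r) l) →
  all (λ S → proj₁ S <ᵇ 2) T ≡ true → evalAt q T ts ≡ hits 0 T ts ℕ.+ hits 1 T ts ℕ.* q
evalAt-linear q [] ts eq = refl
evalAt-linear q ((0 , L) ∷ T) ts eq with sat ts L
... | true = cong suc (evalAt-linear q T ts eq)
... | false = evalAt-linear q T ts eq
evalAt-linear q ((1 , L) ∷ T) ts eq with sat ts L
... | true = trans (cong₂ ℕ._+_ (ℕₚ.*-identityʳ q) (evalAt-linear q T ts eq)) (m+[n+o]≡n+[m+o] q (hits 0 T ts) _)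
... | false = evalAt-linear q T ts eq

module Points (F : FiniteField) (char3 : Char3 F) where
  open Field F
  open Ternary F char3
  open Syndromes F char3

  open DecMembership _≟_ using (_∈?_)

  Independent : ∀ {l} → V l → Set
  Independent {l} ω = ∀ (c : Col l) → c ⊙ ω ≡ 0# → c ≡ replicate l 0₃

  span : ∀ {l} → V l → List Carrier
  span {l} ω = map (_⊙ ω) (allCols l)

  length-span : ∀ {l} (ω : V l) → length (span ω) ≡ 3 ^ l
  length-span {l} ω = trans (length-map (_⊙ ω) (allCols l)) (length-allCols l)

  span-unique : ∀ {l} {ω : V l} → Independent ω → Unique (span ω)
  span-unique {l} {ω} indep = Uniqueₚ.map⁺ (λ {c} {d} eq → ✚-injective c d (indep _ (begin
    (c ✚ (2₃ ✶ d)) ⊙ ω       ≡⟨ ⊙-✚ c (2₃ ✶ d) ω ⟩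
    c ⊙ ω + (2₃ ✶ d) ⊙ ω     ≡⟨ cong₂ _+_ eq (⊙-✶ 2₃ d ω) ⟩
    d ⊙ ω - d ⊙ ω            ≡⟨ x-x≡0 _ ⟩
    0#                       ∎))) (allCols-unique l)
    where open ≡-Reasoning

  ∑-∈ : ∀ {xs} → Unique xs → (∑[ a ∈ elements ] ind (a ∈? xs)) ≡ length xs
  ∑-∈ {[]} [] = ∑-0 elements (λ _ → refl)
  ∑-∈ {x ∷ xs} (x∉ ∷ u) = begin
    (∑[ a ∈ elements ] ind (a ∈? (x ∷ xs)))
      ≡⟨ ∑-cong elements split ⟩
    (∑[ a ∈ elements ] (ind (a ≟ x) ℕ.* 1 ℕ.+ ind (a ∈? xs)))
      ≡⟨ ∑-+ elements _ _ ⟩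
    (∑[ a ∈ elements ] (ind (a ≟ x) ℕ.* 1)) ℕ.+ (∑[ a ∈ elements ] ind (a ∈? xs))
      ≡⟨ cong₂ ℕ._+_ (∑-at x (λ _ → 1)) (∑-∈ u) ⟩
    suc (length xs) ∎
    where
    open ≡-Reasoning
    split : ∀ a → ind (a ∈? (x ∷ xs)) ≡ ind (a ≟ x) ℕ.* 1 ℕ.+ ind (a ∈? xs)
    split a with a ≟ x
    ... | yes refl = sym (cong suc (ind-no (x ∈? xs) (λ x∈ → All.lookup x∉ x∈ refl)))
    ... | no _ = refl

  pigeonhole : ∀ {xs} → Unique xs → length xs ℕ.+ (∑[ a ∈ elements ] ind (¬? (a ∈? xs))) ≡ q
  pigeonhole {xs} u = begin
    length xs ℕ.+ (∑[ a ∈ elements ] ind (¬? (a ∈? xs)))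
      ≡⟨ cong (ℕ._+ (∑[ a ∈ elements ] ind (¬? (a ∈? xs)))) (∑-∈ u) ⟨
    (∑[ a ∈ elements ] ind (a ∈? xs)) ℕ.+ (∑[ a ∈ elements ] ind (¬? (a ∈? xs)))
      ≡⟨ ∑-+ elements _ _ ⟨
    (∑[ a ∈ elements ] (ind (a ∈? xs) ℕ.+ ind (¬? (a ∈? xs))))
      ≡⟨ ∑-cong elements (λ a → complement (a ∈? xs)) ⟩
    (∑[ _ ∈ elements ] 1)
      ≡⟨ trans (∑-const elements 1) (ℕₚ.*-identityʳ q) ⟩
    q ∎
    where
    open ≡-Reasoning
    complement : ∀ {P : Set} (d : Dec P) → ind d ℕ.+ ind (¬? d) ≡ 1
    complement (yes _) = refl
    complement (no _) = refl

  2≤q : 2 ≤ q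
  2≤q = subst (2 ≤_) (pigeonhole {0# ∷ 1# ∷ []} ((0≢1 ∷ []) ∷ [] ∷ [])) (ℕₚ.m≤m+n 2 _)

  ∃-outside : ∀ {xs} → Unique xs → length xs < q → ∃ λ a → a ∉ xs
  ∃-outside {xs} u l<q with a , p ← ∑≢0 elements (λ a → ind (¬? (a ∈? xs))) (λ eq →
      ℕₚ.<⇒≢ l<q (trans (sym (trans (cong (length xs ℕ.+_) eq) (ℕₚ.+-identityʳ _))) (pigeonhole u))) =
    a , ind≢0 (¬? (a ∈? xs)) p

  all-inside : ∀ {xs} → Unique xs → length xs ≡ q → ∀ a → a ∈ xs
  all-inside {xs} u l≡q a with a ∈? xs in eq
  ... | yes p = p
  ... | no p = ⊥-elim (ℕₚ.1+n≰n (begin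
    1                                             ≡⟨ ind-yes (¬? (a ∈? xs)) p ⟨
    ind (¬? (a ∈? xs))                            ≤⟨ ∑-term (λ a → ind (¬? (a ∈? xs))) (complete a) ⟩
    (∑[ a ∈ elements ] ind (¬? (a ∈? xs)))        ≡⟨ ℕₚ.+-cancelˡ-≡ (length xs) _ 0
      (trans (pigeonhole u) (trans (sym l≡q) (sym (ℕₚ.+-identityʳ _)))) ⟩
    0                                             ∎))
    where open ℕₚ.≤-Reasoning

  extend-independent : ∀ {l} {ω : V l} {x} → Independent ω → x ∉ span ω → Independent (consV F x ω)
  extend-independent {ω = ω} indep x∉ (0₃ ∷ c) eq = cong (0₃ ∷_) (indep c (trans (sym (+-identityˡ _)) eq))
  extend-independent {ω = ω} {x} indep x∉ (1₃ ∷ c) eq = ⊥-elim (x∉ (subst (_∈ span ω)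
    (trans (⊙-✶ 2₃ c ω) (sym (x+y≡0⇒x≡-y x _ eq))) (∈-map⁺ (_⊙ ω) (∈-allCols (2₃ ✶ c)))))
  extend-independent {ω = ω} {x} indep x∉ (2₃ ∷ c) eq = ⊥-elim (x∉ (subst (_∈ span ω)
    (x-y≡0⇒x≡y _ _ (trans (+-comm _ _) eq)) (∈-map⁺ (_⊙ ω) (∈-allCols c))))

  -- The span of `l` independent elements has only `3 ^ l` members, so a larger field has an element
  -- outside it.
  ∃-independent : ∀ l → 3 ^ l ≤ q → ∃ λ (ω : V l) → Independent ω
  ∃-independent zero _ = (λ ()) , λ { [] _ → refl }
  ∃-independent (suc l) 3^[1+l]≤q
    with ω , indep ← ∃-independent l (ℕₚ.≤-trans (ℕₚ.^-monoʳ-≤ 3 (ℕₚ.n≤1+n l)) 3^[1+l]≤q)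
    with x , x∉ ← ∃-outside (span-unique indep) (subst (_< q) (sym (length-span ω))
           (ℕₚ.<-≤-trans (ℕₚ.^-monoʳ-< 3 (s≤s (s≤s z≤n)) (ℕₚ.n<1+n l)) 3^[1+l]≤q)) =
    consV F x ω , extend-independent indep x∉

  nonzero-independent : ∀ {x} → x ≢ 0# → Independent {1} (λ _ → x)
  nonzero-independent x≢0 (0₃ ∷ []) eq = refl
  nonzero-independent x≢0 (1₃ ∷ []) eq = ⊥-elim (x≢0 (trans (sym (+-identityʳ _)) eq))
  nonzero-independent {x} x≢0 (2₃ ∷ []) eq = ⊥-elim (x≢0
    (trans (sym (-‿involutive x)) (trans (cong -_ (trans (sym (+-identityʳ _)) eq)) -0#≡0#)))

  -- The `3 ^ l` combinations are distinct and therefore fill a field of that order: `ω` is a basis.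
  coordinates : ∀ {l} {ω : V l} → Independent ω → 3 ^ l ≡ q → ∀ x → ∃ λ c → x ≡ c ⊙ ω
  coordinates {ω = ω} indep 3^l≡q x
    with c , _ , eq ← ∈-map⁻ (_⊙ ω) (all-inside (span-unique indep) (trans (length-span ω) 3^l≡q) x) = c , eq

  -- A vector over F written in coordinates t₁ … t_l over 𝔽₃ is Σ ω_k t_k, that is, syndrome ts ω.
  syndrome-tabulate : ∀ {r l} (ω : V l) (f : Fin r → Fin l → 𝔽₃) →
    syndrome (tabulate (λ k → tabulate (λ i → f i k))) ω ≈ λ i → tabulate (f i) ⊙ ω
  syndrome-tabulate {l = zero} ω f i = refl
  syndrome-tabulate {l = suc l} ω f i = cong₂ _+_
    (cong (_· ω zero) (lookup∘tabulate (λ i → f i zero) i)) (syndrome-tabulate (ω ∘ suc) (λ i → f i ∘ suc) i)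

  ⊙-scale : ∀ {r} (y t : Col r) a → y ⊙ (λ i → lookup t i · a) ≡ (y • t) · a
  ⊙-scale [] [] a = refl
  ⊙-scale (c ∷ y) (d ∷ t) a = trans (cong₂ _+_ (sym (·-*₃ c d a)) (⊙-scale y t a)) (sym (·-+₃ (c *₃ d) (y • t) a))

  ⊙-+ : ∀ {r} (y : Col r) s t → y ⊙ (λ i → s i + t i) ≡ y ⊙ s + y ⊙ t
  ⊙-+ [] s t = sym (+-identityˡ _)
  ⊙-+ (c ∷ y) s t = trans (cong₂ _+_ (·-distrib-+ c _ _) (⊙-+ y (s ∘ suc) (t ∘ suc))) (+-interchange _ _ _ _)

  ⊙-zeroV : ∀ {r} (y : Col r) → y ⊙ (λ _ → 0#) ≡ 0#
  ⊙-zeroV [] = refl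
  ⊙-zeroV (c ∷ y) = trans (cong₂ _+_ (·-zeroʳ c) (⊙-zeroV y)) (+-identityˡ _)

  ⊙-syndrome : ∀ {r l} (y : Col r) (ts : Vec (Col r) l) ω → y ⊙ syndrome ts ω ≡ Vec.map (y •_) ts ⊙ ω
  ⊙-syndrome y [] ω = ⊙-zeroV y
  ⊙-syndrome y (t ∷ ts) ω = trans (⊙-+ y _ _) (cong₂ _+_ (⊙-scale y t (ω zero)) (⊙-syndrome y ts (ω ∘ suc)))

  module _ {l : ℕ} {ω : V l} (indep : Independent ω) where

    δ-independent : ∀ c → δ (c ⊙ ω) ≡ (if allZero c then 1 else 0)
    δ-independent c with allZero c in eq
    ... | true = ind-yes (_ ≟ 0#) (trans (cong (_⊙ ω) (allZero-sound c eq)) (⊙-0₃ ω))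
    ... | false = ind-no (_ ≟ 0#) (λ z → false≢true (trans (sym eq)
      (trans (cong allZero (indep c z)) (allZero-replicate l))))
      where
      false≢true : false ≢ true
      false≢true ()

    ∏δ-sat : ∀ {r} (L : List (Col r)) ts → ∏δ L (syndrome ts ω) ≡ (if sat ts L then 1 else 0)
    ∏δ-sat [] ts = refl
    ∏δ-sat (y ∷ L) ts = trans (cong₂ ℕ._*_
        (trans (cong δ (⊙-syndrome y ts ω)) (δ-independent (Vec.map (y •_) ts))) (∏δ-sat L ts))
      (∧-* (allZero (Vec.map (y •_) ts)) (sat ts L))
      where
      ∧-* : ∀ a b → (if a then 1 else 0) ℕ.* (if b then 1 else 0) ≡ (if a ∧ b then 1 else 0)
      ∧-* false b = refl
      ∧-* true false = refl
      ∧-* true true = refl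

    total≡evalAt : ∀ {r} (T : List (System r)) ts → total T (syndrome ts ω) ≡ evalAt q T ts
    total≡evalAt [] ts = refl
    total≡evalAt ((k , L) ∷ T) ts = cong₂ ℕ._+_
      (trans (cong (q ^ k ℕ.*_) (∏δ-sat L ts)) (choose (sat ts L) (q ^ k))) (total≡evalAt T ts)
      where
      choose : ∀ b x → x ℕ.* (if b then 1 else 0) ≡ (if b then x else 0)
      choose false x = ℕₚ.*-zeroʳ x
      choose true x = ℕₚ.*-identityʳ x

    spans : 3 ^ l ≡ q → ∀ {r} (s : V r) → ∃ λ ts → s ≈ syndrome ts ω
    spans 3^l≡q {r} s = tabulate (λ k → tabulate (λ i → lookup (c i) k)) , λ i →
      trans (proj₂ (coordinates indep 3^l≡q (s i)))
        (trans (cong (_⊙ ω) (sym (tabulate∘lookup (c i)))) (sym (syndrome-tabulate ω (λ i → lookup (c i)) i)))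
      where
      c : Fin r → Col l
      c i = proj₁ (coordinates indep 3^l≡q (s i))

  ∑δ : ∀ {r} → List (Col r) → V r → ℕ
  ∑δ L s = ∑[ y ∈ L ] δ (y ⊙ s)

  δ-neg : ∀ x → δ (- x) ≡ δ x
  δ-neg x = ind-⇔ ((- x) ≟ 0#) (x ≟ 0#)
    (λ eq → trans (sym (-‿involutive x)) (trans (cong -_ eq) -0#≡0#)) (λ { refl → -0#≡0# })

  δ-normalise : ∀ {r} (y : Col r) s → δ (normalise y ⊙ s) ≡ δ (y ⊙ s)
  δ-normalise [] s = refl
  δ-normalise (0₃ ∷ y) s = trans (cong δ (+-identityˡ _)) (trans (δ-normalise y (s ∘ suc)) (cong δ (sym (+-identityˡ _))))
  δ-normalise (1₃ ∷ y) s = refl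
  δ-normalise (2₃ ∷ y) s = trans (cong δ (⊙-✶ 2₃ (2₃ ∷ y) s)) (δ-neg ((2₃ ∷ y) ⊙ s))

  total-classify : ∀ {r} (T : List (System r)) {c a b} → classify T ≡ just (c , a , b) → ∀ s →
    total T s ≡ c ℕ.+ ∑δ a s ℕ.+ q ℕ.* ∑δ b s
  total-classify [] refl s = sym (ℕₚ.*-zeroʳ q)
  total-classify ((0 , []) ∷ T) eq s with classify T in cl
  total-classify ((0 , []) ∷ T) refl s | just _ = cong suc (total-classify T cl s)
  total-classify ((0 , y ∷ []) ∷ T) eq s with classify T in cl
  total-classify ((0 , y ∷ []) ∷ T) refl s | just (c , a , b) = trans
    (cong₂ ℕ._+_ (cong (λ z → 1 ℕ.* (z ℕ.* 1)) (sym (δ-normalise y s))) (total-classify T cl s))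
    (rearrange (δ (normalise y ⊙ s)) c (∑δ a s) (q ℕ.* ∑δ b s))
    where
    rearrange : ∀ d c x y → 1 ℕ.* (d ℕ.* 1) ℕ.+ (c ℕ.+ x ℕ.+ y) ≡ c ℕ.+ (d ℕ.+ x) ℕ.+ y
    rearrange = solve 4 (λ d c x y → con 1 :* (d :* con 1) :+ (c :+ x :+ y) := c :+ (d :+ x) :+ y) refl
      where open ℕ-Solver.+-*-Solver
  total-classify ((1 , y ∷ []) ∷ T) eq s with classify T in cl
  total-classify ((1 , y ∷ []) ∷ T) refl s | just (c , a , b) = trans
    (cong₂ ℕ._+_ (cong (λ z → q ^ 1 ℕ.* (z ℕ.* 1)) (sym (δ-normalise y s))) (total-classify T cl s))
    (rearrange q (δ (normalise y ⊙ s)) c (∑δ a s) (∑δ b s))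
    where
    rearrange : ∀ q d c x y → q ℕ.* 1 ℕ.* (d ℕ.* 1) ℕ.+ (c ℕ.+ x ℕ.+ q ℕ.* y) ≡ c ℕ.+ x ℕ.+ q ℕ.* (d ℕ.+ y)
    rearrange = solve 5 (λ q d c x y → q :* con 1 :* (d :* con 1) :+ (c :+ x :+ q :* y) := c :+ x :+ q :* (d :+ y)) refl
      where open ℕ-Solver.+-*-Solver

  ∑-delete : ∀ {r} (y : Col r) zs {zs′} → delete y zs ≡ just zs′ → ∀ g → ∑ zs g ≡ g y ℕ.+ ∑ zs′ g
  ∑-delete y (z ∷ zs) eq g with ≡-dec Fin._≟_ y z
  ∑-delete y (z ∷ zs) refl g | yes refl = refl
  ∑-delete y (z ∷ zs) eq g | no _ with delete y zs in del
  ∑-delete y (z ∷ zs) refl g | no _ | just zs′ = trans (cong (g z ℕ.+_) (∑-delete y zs del g)) (m+[n+o]≡n+[m+o] (g z) (g y) _)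

  ∑-isPermutation : ∀ {r} (xs ys : List (Col r)) → isPermutation xs ys ≡ true → ∀ g → ∑ xs g ≡ ∑ ys g
  ∑-isPermutation [] [] eq g = refl
  ∑-isPermutation (x ∷ xs) ys eq g with delete x ys in del
  ... | just ys′ = trans (cong (g x ℕ.+_) (∑-isPermutation xs ys′ eq g)) (sym (∑-delete x ys del g))

  ∑-repeat : ∀ {A : Set} n (xs : List A) g → ∑ (repeat n xs) g ≡ n ℕ.* ∑ xs g
  ∑-repeat zero xs g = refl
  ∑-repeat (suc n) xs g = trans (∑-++ xs _) (cong (∑ xs g ℕ.+_) (∑-repeat n xs g))

  -- If `s` lies on β of the hyperplanes listed for `T′`, then `T` has total μ β and `T′` has total
  -- c + q β; eliminate β.
  total-proportional : ∀ {r} μ (T T′ : List (System r)) {c} → proportional μ T T′ ≡ just c → ∀ s →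
    μ ℕ.* total T′ s ≡ μ ℕ.* c ℕ.+ q ℕ.* total T s
  total-proportional μ T T′ eq s with classify T in cl | classify T′ in cl′
  ... | just (0 , a , []) | just (c , [] , b) with isPermutation a (repeat μ b) in perm
  total-proportional μ T T′ refl s | just (0 , a , []) | just (c , [] , b) | true = begin
    μ ℕ.* total T′ s
      ≡⟨ cong (μ ℕ.*_) (total-classify T′ cl′ s) ⟩
    μ ℕ.* (c ℕ.+ 0 ℕ.+ q ℕ.* ∑δ b s)
      ≡⟨ rearrange μ c q (∑δ b s) ⟩
    μ ℕ.* c ℕ.+ q ℕ.* (μ ℕ.* ∑δ b s)
      ≡⟨ cong (λ z → μ ℕ.* c ℕ.+ q ℕ.* z) (trans (∑-isPermutation a _ perm _) (∑-repeat μ b _)) ⟨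
    μ ℕ.* c ℕ.+ q ℕ.* ∑δ a s
      ≡⟨ cong (λ z → μ ℕ.* c ℕ.+ q ℕ.* z) (trans (total-classify T cl s)
           (trans (cong (∑δ a s ℕ.+_) (ℕₚ.*-zeroʳ q)) (ℕₚ.+-identityʳ _))) ⟨
    μ ℕ.* c ℕ.+ q ℕ.* total T s ∎
    where
    open ≡-Reasoning
    rearrange : ∀ μ c q b → μ ℕ.* (c ℕ.+ 0 ℕ.+ q ℕ.* b) ≡ μ ℕ.* c ℕ.+ q ℕ.* (μ ℕ.* b)
    rearrange = solve 4 (λ μ c q b → μ :* (c :+ con 0 :+ q :* b) := μ :* c :+ q :* (μ :* b)) refl
      where open ℕ-Solver.+-*-Solver

-- Properties of codes in terms of moments

toℚ-+ : ∀ a b → toℚ (a ℕ.+ b) ≡ toℚ a ℚ.+ toℚ b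
toℚ-+ a b = ℚₚ.toℚᵘ-injective (begin-equality
  ℚ.toℚᵘ (toℚ (a ℕ.+ b))                      ≃⟨ ℚₚ.toℚᵘ-fromℚᵘ (mkℚᵘ (ℤ.+ (a ℕ.+ b)) 0) ⟩
  mkℚᵘ (ℤ.+ (a ℕ.+ b)) 0                        ≃⟨ *≡* (cong (ℤ._* (ℤ.+ 1)) (trans (ℤₚ.pos-+ a b) (cong₂ ℤ._+_ (sym (ℤₚ.*-identityʳ (ℤ.+ a))) (sym (ℤₚ.*-identityʳ (ℤ.+ b)))))) ⟩
  mkℚᵘ (ℤ.+ a) 0 ℚᵘ.+ mkℚᵘ (ℤ.+ b) 0              ≃⟨ ℚᵘₚ.+-cong (ℚₚ.toℚᵘ-fromℚᵘ (mkℚᵘ (ℤ.+ a) 0)) (ℚₚ.toℚᵘ-fromℚᵘ (mkℚᵘ (ℤ.+ b) 0)) ⟨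
  ℚ.toℚᵘ (toℚ a) ℚᵘ.+ ℚ.toℚᵘ (toℚ b)          ≃⟨ ℚₚ.toℚᵘ-homo-+ (toℚ a) (toℚ b) ⟨
  ℚ.toℚᵘ (toℚ a ℚ.+ toℚ b)                    ∎)
  where open ℚᵘₚ.≤-Reasoning

toℚ-* : ∀ a b → toℚ (a ℕ.* b) ≡ toℚ a ℚ.* toℚ b
toℚ-* a b = ℚₚ.toℚᵘ-injective (begin-equality
  ℚ.toℚᵘ (toℚ (a ℕ.* b))                      ≃⟨ ℚₚ.toℚᵘ-fromℚᵘ (mkℚᵘ (ℤ.+ (a ℕ.* b)) 0) ⟩
  mkℚᵘ (ℤ.+ (a ℕ.* b)) 0                        ≃⟨ *≡* (cong (ℤ._* (ℤ.+ 1)) (ℤₚ.pos-* a b)) ⟩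
  mkℚᵘ (ℤ.+ a) 0 ℚᵘ.* mkℚᵘ (ℤ.+ b) 0              ≃⟨ ℚᵘₚ.*-cong (ℚₚ.toℚᵘ-fromℚᵘ (mkℚᵘ (ℤ.+ a) 0)) (ℚₚ.toℚᵘ-fromℚᵘ (mkℚᵘ (ℤ.+ b) 0)) ⟨
  ℚ.toℚᵘ (toℚ a) ℚᵘ.* ℚ.toℚᵘ (toℚ b)          ≃⟨ ℚₚ.toℚᵘ-homo-* (toℚ a) (toℚ b) ⟨
  ℚ.toℚᵘ (toℚ a ℚ.* toℚ b)                    ∎)
  where open ℚᵘₚ.≤-Reasoning

toℚ-injective : ∀ {a b} → toℚ a ≡ toℚ b → a ≡ b
toℚ-injective {a} {b} eq with *≡* p ← ℚₚ.fromℚᵘ-injective {mkℚᵘ (ℤ.+ a) 0} {mkℚᵘ (ℤ.+ b) 0} eq =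
  ℤₚ.+-injective (trans (sym (ℤₚ.*-identityʳ (ℤ.+ a))) (trans p (ℤₚ.*-identityʳ (ℤ.+ b))))

toℚ-/ : ∀ k x → toℚ x ≡ ℤ.+ (suc k ℕ.* x) ℚ./ suc k
toℚ-/ k x = ℚₚ.fromℚᵘ-cong {mkℚᵘ (ℤ.+ x) 0} {mkℚᵘ (ℤ.+ (suc k ℕ.* x)) k}
  (*≡* (trans (ℤₚ.*-comm (ℤ.+ x) (ℤ.+ suc k)) (trans (sym (ℤₚ.pos-* (suc k) x)) (sym (ℤₚ.*-identityʳ _)))))

sumℚ-last : ∀ r (f : Fin (suc r) → ℚ) → sumℚ (suc r) f ≡ sumℚ r (f ∘ inject₁) ℚ.+ f (fromℕ r)
sumℚ-last zero f = trans (ℚₚ.+-identityʳ (f zero)) (sym (ℚₚ.+-identityˡ (f zero)))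
sumℚ-last (suc r) f = trans (cong (f zero ℚ.+_) (sumℚ-last r (f ∘ suc))) (sym (ℚₚ.+-assoc (f zero) _ _))

sumℚ-0 : ∀ r {f : Fin r → ℚ} → (∀ j → f j ≡ 0ℚ) → sumℚ r f ≡ 0ℚ
sumℚ-0 zero eq = refl
sumℚ-0 (suc r) eq = trans (cong₂ ℚ._+_ (eq zero) (sumℚ-0 r (eq ∘ suc))) (ℚₚ.+-identityˡ 0ℚ)

-- The coefficients of a UPWS relation will have this form, with `a` and `b` collecting the positive
-- and the negative contributions, so the sums are evaluated in ℕ and rationals enter only at the
-- end.
sumℚ-difference : ∀ r κ (a b N : ℕ → ℕ) →
  sumℚ r (λ j → ((toℚ (a (toℕ j)) ℚ.- toℚ (b (toℕ j))) ℚ.* κ) ℚ.* toℚ (N (toℕ j))) ≡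
  (toℚ (Σ[ j < r ] (a j ℕ.* N j)) ℚ.- toℚ (Σ[ j < r ] (b j ℕ.* N j))) ℚ.* κ
sumℚ-difference zero κ a b N = sym (ℚₚ.*-zeroˡ κ)
sumℚ-difference (suc r) κ a b N = begin
  ((A₀ ℚ.- B₀) ℚ.* κ) ℚ.* N₀ ℚ.+
    sumℚ r (λ j → ((toℚ (a (suc (toℕ j))) ℚ.- toℚ (b (suc (toℕ j)))) ℚ.* κ) ℚ.* toℚ (N (suc (toℕ j))))
    ≡⟨ cong (((A₀ ℚ.- B₀) ℚ.* κ) ℚ.* N₀ ℚ.+_) (sumℚ-difference r κ (a ∘ suc) (b ∘ suc) (N ∘ suc)) ⟩
  ((A₀ ℚ.- B₀) ℚ.* κ) ℚ.* N₀ ℚ.+ (A₁ ℚ.- B₁) ℚ.* κ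
    ≡⟨ solve 6 (λ a₀ b₀ k n₀ a₁ b₁ → ((a₀ :- b₀) :* k) :* n₀ :+ (a₁ :- b₁) :* k :=
                  ((a₀ :* n₀ :+ a₁) :- (b₀ :* n₀ :+ b₁)) :* k) refl A₀ B₀ κ N₀ A₁ B₁ ⟩
  ((A₀ ℚ.* N₀ ℚ.+ A₁) ℚ.- (B₀ ℚ.* N₀ ℚ.+ B₁)) ℚ.* κ
    ≡⟨ cong₂ (λ x y → (x ℚ.- y) ℚ.* κ) (peel a) (peel b) ⟨
  (toℚ (Σ[ j < suc r ] (a j ℕ.* N j)) ℚ.- toℚ (Σ[ j < suc r ] (b j ℕ.* N j))) ℚ.* κ ∎
  where
  open ≡-Reasoning
  open +-*-Solver
  A₀ = toℚ (a 0)
  B₀ = toℚ (b 0)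
  N₀ = toℚ (N 0)
  A₁ = toℚ (Σ[ j < r ] (a (suc j) ℕ.* N (suc j)))
  B₁ = toℚ (Σ[ j < r ] (b (suc j) ℕ.* N (suc j)))
  peel : ∀ c → toℚ (Σ[ j < suc r ] (c j ℕ.* N j)) ≡
    toℚ (c 0) ℚ.* N₀ ℚ.+ toℚ (Σ[ j < r ] (c (suc j) ℕ.* N (suc j)))
  peel c = trans (cong toℚ (Σ<-peel r (λ j → c j ℕ.* N j)))
    (trans (toℚ-+ (c 0 ℕ.* N 0) _)
      (cong (ℚ._+ toℚ (Σ[ j < r ] (c (suc j) ℕ.* N (suc j)))) (toℚ-* (c 0) (N 0))))

-- The vanishing of a 3 × 3 determinant, with both sides moved so that no subtraction occurs.
determinant : ∀ α β x₀ x₁ x₂ y₁ y₂ →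
  β ℚ.* x₀ ≡ 1ℚ → α ℚ.* y₁ ℚ.+ β ℚ.* x₁ ≡ 1ℚ → α ℚ.* y₂ ℚ.+ β ℚ.* x₂ ≡ 1ℚ →
  y₁ ℚ.* x₂ ℚ.+ x₀ ℚ.* y₂ ≡ x₁ ℚ.* y₂ ℚ.+ x₀ ℚ.* y₁
determinant α β x₀ x₁ x₂ y₁ y₂ eq₀ eq₁ eq₂ = begin
  y₁ ℚ.* x₂ ℚ.+ x₀ ℚ.* y₂
    -- Each factor 1 is replaced by the left side of one of the equations, after which the two sides
    -- are the same polynomial.
    ≡⟨ trans (cong₂ (λ u v → u ℚ.* (y₁ ℚ.* x₂) ℚ.+ v ℚ.* (x₀ ℚ.* y₂)) eq₀ eq₁)
         (cong₂ ℚ._+_ (ℚₚ.*-identityˡ (y₁ ℚ.* x₂)) (ℚₚ.*-identityˡ (x₀ ℚ.* y₂))) ⟨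
  (β ℚ.* x₀) ℚ.* (y₁ ℚ.* x₂) ℚ.+ (α ℚ.* y₁ ℚ.+ β ℚ.* x₁) ℚ.* (x₀ ℚ.* y₂)
    ≡⟨ solve 7 (λ α β x₀ x₁ x₂ y₁ y₂ →
         (β :* x₀) :* (y₁ :* x₂) :+ (α :* y₁ :+ β :* x₁) :* (x₀ :* y₂) :=
         (β :* x₀) :* (x₁ :* y₂) :+ (α :* y₂ :+ β :* x₂) :* (x₀ :* y₁)) refl α β x₀ x₁ x₂ y₁ y₂ ⟩
  (β ℚ.* x₀) ℚ.* (x₁ ℚ.* y₂) ℚ.+ (α ℚ.* y₂ ℚ.+ β ℚ.* x₂) ℚ.* (x₀ ℚ.* y₁)
    ≡⟨ trans (cong₂ (λ u v → u ℚ.* (x₁ ℚ.* y₂) ℚ.+ v ℚ.* (x₀ ℚ.* y₁)) eq₀ eq₂)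
         (cong₂ ℚ._+_ (ℚₚ.*-identityˡ (x₁ ℚ.* y₂)) (ℚₚ.*-identityˡ (x₀ ℚ.* y₁))) ⟩
  x₁ ℚ.* y₂ ℚ.+ x₀ ℚ.* y₁ ∎
  where
  open ≡-Reasoning
  open +-*-Solver

Σ<-*ʳ : ∀ c n f → (Σ[ j < n ] (f j ℕ.* c)) ≡ Σ< n f ℕ.* c
Σ<-*ʳ c n f = trans (Σ<-cong n (λ j _ → ℕₚ.*-comm (f j) c)) (trans (Σ<-*ˡ c n f) (ℕₚ.*-comm c _))

Σ<-swap : ∀ m n (f : ℕ → ℕ → ℕ) → (Σ[ i < m ] Σ[ j < n ] f i j) ≡ (Σ[ j < n ] Σ[ i < m ] f i j)
Σ<-swap zero n f = sym (Σ<-0 n (λ _ _ → refl))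
Σ<-swap (suc m) n f = trans (cong (ℕ._+ Σ< n (f m)) (Σ<-swap m n f))
  (sym (Σ<-+ n (λ j → Σ[ i < m ] f i j) (f m)))

cancel-ratio : ∀ x y z κ → z ≡ x ℚ.+ y → x ℚ.* κ ≡ 1ℚ → (z ℚ.- y) ℚ.* κ ≡ 1ℚ
cancel-ratio x y z κ refl eq =
  trans (cong (ℚ._* κ) (solve 2 (λ x y → x :+ y :- y := x) refl x y)) eq
  where open +-*-Solver

determinantℕ : ∀ α β x₀ x₁ x₂ y₁ y₂ →
  β ℚ.* toℚ x₀ ≡ 1ℚ → α ℚ.* toℚ y₁ ℚ.+ β ℚ.* toℚ x₁ ≡ 1ℚ → α ℚ.* toℚ y₂ ℚ.+ β ℚ.* toℚ x₂ ≡ 1ℚ →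
  y₁ ℕ.* x₂ ℕ.+ x₀ ℕ.* y₂ ≡ x₁ ℕ.* y₂ ℕ.+ x₀ ℕ.* y₁
determinantℕ α β x₀ x₁ x₂ y₁ y₂ eq₀ eq₁ eq₂ = toℚ-injective (trans (toℚ-+* y₁ x₂ x₀ y₂)
  (trans (determinant α β (toℚ x₀) (toℚ x₁) (toℚ x₂) (toℚ y₁) (toℚ y₂) eq₀ eq₁ eq₂) (sym (toℚ-+* x₁ y₂ x₀ y₁))))
  where
  toℚ-+* : ∀ a b c d → toℚ (a ℕ.* b ℕ.+ c ℕ.* d) ≡ toℚ a ℚ.* toℚ b ℚ.+ toℚ c ℚ.* toℚ d
  toℚ-+* a b c d = trans (toℚ-+ (a ℕ.* b) (c ℕ.* d)) (cong₂ ℚ._+_ (toℚ-* a b) (toℚ-* c d))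

sumℚ-last-two : ∀ ρ (β : Fin (suc (suc ρ)) → ℚ) (N : ℕ → ℕ) → (∀ j → j < ρ → N j ≡ 0) →
  sumℚ (suc (suc ρ)) (λ j → β j ℚ.* toℚ (N (toℕ j))) ≡
  β (inject₁ (fromℕ ρ)) ℚ.* toℚ (N ρ) ℚ.+ β (fromℕ (suc ρ)) ℚ.* toℚ (N (suc ρ))
sumℚ-last-two ρ β N vanish = begin
  sumℚ (suc (suc ρ)) f
    ≡⟨ trans (sumℚ-last (suc ρ) f) (cong (ℚ._+ f (fromℕ (suc ρ))) (sumℚ-last ρ (f ∘ inject₁))) ⟩
  sumℚ ρ (f ∘ inject₁ ∘ inject₁) ℚ.+ f (inject₁ (fromℕ ρ)) ℚ.+ f (fromℕ (suc ρ))
    ≡⟨ cong (λ z → z ℚ.+ f (inject₁ (fromℕ ρ)) ℚ.+ f (fromℕ (suc ρ))) (sumℚ-0 ρ λ j →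
         trans (cong (λ k → β (inject₁ (inject₁ j)) ℚ.* toℚ k)
           (vanish _ (subst (_< ρ) (sym (trans (Finₚ.toℕ-inject₁ (inject₁ j)) (Finₚ.toℕ-inject₁ j)))
             (Finₚ.toℕ<n j)))) (ℚₚ.*-zeroʳ (β (inject₁ (inject₁ j))))) ⟩
  0ℚ ℚ.+ f (inject₁ (fromℕ ρ)) ℚ.+ f (fromℕ (suc ρ))
    ≡⟨ cong (ℚ._+ f (fromℕ (suc ρ))) (ℚₚ.+-identityˡ (f (inject₁ (fromℕ ρ)))) ⟩
  f (inject₁ (fromℕ ρ)) ℚ.+ f (fromℕ (suc ρ))
    ≡⟨ cong₂ (λ k l → β (inject₁ (fromℕ ρ)) ℚ.* toℚ (N k) ℚ.+ β (fromℕ (suc ρ)) ℚ.* toℚ (N l))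
         (trans (Finₚ.toℕ-inject₁ (fromℕ ρ)) (Finₚ.toℕ-fromℕ ρ)) (Finₚ.toℕ-fromℕ (suc ρ)) ⟩
  β (inject₁ (fromℕ ρ)) ℚ.* toℚ (N ρ) ℚ.+ β (fromℕ (suc ρ)) ℚ.* toℚ (N (suc ρ)) ∎
  where
  open ≡-Reasoning
  f : Fin (suc (suc ρ)) → ℚ
  f j = β j ℚ.* toℚ (N (toℕ j))

private
  -- Passing from `N R` to the moment adds `c` times one column of the determinant to another, so
  -- its vanishing can be tested on moments.
  affine : ∀ c a b u v w → a ℕ.* v ℕ.+ w ℕ.* b ≡ u ℕ.* b ℕ.+ w ℕ.* a →
    a ℕ.* (c ℕ.* b ℕ.+ v) ℕ.+ w ℕ.* b ≡ (c ℕ.* a ℕ.+ u) ℕ.* b ℕ.+ w ℕ.* a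
  affine c a b u v w eq = trans (left c a b v w) (trans (cong (c ℕ.* (a ℕ.* b) ℕ.+_) eq) (right c a b u w))
    where
    open ℕ-Solver.+-*-Solver
    left : ∀ c a b v w → a ℕ.* (c ℕ.* b ℕ.+ v) ℕ.+ w ℕ.* b ≡ c ℕ.* (a ℕ.* b) ℕ.+ (a ℕ.* v ℕ.+ w ℕ.* b)
    left = solve 5 (λ c a b v w → a :* (c :* b :+ v) :+ w :* b := c :* (a :* b) :+ (a :* v :+ w :* b)) refl
    right : ∀ c a b u w → c ℕ.* (a ℕ.* b) ℕ.+ (u ℕ.* b ℕ.+ w ℕ.* a) ≡ (c ℕ.* a ℕ.+ u) ℕ.* b ℕ.+ w ℕ.* a
    right = solve 5 (λ c a b u w → c :* (a :* b) :+ (u :* b :+ w :* a) := (c :* a :+ u) :* b :+ w :* a) refl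

module _ (n ρ : ℕ) (N : ℕ → ℕ) (vanish : ∀ j → j < suc ρ → N j ≡ 0) where

  private
    R : ℕ
    R = suc (suc ρ)

    zeros : ∀ i → (Σ[ j < suc ρ ] (coverings j (n ∸ j) i ℕ.* N j)) ≡ 0
    zeros i = Σ<-0 (suc ρ) (λ j j<1+ρ → trans (cong (coverings j (n ∸ j) i ℕ.*_) (vanish j j<1+ρ))
      (ℕₚ.*-zeroʳ (coverings j (n ∸ j) i)))

    diagonal : ∀ k → coverings k (n ∸ k) k ℕ.* N k ≡ N k
    diagonal k = trans (cong (ℕ._* N k) (coverings-diag k (n ∸ k))) (ℕₚ.*-identityˡ (N k))

  Σ-penultimate : (Σ[ j < R ] (coverings j (n ∸ j) (suc ρ) ℕ.* N j)) ≡ N (suc ρ)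
  Σ-penultimate = cong₂ ℕ._+_ (zeros (suc ρ)) (diagonal (suc ρ))

  Σ-last : (Σ[ j < suc R ] (coverings j (n ∸ j) R ℕ.* N j)) ≡ coverings (suc ρ) (n ∸ suc ρ) R ℕ.* N (suc ρ) ℕ.+ N R
  Σ-last = cong₂ ℕ._+_ (cong (ℕ._+ coverings (suc ρ) (n ∸ suc ρ) R ℕ.* N (suc ρ)) (zeros R)) (diagonal R)

-- Further than ρ from a code, the relation defining the UPWS property only involves two
-- unknowns, so three such points may already contradict it.
module _ (n ρ : ℕ) (N : Fin 3 → ℕ → ℕ) (vanish : ∀ p j → j < suc ρ → N p j ≡ 0) where

  private
    R : ℕ
    R = suc (suc ρ)

  three-points : ∀ (x y : Fin 3 → ℕ) →
    (∀ p → y p ≡ (Σ[ j < R ] (coverings j (n ∸ j) (suc ρ) ℕ.* N p j))) →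
    (∀ p → x p ≡ (Σ[ j < suc R ] (coverings j (n ∸ j) R ℕ.* N p j))) →
    y 0₃ ≡ 0 → (β : Fin (suc R) → ℚ) → (∀ p → sumℚ (suc R) (λ j → β j ℚ.* toℚ (N p (toℕ j))) ≡ 1ℚ) →
    y 1₃ ℕ.* x 2₃ ℕ.+ x 0₃ ℕ.* y 2₃ ≡ x 1₃ ℕ.* y 2₃ ℕ.+ x 0₃ ℕ.* y 1₃
  three-points x y y≡ x≡ y₀≡0 β relation = begin
    y 1₃ ℕ.* x 2₃ ℕ.+ x 0₃ ℕ.* y 2₃
      ≡⟨ cong₂ (λ s t → y 1₃ ℕ.* s ℕ.+ t ℕ.* y 2₃) (x≡+ 2₃) x₀≡N₀ ⟩
    y 1₃ ℕ.* (c ℕ.* y 2₃ ℕ.+ N 2₃ R) ℕ.+ N 0₃ R ℕ.* y 2₃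
      ≡⟨ affine c (y 1₃) (y 2₃) (N 1₃ R) (N 2₃ R) (N 0₃ R)
           (determinantℕ α β₀ (N 0₃ R) (N 1₃ R) (N 2₃ R) (y 1₃) (y 2₃) eq₀ (eq 1₃) (eq 2₃)) ⟩
    (c ℕ.* y 1₃ ℕ.+ N 1₃ R) ℕ.* y 2₃ ℕ.+ N 0₃ R ℕ.* y 1₃
      ≡⟨ cong₂ (λ s t → s ℕ.* y 2₃ ℕ.+ t ℕ.* y 1₃) (x≡+ 1₃) x₀≡N₀ ⟨
    x 1₃ ℕ.* y 2₃ ℕ.+ x 0₃ ℕ.* y 1₃ ∎
    where
    open ≡-Reasoning
    c = coverings (suc ρ) (n ∸ suc ρ) R
    α = β (inject₁ (fromℕ (suc ρ)))
    β₀ = β (fromℕ R)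
    y≡N : ∀ p → y p ≡ N p (suc ρ)
    y≡N p = trans (y≡ p) (Σ-penultimate n ρ (N p) (vanish p))
    x≡+ : ∀ p → x p ≡ c ℕ.* y p ℕ.+ N p R
    x≡+ p = trans (x≡ p) (trans (Σ-last n ρ (N p) (vanish p)) (cong (λ z → c ℕ.* z ℕ.+ N p R) (sym (y≡N p))))
    x₀≡N₀ : x 0₃ ≡ N 0₃ R
    x₀≡N₀ = trans (x≡+ 0₃) (cong (ℕ._+ N 0₃ R) (trans (cong (c ℕ.*_) y₀≡0) (ℕₚ.*-zeroʳ c)))
    eq : ∀ p → α ℚ.* toℚ (y p) ℚ.+ β₀ ℚ.* toℚ (N p R) ≡ 1ℚ
    eq p = trans (cong (λ k → α ℚ.* toℚ k ℚ.+ β₀ ℚ.* toℚ (N p R)) (y≡N p))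
      (trans (sym (sumℚ-last-two (suc ρ) β (N p) (vanish p))) (relation p))
    eq₀ : β₀ ℚ.* toℚ (N 0₃ R) ≡ 1ℚ
    eq₀ = trans (sym (trans (cong (λ k → α ℚ.* toℚ k ℚ.+ β₀ ℚ.* toℚ (N 0₃ R)) y₀≡0)
      (trans (cong (ℚ._+ β₀ ℚ.* toℚ (N 0₃ R)) (ℚₚ.*-zeroʳ α)) (ℚₚ.+-identityˡ (β₀ ℚ.* toℚ (N 0₃ R)))))) (eq 0₃)

module Codes (F : FiniteField) (char3 : Char3 F) where
  open Field F
  open Ternary F char3
  open Syndromes F char3

  dist-self : ∀ {m} (u : V m) → dist F u u ≡ 0
  dist-self {zero} u = refl
  dist-self {suc m} u with u zero ≟ u zero
  ... | yes _ = dist-self (u ∘ suc)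
  ... | no ne = ⊥-elim (ne refl)

  dist≡0⇒≈ : ∀ {m} (u v : V m) → dist F u v ≡ 0 → u ≈ v
  dist≡0⇒≈ {suc m} u v eq i with u zero ≟ v zero
  dist≡0⇒≈ {suc m} u v eq zero | yes p = p
  dist≡0⇒≈ {suc m} u v eq (suc i) | yes p = dist≡0⇒≈ (u ∘ suc) (v ∘ suc) eq i

  dist-sym : ∀ {m} (u v : V m) → dist F u v ≡ dist F v u
  dist-sym {zero} u v = refl
  dist-sym {suc m} u v with u zero ≟ v zero | v zero ≟ u zero
  ... | yes _ | yes _ = dist-sym (u ∘ suc) (v ∘ suc)
  ... | no _ | no _ = cong suc (dist-sym (u ∘ suc) (v ∘ suc))
  ... | yes eq | no ne = ⊥-elim (ne (sym eq))
  ... | no ne | yes eq = ⊥-elim (ne (sym eq))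

  syndrome-zeroV : ∀ {r n} (hs : Vec (Col r) n) → syndrome hs (zeroV F) ≈ zeroV F
  syndrome-zeroV [] i = refl
  syndrome-zeroV (h ∷ hs) i = trans (cong₂ _+_ (·-zeroʳ (lookup h i)) (syndrome-zeroV hs i)) (+-identityˡ 0#)

  module Checked {r n : ℕ} {C : Code F n} {hs : Vec (Col r) n} (check : ParityCheck C hs) where
    open ParityCheck check
    open Parity check public

    S₀ : ℕ → ℕ
    S₀ i = total (systems i hs) (zeroV F)

    total-cong : ∀ (T : List (System r)) {s t} → s ≈ t → total T s ≡ total T t
    total-cong T eq = ∑-cong T (λ (k , L) → cong (q ^ k ℕ.*_) (∏δ-cong L eq))

    S-codeword : ∀ i {v} → mem C v → S i v ≡ S₀ i
    S-codeword i v∈C = total-cong (systems i hs) (annihilates v∈C)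

    zeroV∈C : mem C (zeroV F)
    zeroV∈C = detects (syndrome-zeroV hs)

    S₀0≡1 : S₀ 0 ≡ 1
    S₀0≡1 = trans (ℕₚ.+-identityʳ _) (trans (ℕₚ.*-identityˡ _) (trans (∏δ-units {r} (zeroV F)) (zro-yes {r} (λ _ → refl))))

    A≡B : ∀ j → A F j C ≡ B F j (zeroV F) C
    A≡B j = trans (length-filter _ (vectors n)) (trans
      (∑-cong (vectors n) (λ c → ind-⇔ (mem? C c ×-dec (wt c ℕ.≟ j)) (mem? C c ×-dec (dist F (zeroV F) c ℕ.≟ j))
        (λ (m , eq) → m , trans (dist-sym (zeroV F) c) eq) (λ (m , eq) → m , trans (dist-sym c (zeroV F)) eq)))
      (sym (length-filter _ (vectors n))))

    module _ {d : ℕ} (d<n : suc d ≤ n) (S-d : S₀ d ≡ binomial n d) where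

      -- The codeword `u` alone contributes `binomial n d` to the moment at `u`. The hypothesis says
      -- that this is all, which leaves no room for another codeword within distance `d`.
      B-codeword : ∀ {u} → mem C u → ∀ {j} → j < d → B F (suc j) u C ≡ 0
      B-codeword {u} u∈C {j} j<d with ℕₚ.m*n≡0⇒m≡0∨n≡0 (coverings (suc j) (n ∸ suc j) d) (ℕₚ.n≤0⇒n≡0 (begin
        coverings (suc j) (n ∸ suc j) d ℕ.* B F (suc j) u C
          ≤⟨ Σ<-term d (λ j → coverings (suc j) (n ∸ suc j) d ℕ.* B F (suc j) u C) j<d ⟩
        rest
          ≤⟨ ℕₚ.+-cancelˡ-≤ (binomial n d ℕ.* 1) rest 0 (begin
               binomial n d ℕ.* 1 ℕ.+ rest
                 ≤⟨ ℕₚ.+-monoˡ-≤ rest (ℕₚ.*-monoʳ-≤ (binomial n d) (ℕₚ.n≢0⇒n>0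
                      (subst (λ k → B F k u C ≢ 0) (dist-self u) (close⇒B≢0 C u u∈C)))) ⟩
               binomial n d ℕ.* B F 0 u C ℕ.+ rest
                 ≡⟨ Σ<-peel d (λ j → coverings j (n ∸ j) d ℕ.* B F j u C) ⟨
               (Σ[ j < suc d ] (coverings j (n ∸ j) d ℕ.* B F j u C))
                 ≡⟨ S≡ΣB {d} ℕₚ.≤-refl u ⟨
               S d u
                 ≡⟨ trans (S-codeword d u∈C) S-d ⟩
               binomial n d
                 ≡⟨ trans (ℕₚ.+-identityʳ _) (ℕₚ.*-identityʳ _) ⟨
               binomial n d ℕ.* 1 ℕ.+ 0 ∎) ⟩
        0 ∎))
        where
        open ℕₚ.≤-Reasoning
        rest = Σ[ j < d ] (coverings (suc j) (n ∸ suc j) d ℕ.* B F (suc j) u C)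
      ... | inj₁ eq = ⊥-elim (coverings-pos {suc j} {n} j<d (ℕₚ.<⇒≤ d<n) eq)
      ... | inj₂ eq = eq

      B0-zeroV : B F 0 (zeroV F) C ≡ 1
      B0-zeroV = trans (sym (trans (S≡ΣB {0} {0} z≤n (zeroV F)) (ℕₚ.+-identityʳ _)))
        (trans (S-codeword 0 zeroV∈C) S₀0≡1)

      -- Only e = 0 has weight at most d among the vectors of syndrome 0.
      low-terms : ∀ k → (Σ[ j < suc d ] (coverings j (n ∸ j) k ℕ.* B F j (zeroV F) C)) ≡ binomial n k
      low-terms k = begin
        (Σ[ j < suc d ] (coverings j (n ∸ j) k ℕ.* B F j (zeroV F) C))
          ≡⟨ Σ<-peel d (λ j → coverings j (n ∸ j) k ℕ.* B F j (zeroV F) C) ⟩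
        binomial n k ℕ.* B F 0 (zeroV F) C ℕ.+
          (Σ[ j < d ] (coverings (suc j) (n ∸ suc j) k ℕ.* B F (suc j) (zeroV F) C))
          ≡⟨ cong₂ ℕ._+_ (trans (cong (binomial n k ℕ.*_) B0-zeroV) (ℕₚ.*-identityʳ _))
               (Σ<-0 d (λ j j<d → trans (cong (coverings (suc j) (n ∸ suc j) k ℕ.*_) (B-codeword zeroV∈C j<d))
                 (ℕₚ.*-zeroʳ (coverings (suc j) (n ∸ suc j) k)))) ⟩
        binomial n k ℕ.+ 0
          ≡⟨ ℕₚ.+-identityʳ _ ⟩
        binomial n k ∎
        where open ≡-Reasoning

      S₀-first : S₀ (suc d) ≡ binomial n (suc d) ℕ.+ B F (suc d) (zeroV F) C
      S₀-first = trans (sym (S-codeword (suc d) zeroV∈C)) (trans (S≡ΣB {suc d} ℕₚ.≤-refl (zeroV F))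
        (cong₂ ℕ._+_ (low-terms (suc d))
          (trans (cong (ℕ._* B F (suc d) (zeroV F) C) (coverings-diag (suc d) (n ∸ suc d))) (ℕₚ.*-identityˡ _))))

      S₀-second : S₀ (suc (suc d)) ≡ binomial n (suc (suc d)) ℕ.+
        coverings (suc d) (n ∸ suc d) (suc (suc d)) ℕ.* B F (suc d) (zeroV F) C ℕ.+ B F (suc (suc d)) (zeroV F) C
      S₀-second = trans (sym (S-codeword (suc (suc d)) zeroV∈C)) (trans (S≡ΣB {suc (suc d)} ℕₚ.≤-refl (zeroV F))
        (cong₂ ℕ._+_ (cong (ℕ._+ coverings (suc d) (n ∸ suc d) (suc (suc d)) ℕ.* B F (suc d) (zeroV F) C)
            (low-terms (suc (suc d))))
          (trans (cong (ℕ._* B F (suc (suc d)) (zeroV F) C) (coverings-diag (suc (suc d)) (n ∸ suc (suc d))))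
            (ℕₚ.*-identityˡ _))))

      minDist : S₀ (suc d) ≢ binomial n (suc d) → HasMinDist F C (suc d)
      minDist S-1+d = attained , bounded
        where
        attained : Σ (V n) λ u → Σ (V n) λ v → mem C u × mem C v × ¬ (u ≈ v) × dist F u v ≡ suc d
        attained = build (B≢0⇒close C (suc d) (zeroV F)
          (λ eq → S-1+d (trans S₀-first (trans (cong (binomial n (suc d) ℕ.+_) eq) (ℕₚ.+-identityʳ _)))))
          where
          build : (∃ λ c → mem C c × dist F (zeroV F) c ≡ suc d) → _
          build (c , c∈C , eq) = zeroV F , c , zeroV∈C , c∈C ,
            (λ 0≈c → ℕₚ.1+n≢0 (trans (sym eq) (trans (dist-cong (λ _ → refl) (sym ∘ 0≈c)) (dist-self (zeroV F {n}))))) ,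
            eq
        bounded : ∀ u v → mem C u → mem C v → ¬ (u ≈ v) → suc d ≤ dist F u v
        bounded u v u∈C v∈C u≉v with dist F u v in eq
        ... | zero = ⊥-elim (u≉v (dist≡0⇒≈ u v eq))
        ... | suc j with suc j ℕ.<? suc d
        ...   | yes j<d = ⊥-elim (close⇒B≢0 C u v∈C
                (subst (λ k → B F k u C ≡ 0) (sym eq) (B-codeword u∈C (s≤s⁻¹ j<d))))
        ...   | no j≮d = ℕₚ.≮⇒≥ j≮d

    covRad : ∀ {R} → suc R ≤ n → (∀ v → S (suc R) v ≢ 0) → (∃ λ v → S R v ≡ 0) → HasCovRad F C (suc R)
    covRad {R} R<n covered (v , hole) =
      (λ v → S≢0⇒close (suc R) v (covered v)) ,
      λ R′ covers′ → ℕₚ.≰⇒> λ R′≤R → let c , c∈C , d≤R′ = covers′ v in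
        close⇒S≢0 {R} {v} (ℕₚ.<⇒≤ R<n) c∈C (ℕₚ.≤-trans d≤R′ R′≤R) hole

    weighted : ∀ R (γ : ℕ → ℕ) v →
      (Σ[ i < suc R ] (γ i ℕ.* S i v)) ≡
      (Σ[ j < suc R ] ((Σ[ i < suc R ] (γ i ℕ.* coverings j (n ∸ j) i)) ℕ.* B F j v C))
    weighted R γ v = begin
      (Σ[ i < suc R ] (γ i ℕ.* S i v))
        ≡⟨ Σ<-cong (suc R) (λ i i<1+R → trans (cong (γ i ℕ.*_) (S≡ΣB {i} (s≤s⁻¹ i<1+R) v)) (sym (Σ<-*ˡ (γ i) (suc R) _))) ⟩
      (Σ[ i < suc R ] Σ[ j < suc R ] (γ i ℕ.* (coverings j (n ∸ j) i ℕ.* B F j v C)))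
        ≡⟨ Σ<-swap (suc R) (suc R) _ ⟩
      (Σ[ j < suc R ] Σ[ i < suc R ] (γ i ℕ.* (coverings j (n ∸ j) i ℕ.* B F j v C)))
        ≡⟨ Σ<-cong (suc R) (λ j _ → trans
             (Σ<-cong (suc R) (λ i _ → sym (ℕₚ.*-assoc (γ i) (coverings j (n ∸ j) i) _)))
             (Σ<-*ʳ (B F j v C) (suc R) (λ i → γ i ℕ.* coverings j (n ∸ j) i))) ⟩
      (Σ[ j < suc R ] ((Σ[ i < suc R ] (γ i ℕ.* coverings j (n ∸ j) i)) ℕ.* B F j v C)) ∎
      where open ≡-Reasoning

    -- A linear relation between moments with nonzero constant term becomes one between the `B j`,
    -- and dividing by `suc D` makes the constant 1. Two coefficient families keep both sides
    -- natural.
    upws : ∀ {R} → HasCovRad F C R → ∀ D (γ γ′ : ℕ → ℕ) →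
      (∀ v → (Σ[ i < suc R ] (γ i ℕ.* S i v)) ≡ suc D ℕ.+ (Σ[ i < suc R ] (γ′ i ℕ.* S i v))) → IsUPWS F C
    upws {R} cov D γ γ′ relation = R , cov ,
      (λ j → (toℚ (a γ (toℕ j)) ℚ.- toℚ (a γ′ (toℕ j))) ℚ.* κ) , λ v → begin
        sumℚ (suc R) (λ j → ((toℚ (a γ (toℕ j)) ℚ.- toℚ (a γ′ (toℕ j))) ℚ.* κ) ℚ.* toℚ (B F (toℕ j) v C))
          ≡⟨ sumℚ-difference (suc R) κ (a γ) (a γ′) (λ j → B F j v C) ⟩
        (toℚ (Σ[ j < suc R ] (a γ j ℕ.* B F j v C)) ℚ.- toℚ (Y v)) ℚ.* κ
          ≡⟨ cancel-ratio (toℚ (suc D)) (toℚ (Y v)) _ κ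
               (trans (cong toℚ (trans (sym (weighted R γ v)) (trans (relation v) (cong (suc D ℕ.+_) (weighted R γ′ v)))))
                 (toℚ-+ (suc D) (Y v)))
               (ℚₚ.*-inverseʳ (toℚ (suc D))) ⟩
        1ℚ ∎
      where
      open ≡-Reasoning
      instance
        nonZero : ℚ.NonZero (toℚ (suc D))
        nonZero = ℚ.≢-nonZero (λ eq → ℕₚ.1+n≢0 (toℚ-injective {suc D} {0} eq))
      κ = ℚ.1/ toℚ (suc D)
      a : (ℕ → ℕ) → ℕ → ℕ
      a γ j = Σ[ i < suc R ] (γ i ℕ.* coverings j (n ∸ j) i)
      Y : V n → ℕ
      Y v = Σ[ j < suc R ] (a γ′ j ℕ.* B F j v C)

    covRad-unique : ∀ {R R′} → HasCovRad F C R → HasCovRad F C R′ → R ≡ R′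
    covRad-unique (cov , min) (cov′ , min′) = ℕₚ.≤-antisym (min _ cov′) (min′ _ cov)

    S≡0⇒B≡0 : ∀ i v → S i v ≡ 0 → ∀ {j} → j ≤ i → i ≤ n → B F j v C ≡ 0
    S≡0⇒B≡0 i v S≡0 {j} j≤i i≤n = decidable-stable (B F j v C ℕ.≟ 0) λ B≢0 →
      let c , c∈C , d≡j = B≢0⇒close C j v B≢0 in
      close⇒S≢0 {i} {v} i≤n c∈C (subst (_≤ i) (sym d≡j) j≤i) S≡0

    ¬upws : ∀ {ρ} → ρ ≤ n → HasCovRad F C (suc (suc ρ)) → (v : Fin 3 → V n) →
      (∀ p → S ρ (v p) ≡ 0) → S (suc ρ) (v 0₃) ≡ 0 →
      S (suc ρ) (v 1₃) ℕ.* S (suc (suc ρ)) (v 2₃) ℕ.+ S (suc (suc ρ)) (v 0₃) ℕ.* S (suc ρ) (v 2₃) ≢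
      S (suc (suc ρ)) (v 1₃) ℕ.* S (suc ρ) (v 2₃) ℕ.+ S (suc (suc ρ)) (v 0₃) ℕ.* S (suc ρ) (v 1₃) →
      ¬ IsUPWS F C
    ¬upws {ρ} ρ≤n cov v hole y₀≡0 det≢0 (R′ , cov′ , β , relation) = contradict (covRad-unique cov′ cov) β relation
      where
      contradict : ∀ {R′} → R′ ≡ suc (suc ρ) → (β : Fin (suc R′) → ℚ) →
        (∀ v → sumℚ (suc R′) (λ j → β j ℚ.* toℚ (B F (toℕ j) v C)) ≡ 1ℚ) → ⊥
      contradict refl β relation = det≢0 (three-points n ρ (λ p j → B F j (v p) C)
        (λ p j j<1+ρ → S≡0⇒B≡0 ρ (v p) (hole p) (s≤s⁻¹ j<1+ρ) ρ≤n)
        (λ p → S (suc (suc ρ)) (v p)) (λ p → S (suc ρ) (v p))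
        (λ p → S≡ΣB {suc ρ} ℕₚ.≤-refl (v p)) (λ p → S≡ΣB {suc (suc ρ)} ℕₚ.≤-refl (v p))
        y₀≡0 β (λ p → relation (v p)))

    -- The diagonal coefficients of the triangular system are 1, so it can be solved for the `B j`
    -- one after the other.
    B-determined : ∀ {R} v w → (∀ i → i ≤ R → S i v ≡ S i w) → ∀ k → k ≤ suc R → ∀ j → j < k → B F j v C ≡ B F j w C
    B-determined v w same (suc k) k≤R j j<1+k with ℕₚ.m≤n⇒m<n∨m≡n (s≤s⁻¹ j<1+k)
    ... | inj₁ j<k = B-determined v w same k (ℕₚ.<⇒≤ k≤R) j j<k
    ... | inj₂ refl = trans (sym (ℕₚ.*-identityˡ _)) (trans
      (subst (λ c → c ℕ.* B F k v C ≡ c ℕ.* B F k w C) (coverings-diag k (n ∸ k))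
        (ℕₚ.+-cancelˡ-≡ (Σ[ j < k ] (coverings j (n ∸ j) k ℕ.* B F j v C)) _ _ (begin
          (Σ[ j < suc k ] (coverings j (n ∸ j) k ℕ.* B F j v C))   ≡⟨ S≡ΣB {k} ℕₚ.≤-refl v ⟨
          S k v                                                    ≡⟨ same k (s≤s⁻¹ k≤R) ⟩
          S k w                                                    ≡⟨ S≡ΣB {k} ℕₚ.≤-refl w ⟩
          (Σ[ j < suc k ] (coverings j (n ∸ j) k ℕ.* B F j w C))
            ≡⟨ cong (ℕ._+ coverings k (n ∸ k) k ℕ.* B F k w C) (Σ<-cong k (λ j j<k → cong (coverings j (n ∸ j) k ℕ.*_)
                 (B-determined v w same k (ℕₚ.<⇒≤ k≤R) j j<k))) ⟨
          (Σ[ j < k ] (coverings j (n ∸ j) k ℕ.* B F j v C)) ℕ.+ coverings k (n ∸ k) k ℕ.* B F k w C ∎)))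
      (ℕₚ.*-identityˡ _))
      where open ≡-Reasoning

    -- The first nonzero moment marks the distance `d`, so it suffices that the moments up to `R`
    -- are constant on each such shell.
    regular : ∀ {R t} → t ≤ n → (f : ℕ → ℕ → ℕ) →
      (∀ v d → d ≤ t → (∀ i → i < d → S i v ≡ 0) → S d v ≢ 0 → ∀ i → i ≤ R → S i v ≡ f d i) → Regular F C R t
    regular {R} {t} t≤n f profile s s≤t v w v-s w-s j j≤R = B-determined v w
      (λ i i≤R → trans (at v v-s i i≤R) (sym (at w w-s i i≤R))) (suc R) ℕₚ.≤-refl j (s≤s j≤R)
      where
      at : ∀ v → DistToCode F C v s → ∀ i → i ≤ R → S i v ≡ f s i
      at v ((c , c∈C , d≡s) , far) = profile v s s≤t empty
        (close⇒S≢0 {s} {v} (ℕₚ.≤-trans s≤t t≤n) c∈C (ℕₚ.≤-reflexive d≡s))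
        where
        empty : ∀ i → i < s → S i v ≡ 0
        empty i i<s = decidable-stable (S i v ℕ.≟ 0) λ ne →
          let c′ , c′∈C , d≤i = S≢0⇒close i v ne in ℕₚ.<⇒≱ i<s (ℕₚ.≤-trans (far c′ c′∈C) d≤i)

    total≢0 : ∀ (T : List (System r)) → unconstrained T ≡ true → ∀ s → total T s ≢ 0
    total≢0 ((k , []) ∷ T) eq s z = q≢0 (ℕₚ.m^n≡0⇒m≡0 q k
      (trans (sym (ℕₚ.*-identityʳ (q ^ k))) (ℕₚ.m+n≡0⇒m≡0 (q ^ k ℕ.* 1) z)))
    total≢0 ((k , y ∷ L) ∷ T) eq s z = total≢0 T eq s (ℕₚ.m+n≡0⇒n≡0 (value (k , y ∷ L) s) z)

    -- This realises syndromes with prescribed coordinates by actual vectors: a nonzero moment has a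
    -- nonzero term.
    ∃-syndrome : ∀ i → unconstrained (systems i hs) ≡ true → ∀ (s : V r) → ∃ λ v → syndrome hs v ≈ s
    ∃-syndrome i eq s =
      let e , p = ∑≢0 (vectors n) _ (λ z → total≢0 (systems i hs) eq s (trans (sym (moment≡total i hs s)) z)) in
      e , λ k → sym (x-y≡0⇒x≡y _ _ (trans (sym (residual-syndrome hs s e k))
        (zro≢0 (λ z → p (cong (ℕ._* covers e i) z)) k)))

-- Codes with generator or parity check matrix [ I | M ]

unit : ∀ {k} → Fin k → Fin k → 𝔽₃
unit i j = if does (i Fin.≟ j) then 1₃ else 0₃

unit-sym : ∀ {n} (i j : Fin n) → unit i j ≡ unit j i
unit-sym i j with i Fin.≟ j | j Fin.≟ i
... | yes _ | yes _ = refl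
... | no _ | no _ = refl
... | yes eq | no ne with () ← ne (sym eq)
... | no ne | yes eq with () ← ne (sym eq)

*₃-comm : ∀ a b → a *₃ b ≡ b *₃ a
*₃-comm 0₃ 0₃ = refl
*₃-comm 0₃ 1₃ = refl
*₃-comm 0₃ 2₃ = refl
*₃-comm 1₃ 0₃ = refl
*₃-comm 1₃ 1₃ = refl
*₃-comm 1₃ 2₃ = refl
*₃-comm 2₃ 0₃ = refl
*₃-comm 2₃ 1₃ = refl
*₃-comm 2₃ 2₃ = refl

split-elim : ∀ {k c} {P : Fin (k ℕ.+ c) → Set} → (∀ i → P (i ↑ˡ c)) → (∀ l → P (k ↑ʳ l)) → ∀ j → P j
split-elim {k} {c} {P} left right j = subst P (Finₚ.join-splitAt k c j) (cases (splitAt k j))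
  where
  cases : ∀ s → P (join k c s)
  cases (inj₁ i) = left i
  cases (inj₂ l) = right l

module Systematic (F : FiniteField) (char3 : Char3 F) where
  open Field F
  open Ternary F char3
  open Syndromes F char3

  ∑F : ∀ n → (Fin n → Carrier) → Carrier
  ∑F = sumF F

  ∑F-cong : ∀ n {f g : Fin n → Carrier} → (∀ i → f i ≡ g i) → ∑F n f ≡ ∑F n g
  ∑F-cong = sumF-cong F

  ∑F-0 : ∀ n {f : Fin n → Carrier} → (∀ i → f i ≡ 0#) → ∑F n f ≡ 0#
  ∑F-0 zero eq = refl
  ∑F-0 (suc n) eq = trans (cong₂ _+_ (eq zero) (∑F-0 n (eq ∘ suc))) (+-identityˡ 0#)

  ∑F-+ : ∀ n (f g : Fin n → Carrier) → ∑F n (λ i → f i + g i) ≡ ∑F n f + ∑F n g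
  ∑F-+ zero f g = sym (+-identityˡ 0#)
  ∑F-+ (suc n) f g = trans (cong (f zero + g zero +_) (∑F-+ n (f ∘ suc) (g ∘ suc))) (+-interchange _ _ _ _)

  ∑F-*ˡ : ∀ n a (f : Fin n → Carrier) → ∑F n (λ i → a * f i) ≡ a * ∑F n f
  ∑F-*ˡ zero a f = sym (zeroʳ a)
  ∑F-*ˡ (suc n) a f = trans (cong (a * f zero +_) (∑F-*ˡ n a (f ∘ suc))) (sym (distribˡ a _ _))

  ∑F-neg : ∀ n (f : Fin n → Carrier) → ∑F n (λ i → - f i) ≡ - ∑F n f
  ∑F-neg zero f = sym -0#≡0#
  ∑F-neg (suc n) f = trans (cong (- f zero +_) (∑F-neg n (f ∘ suc))) (-‿+-comm _ _)

  ∑F-swap : ∀ m n (f : Fin m → Fin n → Carrier) →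
    ∑F m (λ i → ∑F n (f i)) ≡ ∑F n (λ j → ∑F m (λ i → f i j))
  ∑F-swap zero n f = sym (∑F-0 n (λ _ → refl))
  ∑F-swap (suc m) n f = trans (cong (∑F n (f zero) +_) (∑F-swap m n (f ∘ suc))) (sym (∑F-+ n (f zero) _))

  ∑F-split : ∀ k c (f : Fin (k ℕ.+ c) → Carrier) → ∑F (k ℕ.+ c) f ≡ ∑F k (λ i → f (i ↑ˡ c)) + ∑F c (λ l → f (k ↑ʳ l))
  ∑F-split zero c f = sym (+-identityˡ _)
  ∑F-split (suc k) c f = trans (cong (f zero +_) (∑F-split k c (f ∘ suc))) (sym (+-assoc _ _ _))

  ∑F-unit : ∀ {n} (i : Fin n) (f : Fin n → Carrier) → ∑F n (λ j → unit i j · f j) ≡ f i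
  ∑F-unit {suc n} zero f = trans (cong (f zero +_) (∑F-0 n (λ _ → refl))) (+-identityʳ _)
  ∑F-unit (suc i) f = trans (+-identityˡ _) (trans (∑F-cong _ unit-suc) (∑F-unit i (f ∘ suc)))
    where
    unit-suc : ∀ j → unit (suc i) (suc j) · f (suc j) ≡ unit i j · f (suc j)
    unit-suc j with i Fin.≟ j
    ... | yes _ = refl
    ... | no _ = refl

  dot-comm : ∀ {n} (u v : V n) → dot F u v ≡ dot F v u
  dot-comm {n} u v = ∑F-cong n (λ i → *-comm (u i) (v i))

  dot-lincomb : ∀ {k n} (g : Fin k → V n) a c → dot F (lincomb F g a) c ≡ ∑F k (λ i → a i * dot F (g i) c)
  dot-lincomb {k} {n} g a c = begin
    ∑F n (λ j → ∑F k (λ i → a i * g i j) * c j)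
      ≡⟨ ∑F-cong n (λ j → trans (*-comm _ (c j)) (trans (sym (∑F-*ˡ k (c j) _))
           (∑F-cong k λ i → trans (*-comm (c j) _) (*-assoc (a i) (g i j) (c j))))) ⟩
    ∑F n (λ j → ∑F k (λ i → a i * (g i j * c j)))
      ≡⟨ ∑F-swap n k _ ⟩
    ∑F k (λ i → ∑F n (λ j → a i * (g i j * c j)))
      ≡⟨ ∑F-cong k (λ i → ∑F-*ˡ n (a i) _) ⟩
    ∑F k (λ i → a i * dot F (g i) c) ∎
    where open ≡-Reasoning

  dot-lincomb-0 : ∀ {k n} {g : Fin k → V n} {a c} → (∀ i → dot F (g i) c ≡ 0#) → dot F (lincomb F g a) c ≡ 0#
  dot-lincomb-0 {k} {g = g} {a} {c} eq = trans (dot-lincomb g a c)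
    (∑F-0 k (λ i → trans (cong (a i *_) (eq i)) (zeroʳ (a i))))

  dot-congˡ : ∀ {n} {u v : V n} c → u ≈ v → dot F u c ≡ dot F v c
  dot-congˡ {n} c eq = ∑F-cong n (λ i → cong (_* c i) (eq i))

  syndrome-tabulate′ : ∀ {r n} (f : Fin n → Col r) v i →
    syndrome (tabulate f) v i ≡ ∑F n (λ j → lookup (f j) i · v j)
  syndrome-tabulate′ {n = zero} f v i = refl
  syndrome-tabulate′ {n = suc n} f v i = cong (lookup (f zero) i · v zero +_) (syndrome-tabulate′ (f ∘ suc) (v ∘ suc) i)

  syndrome-++ : ∀ {r k c} (hs : Vec (Col r) k) (hs′ : Vec (Col r) c) v i →
    syndrome (hs Vec.++ hs′) v i ≡ syndrome hs (λ j → v (j ↑ˡ c)) i + syndrome hs′ (λ j → v (k ↑ʳ j)) i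
  syndrome-++ [] hs′ v i = sym (+-identityˡ _)
  syndrome-++ (h ∷ hs) hs′ v i = trans (cong (lookup h i · v zero +_) (syndrome-++ hs hs′ (v ∘ suc) i)) (sym (+-assoc _ _ _))

  syndrome-columns : ∀ {r n} (H : Fin r → Fin n → 𝔽₃) v i → syndrome (columns H) v i ≡ dot F (λ j → emb (H i j)) v
  syndrome-columns {n = n} H v i = trans (syndrome-tabulate′ _ v i)
    (∑F-cong n (λ j → trans (cong (_· v j) (lookup∘tabulate (λ i → H i j) i)) (sym (emb-* (H i j) (v j)))))

  kernel-check : ∀ {r n} (H : Fin r → Fin n → 𝔽₃) → ParityCheck (KernelCode F H) (columns H)
  kernel-check H = record
    { annihilates = λ {c} c∈C i → trans (syndrome-columns H c i) (c∈C i)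
    ; detects     = λ {c} eq i → trans (sym (syndrome-columns H c i)) (eq i)
    }

  span-dual-check : ∀ {k n} (G : Fin k → Fin n → 𝔽₃) → ParityCheck (Dual F (SpanCode F G)) (columns G)
  span-dual-check {k} {n} G = record
    { annihilates = λ {x} x∈D i → trans (syndrome-columns G x i) (trans (dot-comm _ x)
        (x∈D (λ j → emb (G i j)) ((λ i′ → unit i i′ · 1#) , λ j → sym (row i j))))
    ; detects = λ {x} eq c (a , c≈) → trans (dot-comm x c) (trans (dot-congˡ x c≈)
        (dot-lincomb-0 {g = λ i j → emb (G i j)} {a} {x} (λ i → trans (sym (syndrome-columns G x i)) (eq i))))
    }
    where
    row : ∀ i j → ∑F k (λ i′ → (unit i i′ · 1#) * emb (G i′ j)) ≡ emb (G i j)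
    row i j = trans (∑F-cong k (λ i′ → trans (sym (·-*-assoc (unit i i′) 1# _))
      (cong (unit i i′ ·_) (*-identityˡ _)))) (∑F-unit i (λ i′ → emb (G i′ j)))

  module _ {k c : ℕ} (G : Fin k → Fin (k ℕ.+ c) → 𝔽₃) (systematic : ∀ i j → G i (j ↑ˡ c) ≡ unit j i) where

    private
      M : Fin k → Fin c → 𝔽₃
      M i l = G i (k ↑ʳ l)

      rows : Fin k → V (k ℕ.+ c)
      rows i j = emb (G i j)

      hd : V (k ℕ.+ c) → V k
      hd x i = x (i ↑ˡ c)

      tl : V (k ℕ.+ c) → V c
      tl x l = x (k ↑ʳ l)

    a*emb : ∀ a m → a * emb m ≡ m · a
    a*emb a m = trans (*-comm a _) (emb-* m a)

    lincomb-hd : ∀ a j → lincomb F rows a (j ↑ˡ c) ≡ a j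
    lincomb-hd a j = trans (∑F-cong k (λ i → trans (a*emb (a i) (G i (j ↑ˡ c))) (cong (_· a i) (systematic i j)))) (∑F-unit j a)

    lincomb-tl : ∀ a l → lincomb F rows a (k ↑ʳ l) ≡ ∑F k (λ i → M i l · a i)
    lincomb-tl a l = ∑F-cong k (λ i → a*emb (a i) (M i l))

    syndrome-dual : ∀ x l → syndrome (dualColumns {k} {c} G) x l ≡ tl x l - ∑F k (λ i → M i l · hd x i)
    syndrome-dual x l = begin
      syndrome (dualColumns {k} {c} G) x l
        ≡⟨ syndrome-++ (tabulate (λ i → tabulate (λ l → -₃ M i l))) _ x l ⟩
      syndrome (tabulate (λ i → tabulate (λ l → -₃ M i l))) (hd x) l + syndrome (tabulate (λ j → tabulate (λ l → unit l j))) (tl x) l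
        ≡⟨ cong₂ _+_ (syndrome-tabulate′ (λ i → tabulate (λ l → -₃ M i l)) (hd x) l)
                     (syndrome-tabulate′ (λ j → tabulate (λ l → unit l j)) (tl x) l) ⟩
      ∑F k (λ i → lookup (tabulate (λ l → -₃ M i l)) l · hd x i) + ∑F c (λ j → lookup (tabulate (λ l → unit l j)) l · tl x j)
        ≡⟨ cong₂ _+_
             (trans (∑F-cong k (λ i → trans (cong (_· hd x i) (lookup∘tabulate (λ l → -₃ M i l) l)) (·-neg (M i l) _)))
               (∑F-neg k _))
             (trans (∑F-cong c (λ j → cong (_· tl x j) (lookup∘tabulate (λ l → unit l j) l))) (∑F-unit l (tl x))) ⟩
      - ∑F k (λ i → M i l · hd x i) + tl x l
        ≡⟨ +-comm _ _ ⟩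
      tl x l - ∑F k (λ i → M i l · hd x i) ∎
      where open ≡-Reasoning

    span-check : ParityCheck (SpanCode F G) (dualColumns {k} {c} G)
    span-check = record
      { annihilates = λ {x} (a , x≈) l → trans (syndrome-dual x l) (trans
          (cong₂ _-_ (trans (x≈ (k ↑ʳ l)) (lincomb-tl a l))
            (∑F-cong k (λ i → cong (M i l ·_) (trans (x≈ (i ↑ˡ c)) (lincomb-hd a i)))))
          (x-x≡0 _))
      ; detects = λ {x} eq → hd x , split-elim {k} {c}
          (λ i → sym (lincomb-hd (hd x) i))
          (λ l → trans (x-y≡0⇒x≡y _ _ (trans (sym (syndrome-dual x l)) (eq l))) (sym (lincomb-tl (hd x) l)))
      }

    span-dim : HasDim F (SpanCode F G) k
    span-dim = rows , (λ x x∈C → x∈C) , (λ a → a , λ _ → refl) ,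
      λ a eq i → trans (sym (lincomb-hd a i)) (eq (i ↑ˡ c))

    kernel-equation : ∀ x i → dot F (rows i) x ≡ hd x i + ∑F c (λ l → M i l · tl x l)
    kernel-equation x i = trans (∑F-split k c _) (cong₂ _+_
      (trans (∑F-cong k (λ j → trans (emb-* (G i (j ↑ˡ c)) (hd x j)) (cong (_· hd x j) (trans (systematic i j) (unit-sym j i))))) (∑F-unit i (hd x)))
      (∑F-cong c (λ l → emb-* (M i l) _)))

    private
      -- The rows of [ -Mᵀ | I ], a basis of the kernel of [ I | M ].
      g : Fin c → V (k ℕ.+ c)
      g l j = [ (λ i → (-₃ M i l) · 1#) , (λ l′ → unit l l′ · 1#) ]′ (splitAt k j)

    g-hd : ∀ l i → g l (i ↑ˡ c) ≡ (-₃ M i l) · 1#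
    g-hd l i rewrite Finₚ.splitAt-↑ˡ k i c = refl

    g-tl : ∀ l l′ → g l (k ↑ʳ l′) ≡ unit l l′ · 1#
    g-tl l l′ rewrite Finₚ.splitAt-↑ʳ k c l′ = refl

    a*[m·1] : ∀ a m → a * (m · 1#) ≡ m · a
    a*[m·1] a m = trans (*-comm a _) (trans (sym (·-*-assoc m 1# a)) (cong (m ·_) (*-identityˡ a)))

    lincomb-g-hd : ∀ a i → lincomb F g a (i ↑ˡ c) ≡ - ∑F c (λ l → M i l · a l)
    lincomb-g-hd a i = trans (∑F-cong c (λ l → trans (cong (a l *_) (g-hd l i)) (trans (a*[m·1] (a l) (-₃ M i l)) (·-neg (M i l) (a l)))))
      (∑F-neg c _)

    lincomb-g-tl : ∀ a l′ → lincomb F g a (k ↑ʳ l′) ≡ a l′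
    lincomb-g-tl a l′ = trans (∑F-cong c (λ l → trans (cong (a l *_) (g-tl l l′)) (trans (a*[m·1] (a l) (unit l l′))
      (cong (_· a l) (unit-sym l l′))))) (∑F-unit l′ a)

    kernel-dim : HasDim F (KernelCode F G) c
    kernel-dim = g ,
      (λ x x∈C → tl x , split-elim {k} {c}
        (λ i → trans (x+y≡0⇒x≡-y _ _ (trans (sym (kernel-equation x i)) (x∈C i))) (sym (lincomb-g-hd (tl x) i)))
        (λ l → sym (lincomb-g-tl (tl x) l))) ,
      (λ a i → trans (kernel-equation (lincomb F g a) i) (trans
        (cong₂ _+_ (lincomb-g-hd a i) (∑F-cong c (λ l → cong (M i l ·_) (lincomb-g-tl a l))))
        (-‿inverseˡ _))) ,
      λ a eq l → trans (sym (lincomb-g-tl a l)) (eq (k ↑ʳ l))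

    -- No dimension count is needed for the double dual: orthogonality to the basis `g` is already
    -- the parity check of the row space, and the row space is orthogonal to the kernel.
    kernel-dual-check : ParityCheck (Dual F (KernelCode F G)) (dualColumns {k} {c} G)
    kernel-dual-check = record
      { annihilates = λ {x} x∈D l → trans (syndrome-dual x l) (trans (sym (dot-g x l)) (x∈D (g l) (g∈C l)))
      ; detects = λ {x} eq y y∈C → let a , x≈ = ParityCheck.detects span-check {x} eq in
          trans (dot-congˡ y x≈) (dot-lincomb-0 {g = rows} {a} {y} y∈C)
      }
      where
      dot-g : ∀ x l → dot F x (g l) ≡ tl x l - ∑F k (λ i → M i l · hd x i)
      dot-g x l = trans (∑F-split k c _) (trans (cong₂ _+_
        (trans (∑F-cong k (λ i → trans (cong (hd x i *_) (g-hd l i)) (trans (a*[m·1] (hd x i) (-₃ M i l)) (·-neg (M i l) _)))) (∑F-neg k _))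
        (trans (∑F-cong c (λ l′ → trans (cong (tl x l′ *_) (g-tl l l′)) (a*[m·1] (tl x l′) (unit l l′)))) (∑F-unit l (tl x))))
        (+-comm _ _))
      g∈C : ∀ l → mem (KernelCode F G) (g l)
      g∈C l i = trans (kernel-equation (g l) i) (trans
        (cong₂ _+_ (trans (g-hd l i) (·-neg (M i l) 1#))
          (trans (∑F-cong c (λ l′ → trans (cong (M i l′ ·_) (g-tl l l′)) (·-comm (M i l′) (unit l l′) 1#)))
            (∑F-unit l (λ l′ → M i l′ · 1#))))
        (-‿inverseˡ _))
        where
        ·-comm : ∀ a b x → a · b · x ≡ b · a · x
        ·-comm a b x = trans (sym (·-*₃ a b x)) (trans (cong (_· x) (*₃-comm a b)) (·-*₃ b a x))

-- The dual weight distribution and a linear programming bound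

-- The i-subsets of {1, …, n}.
data Mask : ℕ → ℕ → Set where
  []      : Mask 0 0
  inside  : ∀ {n i} → Mask n i → Mask (suc n) (suc i)
  outside : ∀ {n i} → Mask n i → Mask (suc n) i

masks : ∀ n i → List (Mask n i)
masks zero zero = [] ∷ []
masks zero (suc i) = []
masks (suc n) zero = map outside (masks n zero)
masks (suc n) (suc i) = map inside (masks n i) ++ map outside (masks n (suc i))

binomial-< : ∀ {z i} → z < i → binomial z i ≡ 0
binomial-< {zero} {suc i} z<i = refl
binomial-< {suc z} {suc i} z<i = cong₂ ℕ._+_ (binomial-< (s≤s⁻¹ z<i)) (binomial-< (ℕₚ.m<n⇒m<1+n (s≤s⁻¹ z<i)))

binomial-diag : ∀ z → binomial z z ≡ 1
binomial-diag zero = refl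
binomial-diag (suc z) = cong₂ ℕ._+_ (binomial-diag z) (binomial-< (ℕₚ.n<1+n z))

module Duality (F : FiniteField) (char3 : Char3 F) where
  open Field F
  open Ternary F char3
  open Syndromes F char3
  open Points F char3 using (2≤q)
  open Codes F char3 using (dist-self; dist≡0⇒≈)

  -- `off J` indicates that `x` vanishes off `J`, `on J` that it vanishes on `J`.
  off on : ∀ {n i} → Mask n i → V n → ℕ
  off [] x = 1
  off (inside J) x = off J (x ∘ suc)
  off (outside J) x = δ (x zero) ℕ.* off J (x ∘ suc)
  on [] x = 1
  on (inside J) x = δ (x zero) ℕ.* on J (x ∘ suc)
  on (outside J) x = on J (x ∘ suc)

  ∑-off : ∀ n i (x : V n) → (∑[ J ∈ masks n i ] off J x) ≡ covers x i
  ∑-off zero zero x = refl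
  ∑-off zero (suc i) x = refl
  ∑-off (suc n) zero x = trans (∑-map outside (masks n zero))
    (trans (∑-*ˡ (δ (x zero)) (masks n zero) _) (cong (δ (x zero) ℕ.*_) (∑-off n zero (x ∘ suc))))
  ∑-off (suc n) (suc i) x = trans (∑-++ (map inside (masks n i)) _) (cong₂ ℕ._+_
    (trans (∑-map inside (masks n i)) (∑-off n i (x ∘ suc)))
    (trans (∑-map outside (masks n (suc i)))
      (trans (∑-*ˡ (δ (x zero)) (masks n (suc i)) _) (cong (δ (x zero) ℕ.*_) (∑-off n (suc i) (x ∘ suc))))))

  ∑-on : ∀ n i (x : V n) → (∑[ J ∈ masks n i ] on J x) ≡ binomial (n ∸ wt x) i
  ∑-on zero zero x = refl
  ∑-on zero (suc i) x = refl
  ∑-on (suc n) zero x = trans (∑-map outside (masks n zero)) (∑-on n zero (x ∘ suc))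
  ∑-on (suc n) (suc i) x = trans (∑-++ (map inside (masks n i)) _) (trans (cong₂ ℕ._+_
      (trans (∑-map inside (masks n i)) (trans (∑-*ˡ (δ (x zero)) (masks n i) _)
        (cong (δ (x zero) ℕ.*_) (∑-on n i (x ∘ suc)))))
      (trans (∑-map outside (masks n (suc i))) (∑-on n (suc i) (x ∘ suc))))
    (sym pascal))
    where
    w = wt (x ∘ suc)
    pascal : binomial (suc n ∸ wt x) (suc i) ≡ δ (x zero) ℕ.* binomial (n ∸ w) i ℕ.+ binomial (n ∸ w) (suc i)
    pascal with x zero ≟ 0#
    ... | yes _ = trans (cong (λ z → binomial z (suc i)) (ℕₚ.+-∸-assoc 1 (wt≤n (x ∘ suc))))
                    (cong (ℕ._+ binomial (n ∸ w) (suc i)) (sym (ℕₚ.+-identityʳ _)))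
    ... | no _ = refl

  ∑≢0-at : ∀ {n} {f : V n → ℕ} → Respects f → ∀ v → f v ≢ 0 → ∑ (vectors n) f ≢ 0
  ∑≢0-at {n} {f} f-cong v fv≢0 eq with w , w∈ , v≈w ← find (allVecs-complete F n v) =
    fv≢0 (trans (f-cong v≈w) (ℕₚ.n≤0⇒n≡0 (subst (f w ≤_) eq (∑-term f w∈))))

  ∑-off-vectors : ∀ {n i} (J : Mask n i) → ∑ (vectors n) (off J) ≡ q ^ i
  ∑-off-vectors [] = refl
  ∑-off-vectors {suc n} {suc i} (inside J) = trans (∑-vectors n _)
    (trans (∑-const elements _) (cong (q ℕ.*_) (∑-off-vectors J)))
  ∑-off-vectors {suc n} (outside J) = trans (∑-vectors n _)
    (trans (∑-cong elements (λ a → ∑-*ˡ (δ a) (vectors n) (off J))) (trans (∑-at 0# (λ _ → ∑ (vectors n) (off J))) (∑-off-vectors J)))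

  -- The constant `a` absorbs the coordinates already processed, for the induction; the duality uses
  -- `a = 0#`.
  dotCount : ∀ {n i} → Mask n i → V n → Carrier → ℕ
  dotCount {n} J c a = ∑[ x ∈ vectors n ] (off J x ℕ.* δ (a + dot F x c))

  ∑-shift : ∀ b (f : Carrier → ℕ) → (∑[ a ∈ elements ] f (b + a)) ≡ ∑ elements f
  ∑-shift b f = ∑-bijection (b +_) (- b +_)
    (λ x → trans (sym (+-assoc b (- b) x)) (trans (cong (_+ x) (-‿inverseʳ b)) (+-identityˡ x)))
    (λ x → trans (sym (+-assoc (- b) b x)) (trans (cong (_+ x) (-‿inverseˡ b)) (+-identityˡ x))) f

  ∑-scale : ∀ {c} → c ≢ 0# → ∀ (f : Carrier → ℕ) → (∑[ a ∈ elements ] f (a * c)) ≡ ∑ elements f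
  ∑-scale {c} c≢0 f = let c⁻¹ , cc⁻¹≡1 = inverse c c≢0 in ∑-bijection (_* c) (_* c⁻¹)
    (λ x → trans (*-assoc x c⁻¹ c) (trans (cong (x *_) (trans (*-comm c⁻¹ c) cc⁻¹≡1)) (trans (*-comm x 1#) (*-identityˡ x))))
    (λ x → trans (*-assoc x c c⁻¹) (trans (cong (x *_) cc⁻¹≡1) (trans (*-comm x 1#) (*-identityˡ x)))) f

  ∑-δ : (∑[ a ∈ elements ] δ a) ≡ 1
  ∑-δ = trans (∑-cong elements (λ a → sym (ℕₚ.*-identityʳ (δ a)))) (∑-at 0# (λ _ → 1))

  dotCount-inside : ∀ {n i} (J : Mask n i) c a →
    dotCount (inside J) c a ≡ (∑[ b ∈ elements ] dotCount J (c ∘ suc) (a + b * c zero))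
  dotCount-inside {n} J c a = trans (∑-vectors n _) (∑-cong elements (λ b → ∑-cong (vectors n) (λ x →
    cong (λ z → off J x ℕ.* δ z) (sym (+-assoc a (b * c zero) _)))))

  dotCount-outside : ∀ {n i} (J : Mask n i) c a → dotCount (outside J) c a ≡ dotCount J (c ∘ suc) a
  dotCount-outside {n} J c a = trans (∑-vectors n _) (trans
    (∑-cong elements (λ b → trans (∑-cong (vectors n) (λ x → ℕₚ.*-assoc (δ b) (off J x) _)) (∑-*ˡ (δ b) (vectors n) _)))
    (trans (∑-at 0# (λ b → ∑[ x ∈ vectors n ] (off J x ℕ.* δ (a + (b * c zero + dot F x (c ∘ suc))))))
      (∑-cong (vectors n) (λ x → cong (λ z → off J x ℕ.* δ (a + z)) (trans (cong (_+ dot F x (c ∘ suc)) (zeroˡ (c zero))) (+-identityˡ _))))))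

  -- A linear form that vanishes on 𝔽^J has q^i zeros there, any other has q^(i-1); both cases at once.
  q*dotCount : ∀ {n i} (J : Mask n i) c a →
    q ℕ.* dotCount J c a ℕ.+ on J c ℕ.* q ^ i ≡ q ^ i ℕ.+ on J c ℕ.* (δ a ℕ.* (q ℕ.* q ^ i))
  q*dotCount [] c a = trans (cong (λ z → q ℕ.* (1 ℕ.* δ z ℕ.+ 0) ℕ.+ 1) (+-identityʳ a)) (rearrange q (δ a))
    where
    rearrange : ∀ q d → q ℕ.* (1 ℕ.* d ℕ.+ 0) ℕ.+ 1 ≡ 1 ℕ.+ 1 ℕ.* (d ℕ.* (q ℕ.* 1))
    rearrange = solve 2 (λ q d → q :* (con 1 :* d :+ con 0) :+ con 1 := con 1 :+ con 1 :* (d :* (q :* con 1))) refl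
      where open ℕ-Solver.+-*-Solver
  q*dotCount (outside J) c a = trans (cong (λ z → q ℕ.* z ℕ.+ _) (dotCount-outside J c a)) (q*dotCount J (c ∘ suc) a)
  q*dotCount {suc n} {suc i} (inside J) c a with c zero ≟ 0#
  ... | yes c₀≡0 = trans (cong₂ (λ z w → q ℕ.* z ℕ.+ w ℕ.* (q ℕ.* q ^ i))
        (trans (dotCount-inside J c a) (trans (∑-cong elements (λ b → cong (dotCount J (c ∘ suc))
          (trans (cong (a +_) (trans (cong (b *_) c₀≡0) (zeroʳ b))) (+-identityʳ a)))) (∑-const elements _)))
        (ℕₚ.+-identityʳ (on J (c ∘ suc))))
      (trans (left q (dotCount J (c ∘ suc) a) (on J (c ∘ suc)) (q ^ i)) (trans (cong (q ℕ.*_) (q*dotCount J (c ∘ suc) a))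
        (right q (on J (c ∘ suc)) (q ^ i) (δ a))))
    where
    open ℕ-Solver.+-*-Solver
    left : ∀ q d o p → q ℕ.* (q ℕ.* d) ℕ.+ o ℕ.* (q ℕ.* p) ≡ q ℕ.* (q ℕ.* d ℕ.+ o ℕ.* p)
    left = solve 4 (λ q d o p → q :* (q :* d) :+ o :* (q :* p) := q :* (q :* d :+ o :* p)) refl
    right : ∀ q o p d → q ℕ.* (p ℕ.+ o ℕ.* (d ℕ.* (q ℕ.* p))) ≡ q ℕ.* p ℕ.+ (1 ℕ.* o) ℕ.* (d ℕ.* (q ℕ.* (q ℕ.* p)))
    right = solve 4 (λ q o p d → q :* (p :+ o :* (d :* (q :* p))) := q :* p :+ (con 1 :* o) :* (d :* (q :* (q :* p)))) refl
  -- As `b` runs over the field so does `a + b * c zero`, hence each vector on the remaining part of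
  -- `J` is counted exactly once.
  ... | no c₀≢0 = cong (λ z → q ℕ.* z ℕ.+ 0) (begin
      dotCount (inside J) c a
        ≡⟨ dotCount-inside J c a ⟩
      (∑[ b ∈ elements ] dotCount J (c ∘ suc) (a + b * c zero))
        ≡⟨ trans (∑-scale c₀≢0 (λ b → dotCount J (c ∘ suc) (a + b))) (∑-shift a (dotCount J (c ∘ suc))) ⟩
      (∑[ b ∈ elements ] dotCount J (c ∘ suc) b)
        ≡⟨ ∑-swap elements (vectors n) _ ⟩
      (∑[ x ∈ vectors n ] ∑[ b ∈ elements ] (off J x ℕ.* δ (b + dot F x (c ∘ suc))))
        ≡⟨ ∑-cong (vectors n) (λ x → trans (∑-*ˡ (off J x) elements _) (trans (cong (off J x ℕ.*_)
             (trans (∑-cong elements (λ b → cong δ (+-comm b _))) (trans (∑-shift (dot F x (c ∘ suc)) δ) ∑-δ)))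
             (ℕₚ.*-identityʳ (off J x)))) ⟩
      ∑ (vectors n) (off J)
        ≡⟨ ∑-off-vectors J ⟩
      q ^ i ∎)
    where open ≡-Reasoning

  ∑-zro : ∀ n → ∑ (vectors n) zro ≡ 1
  ∑-zro zero = refl
  ∑-zro (suc n) = trans (∑-vectors n _) (trans (∑-cong elements (λ a → ∑-*ˡ (δ a) (vectors n) zro))
    (trans (∑-at 0# (λ _ → ∑ (vectors n) zro)) (∑-zro n)))

  zro-⇔ : ∀ {m n} {u : V m} {v : V n} → (u ≈ zeroV F → v ≈ zeroV F) → (v ≈ zeroV F → u ≈ zeroV F) → zro u ≡ zro v
  zro-⇔ {u = u} {v} to from with zro u in equ | zro v in eqv
  ... | zero | zero = refl
  ... | zero | suc _ with () ← trans (sym equ) (zro-yes (from (zro≢0 (λ z → ℕₚ.1+n≢0 (trans (sym eqv) z)))))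
  ... | suc k | _ = trans (sym equ) (trans (zro-yes 0u) (trans (sym (zro-yes (to 0u))) eqv))
    where 0u = zro≢0 (λ z → ℕₚ.1+n≢0 (trans (sym equ) z))

  module _ {n : ℕ} (C : Code F n) (linear : IsLinear F C) where

    private
      χ : V n → ℕ
      χ c = ind (mem? C c)

      χ⊥ : V n → ℕ
      χ⊥ x = ind (mem? (Dual F C) x)

      size : ℕ
      size = ∑ (vectors n) χ

      fibre : V n → Carrier → ℕ
      fibre x b = ∑[ c ∈ vectors n ] (χ c ℕ.* δ (b - dot F x c))

    mem-0 : mem C (zeroV F)
    mem-0 = proj₁ linear

    mem-reflect : ∀ u v → mem C u → mem C v → mem C (λ i → u i - v i)
    mem-reflect u v u∈C v∈C = resp C (λ i → cong (u i +_) (trans (sym (-‿distribˡ-* 1# (v i))) (cong -_ (*-identityˡ (v i)))))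
      (proj₁ (proj₂ linear) u _ u∈C (proj₂ (proj₂ linear) (- 1#) v v∈C))

    dot-- : ∀ {m} (x u v : V m) → dot F x (λ i → u i - v i) ≡ dot F x u - dot F x v
    dot-- {zero} x u v = sym (x-0≡x 0#)
    dot-- {suc m} x u v = trans (cong₂ _+_
        (trans (distribˡ (x zero) (u zero) (- v zero)) (cong (x zero * u zero +_) (sym (-‿distribʳ-* (x zero) (v zero)))))
        (dot-- (x ∘ suc) (u ∘ suc) (v ∘ suc)))
      (-‿interchange _ _ _ _)

    dot-scale : ∀ {m} (x u : V m) t → dot F x (λ i → t * u i) ≡ t * dot F x u
    dot-scale {zero} x u t = sym (zeroʳ t)
    dot-scale {suc m} x u t = trans (cong₂ _+_
        (trans (sym (*-assoc (x zero) t (u zero))) (trans (cong (_* u zero) (*-comm (x zero) t)) (*-assoc t (x zero) (u zero))))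
        (dot-scale (x ∘ suc) (u ∘ suc) t)) (sym (distribˡ t _ _))

    dot-congʳ : ∀ {m} (x : V m) {u v} → u ≈ v → dot F x u ≡ dot F x v
    dot-congʳ {m} x eq = sumF-cong F m (λ i → cong (x i *_) (eq i))

    -- c ↦ t u - c permutes C and maps the kernel of x onto the fibre over t (x · u).
    fibre-constant : ∀ x {u} → mem C u → ∀ t → fibre x 0# ≡ fibre x (t * dot F x u)
    fibre-constant x {u} u∈C t = trans (sym (∑-reflect (λ i → t * u i) kernel-cong))
      (∑-cong (vectors n) (λ c → cong₂ ℕ._*_
        (ind-⇔ (mem? C (λ i → t * u i - c i)) (mem? C c)
          (λ p → resp C (λ i → x-[x-y]≡y _ _) (mem-reflect _ _ tu∈C p)) (λ p → mem-reflect _ _ tu∈C p))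
        (trans (cong (λ z → δ (0# - z)) (trans (dot-- x (λ i → t * u i) c) (cong (_- dot F x c) (dot-scale x u t))))
          (ind-⇔ ((0# - (t * dot F x u - dot F x c)) ≟ 0#) ((t * dot F x u - dot F x c) ≟ 0#) to from))))
      where
      tu∈C : mem C (λ i → t * u i)
      tu∈C = proj₂ (proj₂ linear) t u u∈C
      to : ∀ {y} → 0# - y ≡ 0# → y ≡ 0#
      to eq = sym (x-y≡0⇒x≡y _ _ eq)
      from : ∀ {y} → y ≡ 0# → 0# - y ≡ 0#
      from refl = x-0≡x 0#
      kernel-cong : Respects (λ c → χ c ℕ.* δ (0# - dot F x c))
      kernel-cong {c} {c′} eq = cong₂ ℕ._*_
        (ind-⇔ (mem? C c) (mem? C c′) (resp C eq) (resp C (sym ∘ eq))) (cong (λ z → δ (0# - z)) (dot-congʳ x eq))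

    fibres : ∀ x → (∑[ b ∈ elements ] fibre x b) ≡ size
    fibres x = trans (∑-swap elements (vectors n) _) (∑-cong (vectors n) (λ c → trans (∑-*ˡ (χ c) elements _)
      (trans (cong (χ c ℕ.*_) (trans (∑-cong elements (λ b → cong δ (+-comm b _))) (trans (∑-shift (- dot F x c) δ) ∑-δ)))
        (ℕₚ.*-identityʳ (χ c)))))

    -- The same dichotomy for `C` in place of 𝔽^J: either `x` is in the dual and the kernel is all
    -- of `C`, or the `q` fibres have equal size.
    q*kernel : ∀ x → q ℕ.* fibre x 0# ℕ.+ χ⊥ x ℕ.* size ≡ size ℕ.+ χ⊥ x ℕ.* (q ℕ.* size)
    q*kernel x = cases (mem? (Dual F C) x)
      where
      in-dual : mem (Dual F C) x → fibre x 0# ≡ size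
      in-dual x∈D = ∑-cong (vectors n) (λ c → case c (mem? C c))
        where
        case : ∀ c (d : Dec (mem C c)) → ind d ℕ.* δ (0# - dot F x c) ≡ ind d
        case c (no _) = refl
        case c (yes c∈C) = trans (ℕₚ.+-identityʳ _) (ind-yes (_ ≟ 0#) (trans (cong (λ z → 0# - z) (x∈D c c∈C)) (x-0≡x 0#)))
      not-in-dual : ¬ mem (Dual F C) x → q ℕ.* fibre x 0# ≡ size
      not-in-dual x∉D = trans (sym (∑-const elements (fibre x 0#))) (trans (∑-cong elements constant) (fibres x))
        where
        f : V n → ℕ
        f c = χ c ℕ.* ind (¬? (dot F x c ≟ 0#))
        f-cong : Respects f
        f-cong {c} {c′} eq = cong₂ ℕ._*_ (ind-⇔ (mem? C c) (mem? C c′) (resp C eq) (resp C (sym ∘ eq)))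
          (cong (λ z → ind (¬? (z ≟ 0#))) (dot-congʳ x eq))
        witness : ∃ λ c → f c ≢ 0
        witness = ∑≢0 (vectors n) f λ ∑≡0 → x∉D λ c c∈C → decidable-stable (dot F x c ≟ 0#) λ ne →
          ∑≢0-at {f = f} f-cong c (λ fc≡0 → ℕₚ.1+n≢0 (trans (sym (cong₂ ℕ._*_ (ind-yes (mem? C c) c∈C)
            (ind-yes (¬? (dot F x c ≟ 0#)) ne))) fc≡0)) ∑≡0
        u : V n
        u = proj₁ witness
        u∈C : mem C u
        u∈C = ind≢0 (mem? C u) (λ eq → proj₂ witness (cong (ℕ._* ind (¬? (dot F x u ≟ 0#))) eq))
        d≢0 : dot F x u ≢ 0#
        d≢0 = ind≢0 (¬? (dot F x u ≟ 0#)) (λ eq → proj₂ witness (trans (cong (χ u ℕ.*_) eq) (ℕₚ.*-zeroʳ (χ u))))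
        constant : ∀ b → fibre x 0# ≡ fibre x b
        constant b = let y , dy≡1 = inverse (dot F x u) d≢0 in
          trans (fibre-constant x u∈C (b * y)) (cong (fibre x) (trans (*-assoc b y _)
            (trans (cong (b *_) (trans (*-comm y _) dy≡1)) (trans (*-comm b 1#) (*-identityˡ b)))))
      cases : ∀ (d : Dec (mem (Dual F C) x)) → q ℕ.* fibre x 0# ℕ.+ ind d ℕ.* size ≡ size ℕ.+ ind d ℕ.* (q ℕ.* size)
      cases (yes p) = trans (cong (λ z → q ℕ.* z ℕ.+ 1 ℕ.* size) (in-dual p)) (rearrange (q ℕ.* size) size)
        where
        rearrange : ∀ a b → a ℕ.+ 1 ℕ.* b ≡ b ℕ.+ 1 ℕ.* a
        rearrange = solve 2 (λ a b → a :+ con 1 :* b := b :+ con 1 :* a) refl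
          where open ℕ-Solver.+-*-Solver
      cases (no p) = cong (ℕ._+ 0) (not-in-dual p)

    private
      -- The double count of {(c, x) : c ∈ C, x supported in J, c · x = 0}, done in both orders,
      -- gives the hypotheses; X and Y are the two sides of the duality.
      cancel : ∀ P E X Y → q ℕ.* P ℕ.+ X ≡ E ℕ.+ q ℕ.* X → q ℕ.* P ℕ.+ Y ≡ E ℕ.+ q ℕ.* Y → X ≡ Y
      cancel P E X Y eqX eqY with q | 2≤q
      ... | suc (suc p) | s≤s (s≤s z≤n) = sym (ℕₚ.*-cancelˡ-≡ Y X (suc p) (ℕₚ.+-cancelˡ-≡ (E ℕ.+ (X ℕ.+ Y)) _ _ (begin
        E ℕ.+ (X ℕ.+ Y) ℕ.+ suc p ℕ.* Y            ≡⟨ solve 4 (λ E X Y p → E :+ (X :+ Y) :+ (con 1 :+ p) :* Y := X :+ (E :+ (con 2 :+ p) :* Y)) refl E X Y p ⟩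
        X ℕ.+ (E ℕ.+ suc (suc p) ℕ.* Y)            ≡⟨ cong (X ℕ.+_) eqY ⟨
        X ℕ.+ (suc (suc p) ℕ.* P ℕ.+ Y)            ≡⟨ solve 3 (λ X Z Y → X :+ (Z :+ Y) := Z :+ X :+ Y) refl X (suc (suc p) ℕ.* P) Y ⟩
        suc (suc p) ℕ.* P ℕ.+ X ℕ.+ Y              ≡⟨ cong (ℕ._+ Y) eqX ⟩
        E ℕ.+ suc (suc p) ℕ.* X ℕ.+ Y              ≡⟨ solve 4 (λ E X Y p → E :+ (con 2 :+ p) :* X :+ Y := E :+ (X :+ Y) :+ (con 1 :+ p) :* X) refl E X Y p ⟩
        E ℕ.+ (X ℕ.+ Y) ℕ.+ suc p ℕ.* X            ∎)))
        where
        open ≡-Reasoning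
        open ℕ-Solver.+-*-Solver

    -- The MacWilliams identity for a single set `J`: it compares the dual words supported in `J`
    -- with the codewords vanishing on `J`, without characters. Summing over `J` gives the binomial
    -- moments.
    duality : ∀ {i} (J : Mask n i) →
      size ℕ.* (∑[ x ∈ vectors n ] (χ⊥ x ℕ.* off J x)) ≡ q ^ i ℕ.* (∑[ c ∈ vectors n ] (χ c ℕ.* on J c))
    duality {i} J = cancel P (size ℕ.* q ^ i) (size ℕ.* K) (q ^ i ℕ.* K′) by-x by-c
      where
      open ≡-Reasoning
      open ℕ-Solver.+-*-Solver
      K = ∑[ x ∈ vectors n ] (χ⊥ x ℕ.* off J x)
      K′ = ∑[ c ∈ vectors n ] (χ c ℕ.* on J c)
      P = ∑[ x ∈ vectors n ] (off J x ℕ.* fibre x 0#)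
      δ-minus : ∀ y → δ (0# - y) ≡ δ (0# + y)
      δ-minus y = ind-⇔ ((0# - y) ≟ 0#) ((0# + y) ≟ 0#)
        (λ eq → trans (+-identityˡ y) (sym (x-y≡0⇒x≡y _ _ eq)))
        (λ eq → trans (cong (λ z → 0# - z) (trans (sym (+-identityˡ y)) eq)) (x-0≡x 0#))
      P≡ : P ≡ (∑[ c ∈ vectors n ] (χ c ℕ.* dotCount J c 0#))
      P≡ = begin
        (∑[ x ∈ vectors n ] (off J x ℕ.* fibre x 0#))
          ≡⟨ ∑-cong (vectors n) (λ x → sym (∑-*ˡ (off J x) (vectors n) _)) ⟩
        (∑[ x ∈ vectors n ] ∑[ c ∈ vectors n ] (off J x ℕ.* (χ c ℕ.* δ (0# - dot F x c))))
          ≡⟨ ∑-swap (vectors n) (vectors n) _ ⟩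
        (∑[ c ∈ vectors n ] ∑[ x ∈ vectors n ] (off J x ℕ.* (χ c ℕ.* δ (0# - dot F x c))))
          ≡⟨ ∑-cong (vectors n) (λ c → trans (∑-cong (vectors n) (λ x →
               trans (m*[n*o]≡n*[m*o] (off J x) (χ c) _) (cong (λ z → χ c ℕ.* (off J x ℕ.* z)) (δ-minus (dot F x c)))))
               (∑-*ˡ (χ c) (vectors n) _)) ⟩
        (∑[ c ∈ vectors n ] (χ c ℕ.* dotCount J c 0#)) ∎
      by-x : q ℕ.* P ℕ.+ size ℕ.* K ≡ size ℕ.* q ^ i ℕ.+ q ℕ.* (size ℕ.* K)
      by-x = begin
        q ℕ.* P ℕ.+ size ℕ.* K
          ≡⟨ cong₂ ℕ._+_ (∑-*ˡ q (vectors n) _) (∑-*ˡ size (vectors n) _) ⟨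
        (∑[ x ∈ vectors n ] (q ℕ.* (off J x ℕ.* fibre x 0#))) ℕ.+ (∑[ x ∈ vectors n ] (size ℕ.* (χ⊥ x ℕ.* off J x)))
          ≡⟨ ∑-+ (vectors n) _ _ ⟨
        (∑[ x ∈ vectors n ] (q ℕ.* (off J x ℕ.* fibre x 0#) ℕ.+ size ℕ.* (χ⊥ x ℕ.* off J x)))
          ≡⟨ ∑-cong (vectors n) (λ x → trans
               (solve 5 (λ q o f s d → q :* (o :* f) :+ s :* (d :* o) := o :* (q :* f :+ d :* s)) refl q (off J x) (fibre x 0#) size (χ⊥ x))
               (trans (cong (off J x ℕ.*_) (q*kernel x))
                 (solve 4 (λ q o s d → o :* (s :+ d :* (q :* s)) := s :* o :+ q :* (s :* (d :* o))) refl q (off J x) size (χ⊥ x)))) ⟩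
        (∑[ x ∈ vectors n ] (size ℕ.* off J x ℕ.+ q ℕ.* (size ℕ.* (χ⊥ x ℕ.* off J x))))
          ≡⟨ ∑-+ (vectors n) _ _ ⟩
        (∑[ x ∈ vectors n ] (size ℕ.* off J x)) ℕ.+ (∑[ x ∈ vectors n ] (q ℕ.* (size ℕ.* (χ⊥ x ℕ.* off J x))))
          ≡⟨ cong₂ ℕ._+_ (trans (∑-*ˡ size (vectors n) _) (cong (size ℕ.*_) (∑-off-vectors J)))
               (trans (∑-*ˡ q (vectors n) _) (cong (q ℕ.*_) (∑-*ˡ size (vectors n) _))) ⟩
        size ℕ.* q ^ i ℕ.+ q ℕ.* (size ℕ.* K) ∎
      by-c : q ℕ.* P ℕ.+ q ^ i ℕ.* K′ ≡ size ℕ.* q ^ i ℕ.+ q ℕ.* (q ^ i ℕ.* K′)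
      by-c = begin
        q ℕ.* P ℕ.+ q ^ i ℕ.* K′
          ≡⟨ cong (λ z → q ℕ.* z ℕ.+ q ^ i ℕ.* K′) P≡ ⟩
        q ℕ.* (∑[ c ∈ vectors n ] (χ c ℕ.* dotCount J c 0#)) ℕ.+ q ^ i ℕ.* K′
          ≡⟨ cong₂ ℕ._+_ (∑-*ˡ q (vectors n) _) (∑-*ˡ (q ^ i) (vectors n) _) ⟨
        (∑[ c ∈ vectors n ] (q ℕ.* (χ c ℕ.* dotCount J c 0#))) ℕ.+ (∑[ c ∈ vectors n ] (q ^ i ℕ.* (χ c ℕ.* on J c)))
          ≡⟨ ∑-+ (vectors n) _ _ ⟨
        (∑[ c ∈ vectors n ] (q ℕ.* (χ c ℕ.* dotCount J c 0#) ℕ.+ q ^ i ℕ.* (χ c ℕ.* on J c)))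
          ≡⟨ ∑-cong (vectors n) (λ c → trans
               (solve 5 (λ q o f s d → q :* (o :* f) :+ s :* (o :* d) := o :* (q :* f :+ d :* s)) refl q (χ c) (dotCount J c 0#) (q ^ i) (on J c))
               (trans (cong (χ c ℕ.*_) (trans (q*dotCount J c 0#)
                   (cong (λ z → q ^ i ℕ.+ on J c ℕ.* (z ℕ.* (q ℕ.* q ^ i))) (ind-yes (0# ≟ 0#) refl))))
                 (solve 4 (λ q o s d → o :* (s :+ d :* (con 1 :* (q :* s))) := o :* s :+ q :* (s :* (o :* d))) refl q (χ c) (q ^ i) (on J c)))) ⟩
        (∑[ c ∈ vectors n ] (χ c ℕ.* q ^ i ℕ.+ q ℕ.* (q ^ i ℕ.* (χ c ℕ.* on J c))))
          ≡⟨ ∑-+ (vectors n) _ _ ⟩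
        (∑[ c ∈ vectors n ] (χ c ℕ.* q ^ i)) ℕ.+ (∑[ c ∈ vectors n ] (q ℕ.* (q ^ i ℕ.* (χ c ℕ.* on J c))))
          ≡⟨ cong₂ ℕ._+_ (∑-*ʳ (q ^ i) (vectors n) χ)
               (trans (∑-*ˡ q (vectors n) _) (cong (q ℕ.*_) (∑-*ˡ (q ^ i) (vectors n) _))) ⟩
        size ℕ.* q ^ i ℕ.+ q ℕ.* (q ^ i ℕ.* K′) ∎

    dualMoment : ℕ → ℕ
    dualMoment i = ∑[ x ∈ vectors n ] (χ⊥ x ℕ.* covers x i)

    size*dualMoment : ∀ i → size ℕ.* dualMoment i ≡ q ^ i ℕ.* (∑[ c ∈ vectors n ] (χ c ℕ.* binomial (n ∸ wt c) i))
    size*dualMoment i = begin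
      size ℕ.* dualMoment i
        ≡⟨ cong (size ℕ.*_) (∑-cong (vectors n) (λ x → trans (cong (χ⊥ x ℕ.*_) (sym (∑-off n i x)))
             (sym (∑-*ˡ (χ⊥ x) (masks n i) _)))) ⟩
      size ℕ.* (∑[ x ∈ vectors n ] ∑[ J ∈ masks n i ] (χ⊥ x ℕ.* off J x))
        ≡⟨ cong (size ℕ.*_) (∑-swap (vectors n) (masks n i) _) ⟩
      size ℕ.* (∑[ J ∈ masks n i ] ∑[ x ∈ vectors n ] (χ⊥ x ℕ.* off J x))
        ≡⟨ ∑-*ˡ size (masks n i) _ ⟨
      (∑[ J ∈ masks n i ] (size ℕ.* (∑[ x ∈ vectors n ] (χ⊥ x ℕ.* off J x))))
        ≡⟨ ∑-cong (masks n i) duality ⟩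
      (∑[ J ∈ masks n i ] (q ^ i ℕ.* (∑[ c ∈ vectors n ] (χ c ℕ.* on J c))))
        ≡⟨ ∑-*ˡ (q ^ i) (masks n i) _ ⟩
      q ^ i ℕ.* (∑[ J ∈ masks n i ] ∑[ c ∈ vectors n ] (χ c ℕ.* on J c))
        ≡⟨ cong (q ^ i ℕ.*_) (∑-swap (masks n i) (vectors n) _) ⟩
      q ^ i ℕ.* (∑[ c ∈ vectors n ] ∑[ J ∈ masks n i ] (χ c ℕ.* on J c))
        ≡⟨ cong (q ^ i ℕ.*_) (∑-cong (vectors n) (λ c → trans (∑-*ˡ (χ c) (masks n i) _) (cong (χ c ℕ.*_) (∑-on n i c)))) ⟩
      q ^ i ℕ.* (∑[ c ∈ vectors n ] (χ c ℕ.* binomial (n ∸ wt c) i)) ∎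
      where open ≡-Reasoning

    size≡q^k : ∀ {k} → HasDim F C k → size ≡ q ^ k
    size≡q^k {k} (g , covered , inside-C , independent) = begin
      ∑ (vectors n) χ
        ≡⟨ ∑-cong (vectors n) (λ c → sym (preimages c (mem? C c))) ⟩
      (∑[ c ∈ vectors n ] ∑[ a ∈ vectors k ] zro (λ j → lincomb F g a j - c j))
        ≡⟨ ∑-swap (vectors n) (vectors k) _ ⟩
      (∑[ a ∈ vectors k ] ∑[ c ∈ vectors n ] zro (λ j → lincomb F g a j - c j))
        ≡⟨ ∑-cong (vectors k) (λ a → trans (∑-reflect (lincomb F g a) zro-cong) (∑-zro n)) ⟩
      (∑[ _ ∈ vectors k ] 1)
        ≡⟨ cardinality k ⟩
      q ^ k ∎
      where
      open ≡-Reasoning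
      cardinality : ∀ k → (∑[ _ ∈ vectors k ] 1) ≡ q ^ k
      cardinality zero = refl
      cardinality (suc k) = trans (∑-vectors k _) (trans (∑-const elements _) (cong (q ℕ.*_) (cardinality k)))
      lincomb-- : ∀ a b j → lincomb F g (λ i → a i - b i) j ≡ lincomb F g a j - lincomb F g b j
      lincomb-- a b j = trans (flip-dot (λ i → a i - b i)) (trans (dot-- (λ i → g i j) a b)
        (cong₂ _-_ (sym (flip-dot a)) (sym (flip-dot b))))
        where
        flip-dot : ∀ a → lincomb F g a j ≡ dot F (λ i → g i j) a
        flip-dot a = sumF-cong F k (λ i → *-comm (a i) (g i j))
      lincomb-0 : ∀ {a} → a ≈ zeroV F → lincomb F g a ≈ zeroV F
      lincomb-0 {a} a≈0 j = trans (sumF-cong F k (λ i → cong (_* g i j) (trans (a≈0 i) (sym (x-x≡0 0#)))))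
        (trans (lincomb-- (zeroV F) (zeroV F) j) (x-x≡0 _))
      preimages : ∀ c (d : Dec (mem C c)) → (∑[ a ∈ vectors k ] zro (λ j → lincomb F g a j - c j)) ≡ ind d
      preimages c (no c∉C) = ∑-0 (vectors k) (λ a → decidable-stable (zro (λ j → lincomb F g a j - c j) ℕ.≟ 0) λ ne →
        c∉C (resp C (λ j → x-y≡0⇒x≡y _ _ (zro≢0 ne j)) (inside-C a)))
      preimages c (yes c∈C) = let a₀ , c≈ = covered c c∈C in
        trans (∑-cong (vectors k) (λ a → zro-⇔ {v = λ i → a₀ i - a i}
          (λ eq i → trans (cong (λ z → z - a i) (x-y≡0⇒x≡y _ _ (independent (λ i → a₀ i - a i) (λ j → trans (lincomb-- a₀ a j)
              (trans (cong (_- lincomb F g a j) (trans (sym (c≈ j)) (sym (x-y≡0⇒x≡y _ _ (eq j))))) (x-x≡0 _))) i))) (x-x≡0 (a i)))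
          (λ eq j → trans (cong (lincomb F g a j +_) (cong -_ (trans (c≈ j) (x-y≡0⇒x≡y _ _
              (trans (sym (lincomb-- a₀ a j)) (lincomb-0 eq j)))))) (x-x≡0 _))))
          (trans (∑-reflect a₀ zro-cong) (∑-zro k))

    module _ {k d : ℕ} (n≡k+d : n ≡ k ℕ.+ suc d) (dim : HasDim F C k) (minDist : HasMinDist F C (suc d)) where

      private
        -- Since `n ≡ k ℕ.+ suc d`, a word heavier than the minimum has fewer than `k` zeros, too
        -- few for an `i`-set. Only the zero word and the words of minimum weight remain.
        light : ∀ i → k ≤ i → ∀ c → mem C c →
          binomial (n ∸ wt c) i ≡ zro c ℕ.* binomial n i ℕ.+ ind (wt c ℕ.≟ suc d) ℕ.* binomial k i
        light i k≤i c c∈C with wt c in eq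
        ... | zero = trans (sym (ℕₚ.*-identityˡ _)) (trans (cong (ℕ._* binomial n i)
              (sym (zro-yes (dist≡0⇒≈ c (zeroV F) eq)))) (sym (ℕₚ.+-identityʳ _)))
        ... | suc w = trans (heavy (suc w ℕ.≟ suc d)) (cong (λ z → z ℕ.* binomial n i ℕ.+ _) (sym zro≡0))
          where
          c≉0 : ¬ (c ≈ zeroV F)
          c≉0 c≈0 = ℕₚ.1+n≢0 (trans (sym eq) (trans (dist-cong c≈0 (λ _ → refl)) (dist-self (zeroV F {n}))))
          zro≡0 : zro c ≡ 0
          zro≡0 = decidable-stable (zro c ℕ.≟ 0) (λ ne → c≉0 (zro≢0 ne))
          d≤w : suc d ≤ suc w
          d≤w = subst (suc d ≤_) eq (proj₂ minDist c (zeroV F) c∈C mem-0 c≉0)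
          heavy : (p : Dec (suc w ≡ suc d)) → binomial (n ∸ suc w) i ≡ ind p ℕ.* binomial k i
          heavy (yes refl) = trans (cong (λ z → binomial z i) (trans (cong (_∸ suc d) n≡k+d) (ℕₚ.m+n∸n≡m k (suc d))))
            (sym (ℕₚ.*-identityˡ _))
          heavy (no ne) = binomial-< (ℕₚ.<-≤-trans (subst (n ∸ suc w <_) (trans (cong (_∸ suc d) n≡k+d) (ℕₚ.m+n∸n≡m k (suc d)))
            (ℕₚ.∸-monoʳ-< {n} (ℕₚ.≤∧≢⇒< d≤w (ne ∘ sym)) (subst (_≤ n) eq (wt≤n c)))) k≤i)

        χ*zro : ∀ c → χ c ℕ.* zro c ≡ zro c
        χ*zro c with zro c in eq
        ... | zero = ℕₚ.*-zeroʳ (χ c)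
        ... | suc _ = trans (cong (ℕ._* _) (ind-yes (mem? C c)
          (resp C (λ i → sym (zro≢0 (λ z → ℕₚ.1+n≢0 (trans (sym eq) z)) i)) mem-0))) (ℕₚ.*-identityˡ _)

        ∑-light : ∀ i → k ≤ i →
          (∑[ c ∈ vectors n ] (χ c ℕ.* binomial (n ∸ wt c) i)) ≡ binomial n i ℕ.+ A F (suc d) C ℕ.* binomial k i
        ∑-light i k≤i = begin
          (∑[ c ∈ vectors n ] (χ c ℕ.* binomial (n ∸ wt c) i))
            ≡⟨ ∑-cong (vectors n) (λ c → trans (cases c (mem? C c))
                 (distribute (χ c) (zro c) (binomial n i) (ind (wt c ℕ.≟ suc d)) (binomial k i))) ⟩
          (∑[ c ∈ vectors n ] (χ c ℕ.* zro c ℕ.* binomial n i ℕ.+ χ c ℕ.* ind (wt c ℕ.≟ suc d) ℕ.* binomial k i))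
            ≡⟨ ∑-+ (vectors n) _ _ ⟩
          (∑[ c ∈ vectors n ] (χ c ℕ.* zro c ℕ.* binomial n i)) ℕ.+
            (∑[ c ∈ vectors n ] (χ c ℕ.* ind (wt c ℕ.≟ suc d) ℕ.* binomial k i))
            ≡⟨ cong₂ ℕ._+_ (∑-*ʳ (binomial n i) (vectors n) (λ c → χ c ℕ.* zro c))
                 (∑-*ʳ (binomial k i) (vectors n) (λ c → χ c ℕ.* ind (wt c ℕ.≟ suc d))) ⟩
          (∑[ c ∈ vectors n ] (χ c ℕ.* zro c)) ℕ.* binomial n i ℕ.+
            (∑[ c ∈ vectors n ] (χ c ℕ.* ind (wt c ℕ.≟ suc d))) ℕ.* binomial k i
            ≡⟨ cong₂ (λ a b → a ℕ.* binomial n i ℕ.+ b ℕ.* binomial k i)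
                 (trans (∑-cong (vectors n) χ*zro) (∑-zro n))
                 (sym (trans (length-filter _ (vectors n)) (∑-cong (vectors n) (λ c →
                   ind-× (mem? C c ×-dec (wt c ℕ.≟ suc d)) (mem? C c) (wt c ℕ.≟ suc d) (λ p → p) _,_)))) ⟩
          1 ℕ.* binomial n i ℕ.+ A F (suc d) C ℕ.* binomial k i
            ≡⟨ cong (ℕ._+ A F (suc d) C ℕ.* binomial k i) (ℕₚ.*-identityˡ (binomial n i)) ⟩
          binomial n i ℕ.+ A F (suc d) C ℕ.* binomial k i ∎
          where
          open ≡-Reasoning
          cases : ∀ c (p : Dec (mem C c)) → ind p ℕ.* binomial (n ∸ wt c) i ≡
            ind p ℕ.* (zro c ℕ.* binomial n i ℕ.+ ind (wt c ℕ.≟ suc d) ℕ.* binomial k i)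
          cases c (no _) = refl
          cases c (yes p) = cong (1 ℕ.*_) (light i k≤i c p)
          distribute : ∀ x z b e b′ → x ℕ.* (z ℕ.* b ℕ.+ e ℕ.* b′) ≡ x ℕ.* z ℕ.* b ℕ.+ x ℕ.* e ℕ.* b′
          distribute = solve 5 (λ x z b e b′ → x :* (z :* b :+ e :* b′) := x :* z :* b :+ x :* e :* b′) refl
            where open ℕ-Solver.+-*-Solver

      -- The factor `binomial k (k ℕ.+ e)` is 1 for `e = 0` and 0 beyond, so the unknown count
      -- enters the first moment only and the next ones are fixed by the parameters.
      dualMoment≡ : ∀ e → dualMoment (k ℕ.+ e) ≡ q ^ e ℕ.* (binomial n (k ℕ.+ e) ℕ.+ A F (suc d) C ℕ.* binomial k (k ℕ.+ e))
      dualMoment≡ e = ℕₚ.*-cancelˡ-≡ _ _ (q ^ k) {{ℕₚ.m^n≢0 q k {{ℕ.>-nonZero (ℕₚ.≤-trans (s≤s z≤n) 2≤q)}}}} (begin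
        q ^ k ℕ.* dualMoment (k ℕ.+ e)
          ≡⟨ cong (ℕ._* dualMoment (k ℕ.+ e)) (size≡q^k dim) ⟨
        size ℕ.* dualMoment (k ℕ.+ e)
          ≡⟨ size*dualMoment (k ℕ.+ e) ⟩
        q ^ (k ℕ.+ e) ℕ.* (∑[ c ∈ vectors n ] (χ c ℕ.* binomial (n ∸ wt c) (k ℕ.+ e)))
          ≡⟨ cong₂ ℕ._*_ (ℕₚ.^-distribˡ-+-* q k e) (∑-light (k ℕ.+ e) (ℕₚ.m≤m+n k e)) ⟩
        q ^ k ℕ.* q ^ e ℕ.* (binomial n (k ℕ.+ e) ℕ.+ A F (suc d) C ℕ.* binomial k (k ℕ.+ e))
          ≡⟨ ℕₚ.*-assoc (q ^ k) (q ^ e) _ ⟩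
        q ^ k ℕ.* (q ^ e ℕ.* (binomial n (k ℕ.+ e) ℕ.+ A F (suc d) C ℕ.* binomial k (k ℕ.+ e))) ∎)
        where open ≡-Reasoning

      -- A linear programming bound: the pointwise inequality is a polynomial in the number of
      -- zeros of a dual word that is nonnegative at integers, summed over the dual code.
      linear-programming-bound : ∀ α β γ E a → .{{ℕ.NonZero α}} →
        (∀ (w : Fin (suc n)) → let w = Fin.toℕ w in
          β ℕ.* coverings w (n ∸ w) (k ℕ.+ 1) ℕ.+ E ℕ.* ind (w ℕ.≟ 0) ≤
          α ℕ.* coverings w (n ∸ w) (k ℕ.+ 0) ℕ.+ γ ℕ.* coverings w (n ∸ w) (k ℕ.+ 2)) →
        α ℕ.* (binomial n (k ℕ.+ 0) ℕ.+ a) ℕ.+ γ ℕ.* (q ^ 2 ℕ.* binomial n (k ℕ.+ 2)) ≤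
          β ℕ.* (q ^ 1 ℕ.* binomial n (k ℕ.+ 1)) ℕ.+ E →
        a ≤ A F (suc d) C
      linear-programming-bound α β γ E a pointwise tight = ℕₚ.+-cancelˡ-≤ (binomial n (k ℕ.+ 0)) _ _ (ℕₚ.*-cancelˡ-≤ α
        (ℕₚ.+-cancelʳ-≤ (γ ℕ.* (q ^ 2 ℕ.* binomial n (k ℕ.+ 2))) _ _ (begin
          α ℕ.* (binomial n (k ℕ.+ 0) ℕ.+ a) ℕ.+ γ ℕ.* (q ^ 2 ℕ.* binomial n (k ℕ.+ 2))
            ≤⟨ tight ⟩
          β ℕ.* (q ^ 1 ℕ.* binomial n (k ℕ.+ 1)) ℕ.+ E
            ≡⟨ cong₂ ℕ._+_ (cong (β ℕ.*_) (sym (trans (dualMoment≡ 1) (cong (q ^ 1 ℕ.*_) (vanishing 0)))))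
                 (sym (trans (cong (E ℕ.*_) (trans (∑-cong (vectors n) zero-word) (∑-zro n))) (ℕₚ.*-identityʳ E))) ⟩
          β ℕ.* dualMoment (k ℕ.+ 1) ℕ.+ E ℕ.* (∑[ x ∈ vectors n ] (χ⊥ x ℕ.* ind (wt x ℕ.≟ 0)))
            ≡⟨ cong₂ ℕ._+_ (∑-*ˡ β (vectors n) _) (∑-*ˡ E (vectors n) _) ⟨
          (∑[ x ∈ vectors n ] (β ℕ.* (χ⊥ x ℕ.* covers x (k ℕ.+ 1)))) ℕ.+
            (∑[ x ∈ vectors n ] (E ℕ.* (χ⊥ x ℕ.* ind (wt x ℕ.≟ 0))))
            ≡⟨ ∑-+ (vectors n) _ _ ⟨
          (∑[ x ∈ vectors n ] (β ℕ.* (χ⊥ x ℕ.* covers x (k ℕ.+ 1)) ℕ.+ E ℕ.* (χ⊥ x ℕ.* ind (wt x ℕ.≟ 0))))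
            ≤⟨ ∑-mono (vectors n) at ⟩
          (∑[ x ∈ vectors n ] (α ℕ.* (χ⊥ x ℕ.* covers x (k ℕ.+ 0)) ℕ.+ γ ℕ.* (χ⊥ x ℕ.* covers x (k ℕ.+ 2))))
            ≡⟨ trans (∑-+ (vectors n) _ _) (cong₂ ℕ._+_ (∑-*ˡ α (vectors n) _) (∑-*ˡ γ (vectors n) _)) ⟩
          α ℕ.* dualMoment (k ℕ.+ 0) ℕ.+ γ ℕ.* dualMoment (k ℕ.+ 2)
            ≡⟨ cong₂ (λ y z → α ℕ.* y ℕ.+ γ ℕ.* z)
                 (trans (dualMoment≡ 0) (trans (ℕₚ.*-identityˡ _) (cong (binomial n (k ℕ.+ 0) ℕ.+_)
                   (trans (cong (λ z → A F (suc d) C ℕ.* binomial k z) (ℕₚ.+-identityʳ k))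
                     (trans (cong (A F (suc d) C ℕ.*_) (binomial-diag k)) (ℕₚ.*-identityʳ _))))))
                 (trans (dualMoment≡ 2) (cong (q ^ 2 ℕ.*_) (vanishing 1))) ⟩
          α ℕ.* (binomial n (k ℕ.+ 0) ℕ.+ A F (suc d) C) ℕ.+ γ ℕ.* (q ^ 2 ℕ.* binomial n (k ℕ.+ 2)) ∎)))
        where
        open ℕₚ.≤-Reasoning
        vanishing : ∀ e → binomial n (k ℕ.+ suc e) ℕ.+ A F (suc d) C ℕ.* binomial k (k ℕ.+ suc e) ≡ binomial n (k ℕ.+ suc e)
        vanishing e = trans (cong (λ z → binomial n (k ℕ.+ suc e) ℕ.+ A F (suc d) C ℕ.* z)
            (binomial-< (ℕₚ.m<m+n k (s≤s z≤n))))
          (trans (cong (binomial n (k ℕ.+ suc e) ℕ.+_) (ℕₚ.*-zeroʳ (A F (suc d) C))) (ℕₚ.+-identityʳ _))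
        zero-word : ∀ x → χ⊥ x ℕ.* ind (wt x ℕ.≟ 0) ≡ zro x
        zero-word x with wt x in eq
        ... | zero = trans (ℕₚ.*-identityʳ _) (trans (ind-yes (mem? (Dual F C) x) (λ c _ →
                trans (sumF-cong F n (λ i → cong (_* c i) (x≈0 i))) (dot-zeroˡ c))) (sym (zro-yes x≈0)))
          where
          x≈0 : x ≈ zeroV F
          x≈0 = dist≡0⇒≈ x (zeroV F) eq
          dot-zeroˡ : ∀ {m} (c : V m) → dot F (zeroV F) c ≡ 0#
          dot-zeroˡ {zero} c = refl
          dot-zeroˡ {suc m} c = trans (cong₂ _+_ (zeroˡ (c zero)) (dot-zeroˡ (c ∘ suc))) (+-identityˡ 0#)
        ... | suc w = trans (ℕₚ.*-zeroʳ (χ⊥ x)) (sym (decidable-stable (zro x ℕ.≟ 0) λ ne → ℕₚ.1+n≢0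
                (trans (sym eq) (trans (dist-cong {n} (zro≢0 ne) (λ _ → refl)) (dist-self (zeroV F {n}))))))
        at : ∀ x → β ℕ.* (χ⊥ x ℕ.* covers x (k ℕ.+ 1)) ℕ.+ E ℕ.* (χ⊥ x ℕ.* ind (wt x ℕ.≟ 0)) ≤
          α ℕ.* (χ⊥ x ℕ.* covers x (k ℕ.+ 0)) ℕ.+ γ ℕ.* (χ⊥ x ℕ.* covers x (k ℕ.+ 2))
        at x = begin
          β ℕ.* (χ⊥ x ℕ.* covers x (k ℕ.+ 1)) ℕ.+ E ℕ.* (χ⊥ x ℕ.* ind (wt x ℕ.≟ 0))
            ≡⟨ factor β E (χ⊥ x) _ _ ⟩
          χ⊥ x ℕ.* (β ℕ.* covers x (k ℕ.+ 1) ℕ.+ E ℕ.* ind (wt x ℕ.≟ 0))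
            ≤⟨ ℕₚ.*-monoʳ-≤ (χ⊥ x) bound ⟩
          χ⊥ x ℕ.* (α ℕ.* covers x (k ℕ.+ 0) ℕ.+ γ ℕ.* covers x (k ℕ.+ 2))
            ≡⟨ factor α γ (χ⊥ x) _ _ ⟨
          α ℕ.* (χ⊥ x ℕ.* covers x (k ℕ.+ 0)) ℕ.+ γ ℕ.* (χ⊥ x ℕ.* covers x (k ℕ.+ 2)) ∎
          where
          factor : ∀ a b x c d → a ℕ.* (x ℕ.* c) ℕ.+ b ℕ.* (x ℕ.* d) ≡ x ℕ.* (a ℕ.* c ℕ.+ b ℕ.* d)
          factor = solve 5 (λ a b x c d → a :* (x :* c) :+ b :* (x :* d) := x :* (a :* c :+ b :* d)) refl
            where open ℕ-Solver.+-*-Solver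
          bound : β ℕ.* covers x (k ℕ.+ 1) ℕ.+ E ℕ.* ind (wt x ℕ.≟ 0) ≤ α ℕ.* covers x (k ℕ.+ 0) ℕ.+ γ ℕ.* covers x (k ℕ.+ 2)
          bound rewrite covers≡coverings x (k ℕ.+ 0) | covers≡coverings x (k ℕ.+ 1) | covers≡coverings x (k ℕ.+ 2) =
            subst (λ w → β ℕ.* coverings w (n ∸ w) (k ℕ.+ 1) ℕ.+ E ℕ.* ind (w ℕ.≟ 0) ≤
                α ℕ.* coverings w (n ∸ w) (k ℕ.+ 0) ℕ.+ γ ℕ.* coverings w (n ∸ w) (k ℕ.+ 2))
              (Finₚ.toℕ-fromℕ< (s≤s (wt≤n x))) (pointwise (Fin.fromℕ< (s≤s (wt≤n x))))

-- Certificates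

all-sound : ∀ {A : Set} (f : A → Bool) xs → all f xs ≡ true → ∀ {x} → x ∈ xs → f x ≡ true
all-sound f (x ∷ xs) eq p with f x in fx
all-sound f (x ∷ xs) eq (here refl) | true = fx
all-sound f (x ∷ xs) eq (there p) | true = all-sound f xs eq p

≡ᵇ-sound : ∀ a b → (a ≡ᵇ b) ≡ true → a ≡ b
≡ᵇ-sound a b eq = ℕₚ.≡ᵇ⇒≡ a b (subst T (sym eq) tt)

satisfiable : ∀ {r l} → List (System r) → Vec (Col r) l → Bool
satisfiable T ts = any (λ S → sat ts (proj₂ S)) T

-- At the point with coordinates ts the total is a + b q, whatever the field size q.
Evaluates : ∀ {r l} → List (System r) → Vec (Col r) l → ℕ → ℕ → Set
Evaluates T ts a b = all (λ S → proj₁ S <ᵇ 2) T ≡ true × hits 0 T ts ≡ a × hits 1 T ts ≡ b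

evalAt-evaluates : ∀ {r l} q (T : List (System r)) (ts : Vec (Col r) l) {a b} →
  Evaluates T ts a b → evalAt q T ts ≡ a ℕ.+ b ℕ.* q
evalAt-evaluates q T ts (low , refl , refl) = evalAt-linear q T ts low

-- Tests whether `d` is the first index with a nonzero moment, that is, the distance from the code.
inShell : ∀ {R} → (Fin (suc R) → ℕ) → ℕ → Bool
inShell {R} value d = all (λ i → if toℕ i <ᵇ d then value i ≡ᵇ 0 else (if toℕ i ≡ᵇ d then not (value i ≡ᵇ 0) else true)) (allFin (suc R))

matches : ∀ {R} → (ℕ → ℕ → ℕ) → (Fin (suc R) → ℕ) → ℕ → Bool
matches {R} f value d = if inShell value d then all (λ i → value i ≡ᵇ f d (toℕ i)) (allFin (suc R)) else true

-- Row d of f lists the moments expected at distance d from the code.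
profile : ∀ {r n} R t → (ℕ → ℕ → ℕ) → ℕ → Vec (Col r) n → Bool
-- The systems depend on the columns only; passing them as an argument shares them among all points.
profile {r} R t f q hs = check (tabulate {n = suc R} (λ i → systems (toℕ i) hs))
  where
  check : Vec (List (System r)) (suc R) → Bool
  check tables = all (λ t₁ → all (λ d → matches f (λ i → evalAt q (lookup tables i) (t₁ ∷ [])) (toℕ d)) (allFin (suc t))) (allCols r)

module Certificates (F : FiniteField) (char3 : Char3 F) where
  open Field F
  open Ternary F char3
  open Syndromes F char3
  open Points F char3
  open Codes F char3

  satisfiable⇒≢0 : ∀ {r l} (T : List (System r)) (ts : Vec (Col r) l) → satisfiable T ts ≡ true → evalAt q T ts ≢ 0
  satisfiable⇒≢0 ((k , L) ∷ T) ts eq z with sat ts L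
  ... | false = satisfiable⇒≢0 T ts eq z
  ... | true = q≢0 (ℕₚ.m^n≡0⇒m≡0 q k (ℕₚ.m+n≡0⇒m≡0 (q ^ k) z))

  module Certified {r n : ℕ} {C : Code F n} {hs : Vec (Col r) n} (check : ParityCheck C hs) where
    open Checked check public

    S₀-evaluates : ∀ i {a b} → Evaluates (systems i hs) [] a b → S₀ i ≡ a ℕ.+ b ℕ.* q
    -- The empty family of coordinates, independent over every field, represents the zero syndrome.
    S₀-evaluates i ev = trans (total≡evalAt {ω = λ ()} (λ { [] _ → refl }) (systems i hs) [])
      (evalAt-evaluates q (systems i hs) [] ev)

    -- A dependent set of columns contributes `q` where an independent one contributes 1. As `2≤q`,
    -- one dependent set already lifts the moment above the binomial coefficient.
    minDist-certified : ∀ {d} → suc d ≤ n → Evaluates (systems d hs) [] (binomial n d) 0 →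
      ∀ {a b} → Evaluates (systems (suc d) hs) [] a (suc b) → a ℕ.+ suc b ≡ binomial n (suc d) → HasMinDist F C (suc d)
    minDist-certified {d} d<n ev {a} {b} ev′ sum = minDist d<n (trans (S₀-evaluates d ev) (ℕₚ.+-identityʳ _)) λ eq →
      ℕₚ.<⇒≢ (begin-strict
        binomial n (suc d)      ≡⟨ sum ⟨
        a ℕ.+ suc b             ≡⟨ cong (a ℕ.+_) (ℕₚ.*-identityʳ (suc b)) ⟨
        a ℕ.+ suc b ℕ.* 1       <⟨ ℕₚ.+-monoʳ-< a (ℕₚ.*-monoʳ-< (suc b) 2≤q) ⟩
        a ℕ.+ suc b ℕ.* q       ≡⟨ S₀-evaluates (suc d) ev′ ⟨
        S₀ (suc d)              ∎) (sym eq)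
      where open ℕₚ.≤-Reasoning

    module At {l : ℕ} {ω : V l} (independent : Independent ω) {R : ℕ} (free : unconstrained (systems R hs) ≡ true) where

      point : Vec (Col r) l → V n
      point ts = proj₁ (∃-syndrome R free (syndrome ts ω))

      S-point : ∀ i ts → S i (point ts) ≡ evalAt q (systems i hs) ts
      S-point i ts = trans (total-cong (systems i hs) (proj₂ (∃-syndrome R free (syndrome ts ω))))
        (total≡evalAt {ω = ω} independent (systems i hs) ts)

      S-evaluates : ∀ i ts {a b} → Evaluates (systems i hs) ts a b → S i (point ts) ≡ a ℕ.+ b ℕ.* q
      S-evaluates i ts ev = trans (S-point i ts) (evalAt-evaluates q (systems i hs) ts ev)

      ¬upws-certified : ∀ {ρ} → ρ ≤ n → HasCovRad F C (suc (suc ρ)) → (ts : Fin 3 → Vec (Col r) l) →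
        (∀ p → Evaluates (systems ρ hs) (ts p) 0 0) → Evaluates (systems (suc ρ) hs) (ts 0₃) 0 0 →
        ∀ {y₁ y₂ x₀ x₁ x₂ k} →
        Evaluates (systems (suc ρ) hs) (ts 1₃) y₁ 0 → Evaluates (systems (suc ρ) hs) (ts 2₃) y₂ 0 →
        Evaluates (systems (suc (suc ρ)) hs) (ts 0₃) x₀ 0 → Evaluates (systems (suc (suc ρ)) hs) (ts 1₃) x₁ 0 →
        Evaluates (systems (suc (suc ρ)) hs) (ts 2₃) x₂ k →
        y₁ ℕ.* (x₂ ℕ.+ k ℕ.* q) ℕ.+ x₀ ℕ.* y₂ ≢ x₁ ℕ.* y₂ ℕ.+ x₀ ℕ.* y₁ → ¬ IsUPWS F C
      ¬upws-certified {ρ} ρ≤n cov ts holes y₀ {y₁} {y₂} {x₀} {x₁} {x₂} {k} ev-y₁ ev-y₂ ev-x₀ ev-x₁ ev-x₂ det =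
        ¬upws ρ≤n cov (point ∘ ts) (λ p → S-evaluates ρ (ts p) (holes p)) (S-evaluates (suc ρ) (ts 0₃) y₀)
          (det ∘ λ eq → trans (sym (cong₂ ℕ._+_ (cong₂ ℕ._*_ (val (suc ρ) 1₃ ev-y₁) (S-evaluates (suc (suc ρ)) (ts 2₃) ev-x₂))
              (cong₂ ℕ._*_ (val (suc (suc ρ)) 0₃ ev-x₀) (val (suc ρ) 2₃ ev-y₂))))
            (trans eq (cong₂ ℕ._+_ (cong₂ ℕ._*_ (val (suc (suc ρ)) 1₃ ev-x₁) (val (suc ρ) 2₃ ev-y₂))
              (cong₂ ℕ._*_ (val (suc (suc ρ)) 0₃ ev-x₀) (val (suc ρ) 1₃ ev-y₁)))))
        where
        val : ∀ i p {a} → Evaluates (systems i hs) (ts p) a 0 → S i (point (ts p)) ≡ a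
        val i p ev = trans (S-evaluates i (ts p) ev) (ℕₚ.+-identityʳ _)

      -- A spanning set of `R` columns bounds the radius whatever `q` is, so a single deep hole
      -- settles it even where the syndromes cannot be enumerated.
      covRad-redundancy : ∀ {R′} → R ≡ suc R′ → R ≤ n → (ts : Vec (Col r) l) → Evaluates (systems R′ hs) ts 0 0 → HasCovRad F C R
      covRad-redundancy {R′} refl R≤n ts ev = covRad R≤n (λ v → total≢0 (systems R hs) free (syndrome hs v)) (point ts , S-evaluates R′ ts ev)

      module _ (3^l≡q : 3 ^ l ≡ q) where

        -- Once `ω` is a basis, a check over all coordinate vectors reaches every syndrome.
        S-everywhere : ∀ v → ∃ λ ts → ∀ i → S i v ≡ evalAt q (systems i hs) ts
        S-everywhere v = let ts , eq = spans {ω = ω} independent 3^l≡q (syndrome hs v) in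
          ts , λ i → trans (total-cong (systems i hs) {t = syndrome ts ω} eq) (total≡evalAt {ω = ω} independent (systems i hs) ts)

        covRad-certified : ∀ {R′} → suc R′ ≤ n → ((ts : Vec (Col r) l) → satisfiable (systems (suc R′) hs) ts ≡ true) →
          (ts : Vec (Col r) l) → Evaluates (systems R′ hs) ts 0 0 → HasCovRad F C (suc R′)
        covRad-certified {R′} R≤n covered ts ev = covRad R≤n
          (λ v z → let ts , eq = S-everywhere v in
            satisfiable⇒≢0 (systems (suc R′) hs) ts (covered ts) (trans (sym (eq (suc R′))) z))
          (point ts , S-evaluates R′ ts ev)

        upws-certified : ∀ {R′} → HasCovRad F C R′ → ∀ D (γ γ′ : ℕ → ℕ) →
          (∀ ts → (Σ[ i < suc R′ ] (γ i ℕ.* evalAt q (systems i hs) ts)) ≡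
                  suc D ℕ.+ (Σ[ i < suc R′ ] (γ′ i ℕ.* evalAt q (systems i hs) ts))) → IsUPWS F C
        upws-certified {R′} cov D γ γ′ relation = upws cov D γ γ′ λ v → let ts , eq = S-everywhere v in
          trans (Σ<-cong (suc R′) (λ i _ → cong (γ i ℕ.*_) (eq i))) (trans (relation ts)
            (cong (suc D ℕ.+_) (sym (Σ<-cong (suc R′) (λ i _ → cong (γ′ i ℕ.*_) (eq i))))))

    module _ (q≡3 : q ≡ 3) {ω : V 1} (independent : Independent ω) {R₀ : ℕ} (free : unconstrained (systems R₀ hs) ≡ true) where

      open At {ω = ω} independent {R₀} free

      profile-sound : ∀ {R t} f → t ≤ R → profile R t f 3 hs ≡ true → ∀ v d → d ≤ t →
        (∀ i → i < d → S i v ≡ 0) → S d v ≢ 0 → ∀ i → i ≤ R → S i v ≡ f d i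
      profile-sound {R} {t} f t≤R eq v d d≤t empty nonempty i i≤R = conclude (S-everywhere (sym q≡3) v)
        where
        tables : Vec (List (System r)) (suc R)
        tables = tabulate (λ i → systems (toℕ i) hs)
        conclude : (∃ λ ts → ∀ i → S i v ≡ evalAt q (systems i hs) ts) → S i v ≡ f d i
        conclude (t₁ ∷ [] , S≡) = trans (S≡val i i≤R) (trans (≡ᵇ-sound _ _ (all-sound _ (allFin (suc R))
            (unfold (all-sound _ (allFin (suc t)) (all-sound _ (allCols r) eq (∈-allCols t₁)) (∈-allFin (fromℕ< (s≤s d≤t)))))
            (∈-allFin (fromℕ< (s≤s i≤R)))))
          (cong (f d) (Finₚ.toℕ-fromℕ< (s≤s i≤R))))
          where
          val : Fin (suc R) → ℕ
          val j = evalAt 3 (lookup tables j) (t₁ ∷ [])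
          val≡S : ∀ j → val j ≡ S (toℕ j) v
          val≡S j = trans (cong (λ T → evalAt 3 T (t₁ ∷ [])) (lookup∘tabulate (λ i → systems (toℕ i) hs) j))
            (trans (cong (λ q → evalAt q (systems (toℕ j) hs) (t₁ ∷ [])) (sym q≡3)) (sym (S≡ (toℕ j))))
          S≡val : ∀ i (i≤R : i ≤ R) → S i v ≡ val (fromℕ< (s≤s i≤R))
          S≡val i i≤R = trans (cong (λ i → S i v) (sym (Finₚ.toℕ-fromℕ< (s≤s i≤R)))) (sym (val≡S (fromℕ< (s≤s i≤R))))
          all-true : ∀ {A : Set} (f : A → Bool) xs → (∀ x → f x ≡ true) → all f xs ≡ true
          all-true f [] h = refl
          all-true f (x ∷ xs) h = cong₂ _∧_ (h x) (all-true f xs h)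
          ≡⇒≡ᵇ-true : ∀ a b → a ≡ b → (a ≡ᵇ b) ≡ true
          ≡⇒≡ᵇ-true a b a≡b with a ≡ᵇ b in e
          ... | true = refl
          ... | false = ⊥-elim (subst T e (ℕₚ.≡⇒≡ᵇ a b a≡b))
          in-shell : inShell val d ≡ true
          in-shell = all-true _ (allFin (suc R)) shell
            where
            shell : ∀ j → (if toℕ j <ᵇ d then val j ≡ᵇ 0 else (if toℕ j ≡ᵇ d then not (val j ≡ᵇ 0) else true)) ≡ true
            shell j with toℕ j <ᵇ d in lt
            ... | true = ≡⇒≡ᵇ-true (val j) 0 (trans (val≡S j) (empty (toℕ j) (ℕₚ.<ᵇ⇒< (toℕ j) d (subst T (sym lt) tt))))
            ... | false with toℕ j ≡ᵇ d in e
            ...   | false = refl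
            ...   | true with val j ≡ᵇ 0 in z
            ...     | false = refl
            ...     | true = ⊥-elim (nonempty (trans (cong (λ k → S k v) (sym (≡ᵇ-sound (toℕ j) d e)))
                        (trans (sym (val≡S j)) (≡ᵇ-sound (val j) 0 z))))
          unfold : matches f val (toℕ (fromℕ< (s≤s d≤t))) ≡ true → all (λ i → val i ≡ᵇ f d (toℕ i)) (allFin (suc R)) ≡ true
          unfold eq = lemma (subst (λ d → matches f val d ≡ true) (Finₚ.toℕ-fromℕ< (s≤s d≤t)) eq)
            where
            lemma : matches f val d ≡ true → all (λ i → val i ≡ᵇ f d (toℕ i)) (allFin (suc R)) ≡ true
            lemma eq = trans (sym (cong (λ b → if b then all (λ i → val i ≡ᵇ f d (toℕ i)) (allFin (suc R)) else true) in-shell)) eq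

Σ<-single : ∀ n w μ (f : ℕ → ℕ) → w < n → (Σ[ i < n ] (μ ℕ.* ind (w ℕ.≟ i) ℕ.* f i)) ≡ μ ℕ.* f w
Σ<-single n w μ f w<n = trans (Σ<-cong n (λ i _ → rearrange μ (ind (w ℕ.≟ i)) (f i))) (Σ<-ind n w (λ i → μ ℕ.* f i) w<n)
  where
  rearrange : ∀ a b c → a ℕ.* b ℕ.* c ≡ a ℕ.* c ℕ.* b
  rearrange = solve 3 (λ a b c → a :* b :* c := a :* c :* b) refl
    where open ℕ-Solver.+-*-Solver

coversAll : ∀ {r} → List (System r) → Bool
coversAll {r} T = all (λ t → satisfiable T (t ∷ [])) (allCols r)

coversPairs : ∀ {r} → List (System r) → Bool
coversPairs {r} T = all (λ s → all (λ t → satisfiable T (s ∷ t ∷ [])) (allCols r)) (allCols r)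

relationHolds : ∀ {r n} → ℕ → ℕ → (ℕ → ℕ) → (ℕ → ℕ) → Vec (Col r) n → Bool
relationHolds {r} R D γ γ′ hs = all (λ t →
  (Σ[ i < suc R ] (γ i ℕ.* evalAt 3 (systems i hs) (t ∷ []))) ≡ᵇ
  (suc D ℕ.+ (Σ[ i < suc R ] (γ′ i ℕ.* evalAt 3 (systems i hs) (t ∷ []))))) (allCols r)

coversAll-sound : ∀ {r} (T : List (System r)) → coversAll T ≡ true → (ts : Vec (Col r) 1) → satisfiable T ts ≡ true
coversAll-sound {r} T covers (t ∷ []) = all-sound (λ t → satisfiable T (t ∷ [])) (allCols r) covers (∈-allCols t)

coversPairs-sound : ∀ {r} (T : List (System r)) → coversPairs T ≡ true → (ts : Vec (Col r) 2) → satisfiable T ts ≡ true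
coversPairs-sound {r} T covers (s ∷ t ∷ []) = all-sound (λ t → satisfiable T (s ∷ t ∷ [])) (allCols r)
  (all-sound (λ s → all (λ t → satisfiable T (s ∷ t ∷ [])) (allCols r)) (allCols r) covers (∈-allCols s)) (∈-allCols t)

relationHolds-sound : ∀ {r n} R D γ γ′ (hs : Vec (Col r) n) → relationHolds R D γ γ′ hs ≡ true → (ts : Vec (Col r) 1) →
  (Σ[ i < suc R ] (γ i ℕ.* evalAt 3 (systems i hs) ts)) ≡ suc D ℕ.+ (Σ[ i < suc R ] (γ′ i ℕ.* evalAt 3 (systems i hs) ts))
relationHolds-sound {r} R D γ γ′ hs holds (t ∷ []) = ≡ᵇ-sound _ _ (all-sound
  (λ t → (Σ[ i < suc R ] (γ i ℕ.* evalAt 3 (systems i hs) (t ∷ []))) ≡ᵇ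
         (suc D ℕ.+ (Σ[ i < suc R ] (γ′ i ℕ.* evalAt 3 (systems i hs) (t ∷ [])))))
  (allCols r) holds (∈-allCols t))

-- Found by computer search: hole₁ (for q = 3) and points₂ 0₃ (for q ≥ 9) are deep holes of all
-- three dual codes.
hole₁ : Col 6
hole₁ = 0₃ ∷ 1₃ ∷ 1₃ ∷ 1₃ ∷ 1₃ ∷ 1₃ ∷ []

points₂ : Fin 3 → Vec (Col 6) 2
points₂ 0₃ = (2₃ ∷ 0₃ ∷ 1₃ ∷ 1₃ ∷ 2₃ ∷ 2₃ ∷ []) ∷ (0₃ ∷ 2₃ ∷ 2₃ ∷ 2₃ ∷ 2₃ ∷ 2₃ ∷ []) ∷ []
points₂ 1₃ = (2₃ ∷ 0₃ ∷ 1₃ ∷ 1₃ ∷ 2₃ ∷ 2₃ ∷ []) ∷ (1₃ ∷ 1₃ ∷ 1₃ ∷ 1₃ ∷ 0₃ ∷ 1₃ ∷ []) ∷ []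
points₂ 2₃ = (2₃ ∷ 2₃ ∷ 0₃ ∷ 1₃ ∷ 0₃ ∷ 1₃ ∷ []) ∷ (1₃ ∷ 1₃ ∷ 0₃ ∷ 1₃ ∷ 1₃ ∷ 0₃ ∷ []) ∷ []

-- The computations in 𝔽₃ for a pair of dual codes with parity check matrices H and D.  There are
-- 1 + hexads dependent 6-sets of columns of H and 1 + circles dependent (1 + c)-sets of columns
-- of D; p₁, p₂ (for q = 3) and points₂ (for q ≥ 9) refute the UPWS property.
record Certificate {c : ℕ} (H : Vec (Col 6) (6 ℕ.+ suc c)) (D : Vec (Col (suc c)) (6 ℕ.+ suc c)) : Set where
  n : ℕ
  n = 6 ℕ.+ suc c
  field
    hexads independents : ℕ
    H-5 : Evaluates (systems 5 H) [] (binomial n 5) 0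
    H-6 : Evaluates (systems 6 H) [] independents (suc hexads)
    H-7 : Evaluates (systems 7 H) [] 0 (binomial n 7)
    H-6-total : independents ℕ.+ suc hexads ≡ binomial n 6
    H-7-total : coverings 6 (suc c) 7 ℕ.* suc hexads ≡ binomial n 7
    hexads-maximal : n Comb.C c ≡ suc c ℕ.* suc hexads
    H-free : unconstrained (systems 6 H) ≡ true
    D-c : Evaluates (systems c D) [] (binomial n c) 0
    circles circle-free : ℕ
    D-1+c : Evaluates (systems (suc c) D) [] (suc circle-free) (suc circles)
    D-1+c-total : suc circle-free ℕ.+ suc circles ≡ binomial n (suc c)
    D-free : unconstrained (systems (suc c) D) ≡ true
    D-proportional : proportional (suc c) (systems c D) (systems (suc c) D) ≡ just (suc circle-free)
    H-covers : coversAll (systems 5 H) ≡ true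
    H-hole : Evaluates (systems 4 H) (hole₁ ∷ []) 0 0
    p₁ p₂ : Col 6
    y₁ y₂ x₀ x₁ x₂ : ℕ
    p-holes : ∀ p → Evaluates (systems 3 H) (lookup (hole₁ ∷ p₁ ∷ p₂ ∷ []) p ∷ []) 0 0
    p-y₁ : Evaluates (systems 4 H) (p₁ ∷ []) y₁ 0
    p-y₂ : Evaluates (systems 4 H) (p₂ ∷ []) y₂ 0
    p-x₀ : Evaluates (systems 5 H) (hole₁ ∷ []) x₀ 0
    p-x₁ : Evaluates (systems 5 H) (p₁ ∷ []) x₁ 0
    p-x₂ : Evaluates (systems 5 H) (p₂ ∷ []) x₂ 0
    p-det : y₁ ℕ.* (x₂ ℕ.+ 0) ℕ.+ x₀ ℕ.* y₂ ≢ x₁ ℕ.* y₂ ℕ.+ x₀ ℕ.* y₁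
    a₁ a₂ k : ℕ
    pp-holes : ∀ p → Evaluates (systems 4 H) (points₂ p) 0 0
    pp-y₀ : Evaluates (systems 5 H) (points₂ 0₃) 0 0
    pp-y₁ : Evaluates (systems 5 H) (points₂ 1₃) (suc a₁) 0
    pp-y₂ : Evaluates (systems 5 H) (points₂ 2₃) a₂ 0
    pp-x₀ : Evaluates (systems 6 H) (points₂ 0₃) independents 0
    pp-x₁ : Evaluates (systems 6 H) (points₂ 1₃) independents 0
    pp-x₂ : Evaluates (systems 6 H) (points₂ 2₃) independents (suc k)

-- Consequences of a certificate for a pair of dual codes

module Families (F : FiniteField) (char3 : Char3 F) where
  open Field F
  open Ternary F char3
  open Syndromes F char3
  open Points F char3
  open Codes F char3
  open Systematic F char3
  open Certificates F char3

  module Family {c : ℕ} {H : Vec (Col 6) (6 ℕ.+ suc c)} {D : Vec (Col (suc c)) (6 ℕ.+ suc c)} (certificate : Certificate H D)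
    {Ker Spn : Code F (6 ℕ.+ suc c)} (kernel-dim : HasDim F Ker (suc c)) (span-dim : HasDim F Spn 6)
    (ker-check : ParityCheck Ker H) (spn-check : ParityCheck Spn D)
    (ker-dual-check : ParityCheck (Dual F Ker) D) (spn-dual-check : ParityCheck (Dual F Spn) H) where
    open Certificate certificate

    private
      minDist-H : ∀ {C : Code F n} → ParityCheck C H → HasMinDist F C 6
      minDist-H check = Certified.minDist-certified check {5} (s≤s (s≤s (s≤s (s≤s (s≤s (s≤s z≤n)))))) H-5 H-6 H-6-total

      minDist-D : ∀ {C : Code F n} → ParityCheck C D → HasMinDist F C (suc c)
      minDist-D check = Certified.minDist-certified check {c} (ℕₚ.m≤n+m (suc c) 6) D-c D-1+c D-1+c-total

      module K = Certified ker-check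
      module P = Certified spn-check

    kernel-NMDS : IsNMDS F Ker
    kernel-NMDS = suc c , 6 , suc c , kernel-dim , minDist-H ker-check ,
      minDist-D ker-dual-check , refl , refl

    span-NMDS : IsNMDS F Spn
    span-NMDS = 6 , suc c , 6 , span-dim , minDist-D spn-check , minDist-H spn-dual-check ,
      ℕₚ.+-comm (suc c) 6 , ℕₚ.+-comm (suc c) 6

    span-params : ∀ {R} → HasCovRad F Spn R → Params F Spn 6 (suc c) R
    span-params cov = span-dim , minDist-D spn-check , cov

    span-covRad : ∀ {l} {ω : V l} → Independent ω → (ts : Vec (Col (suc c)) l) → Evaluates (systems c D) ts 0 0 →
      HasCovRad F Spn (suc c)
    span-covRad indep ts hole = P.At.covRad-redundancy indep {suc c} D-free refl (ℕₚ.m≤n+m (suc c) 6) ts hole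

    span-relation : ∀ v → suc c ℕ.* P.S (suc c) v ≡ suc c ℕ.* suc circle-free ℕ.+ q ℕ.* P.S c v
    span-relation v = total-proportional (suc c) (systems c D) (systems (suc c) D) D-proportional (syndrome D v)

    span-UPWS : HasCovRad F Spn (suc c) → IsUPWS F Spn
    -- The successor of this number computes to the constant `suc c ℕ.* suc circle-free` of
    -- `span-relation`.
    span-UPWS cov = P.upws cov (circle-free ℕ.+ c ℕ.* suc circle-free) (λ i → suc c ℕ.* ind (suc c ℕ.≟ i)) (λ i → q ℕ.* ind (c ℕ.≟ i)) λ v →
      trans (Σ<-single (suc (suc c)) (suc c) (suc c) (λ i → P.S i v) ℕₚ.≤-refl)
        (trans (span-relation v) (cong (suc c ℕ.* suc circle-free ℕ.+_)
          (sym (Σ<-single (suc (suc c)) c q (λ i → P.S i v) (ℕₚ.n≤1+n (suc c))))))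

    kernel-small : q ≡ 3 → Params F Ker (suc c) 6 5 × IsNMDS F Ker × ¬ IsUPWS F Ker
    kernel-small q≡3 =
      (kernel-dim , minDist-H ker-check , cov) , kernel-NMDS ,
      K.At.¬upws-certified {ω = proj₁ base} (proj₂ base) {6} H-free {3} (s≤s (s≤s (s≤s z≤n))) cov
        (λ p → lookup (hole₁ ∷ p₁ ∷ p₂ ∷ []) p ∷ []) p-holes H-hole p-y₁ p-y₂ p-x₀ p-x₁ p-x₂ p-det
      where
      base : ∃ λ (ω : V 1) → Independent ω
      base = ∃-independent 1 (ℕₚ.≤-reflexive (sym q≡3))
      cov : HasCovRad F Ker 5
      cov = K.At.covRad-certified {ω = proj₁ base} (proj₂ base) {6} H-free (sym q≡3) (s≤s (s≤s (s≤s (s≤s (s≤s z≤n)))))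
          (coversAll-sound (systems 5 H) H-covers) (hole₁ ∷ []) H-hole

    kernel-large : 9 ≤ q → Params F Ker (suc c) 6 6 × IsNMDS F Ker × ¬ IsUPWS F Ker
    kernel-large 9≤q =
      (kernel-dim , minDist-H ker-check , cov) , kernel-NMDS ,
      K.At.¬upws-certified {ω = proj₁ base} (proj₂ base) {6} H-free {4} (s≤s (s≤s (s≤s (s≤s z≤n)))) cov
        points₂ pp-holes pp-y₀ pp-y₁ pp-y₂ pp-x₀ pp-x₁ pp-x₂ det
      where
      base : ∃ λ (ω : V 2) → Independent ω
      base = ∃-independent 2 9≤q
      cov : HasCovRad F Ker 6
      cov = K.At.covRad-redundancy {ω = proj₁ base} (proj₂ base) {6} H-free refl (ℕₚ.m≤m+n 6 (suc c)) (points₂ 0₃) pp-y₀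
      -- The first two points lie in no hyperplane spanned by a dependent 6-set and the third lies
      -- in `suc k` of them, so the sides differ by the positive number `suc a₁ ℕ.* (suc k ℕ.* q)`.
      det : suc a₁ ℕ.* (independents ℕ.+ suc k ℕ.* q) ℕ.+ independents ℕ.* a₂ ≢
        independents ℕ.* a₂ ℕ.+ independents ℕ.* suc a₁
      det eq = ℕₚ.<⇒≢ (ℕₚ.*-mono-≤ {1} {suc a₁} {1} (s≤s z≤n) (ℕₚ.*-mono-≤ {1} {suc k} (s≤s z≤n) (ℕₚ.≤-trans (s≤s z≤n) 9≤q)))
        (sym (ℕₚ.+-cancelˡ-≡ (independents ℕ.* a₂ ℕ.+ independents ℕ.* suc a₁) _ _
          (trans (sym (rearrange (suc a₁) independents (suc k ℕ.* q) a₂)) (trans eq (sym (ℕₚ.+-identityʳ _))))))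
        where
        rearrange : ∀ a i k b → a ℕ.* (i ℕ.+ k) ℕ.+ i ℕ.* b ≡ i ℕ.* b ℕ.+ i ℕ.* a ℕ.+ a ℕ.* k
        rearrange = solve 4 (λ a i k b → a :* (i :+ k) :+ i :* b := i :* b :+ i :* a :+ a :* k) refl
          where open ℕ-Solver.+-*-Solver

    private
      B₆ B₇ : ℕ
      B₆ = B F 6 (zeroV F) Ker
      B₇ = B F 7 (zeroV F) Ker

      S₀-5 : K.S₀ 5 ≡ binomial n 5
      S₀-5 = trans (K.S₀-evaluates 5 H-5) (ℕₚ.+-identityʳ _)

      6≤n : 6 ≤ n
      6≤n = ℕₚ.m≤m+n 6 (suc c)

      -- The moment at 6 is evaluated in two ways, by the systems and by weights. In effect every
      -- dependent 6-set supports `q ∸ 1` words of weight 6.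
      hexads*q : suc hexads ℕ.* q ≡ suc hexads ℕ.+ B₆
      hexads*q = ℕₚ.+-cancelˡ-≡ independents _ _ (begin
        independents ℕ.+ suc hexads ℕ.* q         ≡⟨ K.S₀-evaluates 6 H-6 ⟨
        K.S₀ 6                                    ≡⟨ K.S₀-first {5} 6≤n S₀-5 ⟩
        binomial n 6 ℕ.+ B₆                       ≡⟨ cong (ℕ._+ B₆) (sym H-6-total) ⟩
        independents ℕ.+ suc hexads ℕ.+ B₆        ≡⟨ ℕₚ.+-assoc independents (suc hexads) B₆ ⟩
        independents ℕ.+ (suc hexads ℕ.+ B₆)      ∎)
        where open ≡-Reasoning

    -- The complements of the dependent 6-sets are the blocks of Steiner systems 3-(10,4,1),
    -- 2-(9,3,1), 1-(8,2,1); `hexads-maximal` is their block count, which is what the bound asks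
    -- for.
    kernel-A₆ : toℚ (A F 6 Ker) ≡ Amax n (suc c) q
    kernel-A₆ = trans (cong toℚ (trans (K.A≡B 6) B₆≡)) (trans (toℚ-/ c (suc hexads ℕ.* (q ∸ 1)))
      (cong (λ z → ℤ.+ z ℚ./ suc c) (trans (sym (ℕₚ.*-assoc (suc c) (suc hexads) (q ∸ 1)))
        (cong (ℕ._* (q ∸ 1)) (sym hexads-maximal)))))
      where
      B₆≡ : B₆ ≡ suc hexads ℕ.* (q ∸ 1)
      B₆≡ = sym (begin
        suc hexads ℕ.* (q ∸ 1)                    ≡⟨ ℕₚ.*-distribˡ-∸ (suc hexads) q 1 ⟩
        suc hexads ℕ.* q ∸ suc hexads ℕ.* 1       ≡⟨ cong₂ _∸_ hexads*q (ℕₚ.*-identityʳ (suc hexads)) ⟩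
        suc hexads ℕ.+ B₆ ∸ suc hexads            ≡⟨ ℕₚ.m+n∸m≡n (suc hexads) B₆ ⟩
        B₆                                        ∎)
        where open ≡-Reasoning

    -- Each 7-set of columns has a one-dimensional space of relations. By `H-7-total` there are as
    -- many 7-sets as pairs of a dependent 6-set inside a 7-set, so the words of weight 0 and 6 use
    -- up the whole moment.
    kernel-A₇ : A F 7 Ker ≡ 0
    kernel-A₇ = trans (K.A≡B 7) (ℕₚ.+-cancelˡ-≡ (m ℕ.* (suc hexads ℕ.+ B₆)) B₇ 0 (begin
      m ℕ.* (suc hexads ℕ.+ B₆) ℕ.+ B₇            ≡⟨ cong (ℕ._+ B₇) (ℕₚ.*-distribˡ-+ m (suc hexads) B₆) ⟩
      m ℕ.* suc hexads ℕ.+ m ℕ.* B₆ ℕ.+ B₇        ≡⟨ cong (λ z → z ℕ.+ m ℕ.* B₆ ℕ.+ B₇) H-7-total ⟩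
      binomial n 7 ℕ.+ m ℕ.* B₆ ℕ.+ B₇            ≡⟨ K.S₀-second {5} 6≤n S₀-5 ⟨
      K.S₀ 7                                      ≡⟨ K.S₀-evaluates 7 H-7 ⟩
      binomial n 7 ℕ.* q                          ≡⟨ cong (ℕ._* q) (sym H-7-total) ⟩
      m ℕ.* suc hexads ℕ.* q                      ≡⟨ ℕₚ.*-assoc m (suc hexads) q ⟩
      m ℕ.* (suc hexads ℕ.* q)                    ≡⟨ cong (m ℕ.*_) hexads*q ⟩
      m ℕ.* (suc hexads ℕ.+ B₆)                   ≡⟨ ℕₚ.+-identityʳ _ ⟨
      m ℕ.* (suc hexads ℕ.+ B₆) ℕ.+ 0             ∎))
      where
      open ≡-Reasoning
      m = coverings 6 (suc c) 7

    span-A : q ≡ 3 → suc circle-free ℕ.+ suc circles ℕ.* 3 ≡ binomial n (suc c) ℕ.+ A F (suc c) Spn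
    span-A q≡3 = begin
      suc circle-free ℕ.+ suc circles ℕ.* 3       ≡⟨ cong (λ q → suc circle-free ℕ.+ suc circles ℕ.* q) q≡3 ⟨
      suc circle-free ℕ.+ suc circles ℕ.* q       ≡⟨ P.S₀-evaluates (suc c) D-1+c ⟨
      P.S₀ (suc c)                                ≡⟨ P.S₀-first {c} (ℕₚ.m≤n+m (suc c) 6) (trans (P.S₀-evaluates c D-c) (ℕₚ.+-identityʳ _)) ⟩
      binomial n (suc c) ℕ.+ B F (suc c) (zeroV F) Spn   ≡⟨ cong (binomial n (suc c) ℕ.+_) (P.A≡B (suc c)) ⟨
      binomial n (suc c) ℕ.+ A F (suc c) Spn      ∎
      where open ≡-Reasoning

    module _ (q≡3 : q ≡ 3) where

      private
        base : ∃ λ (ω : V 1) → Independent ω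
        base = ∃-independent 1 (ℕₚ.≤-reflexive (sym q≡3))

      span-covRad-small : ∀ R → suc R ≤ suc c → coversAll (systems (suc R) D) ≡ true →
        ∀ t → Evaluates (systems R D) (t ∷ []) 0 0 → HasCovRad F Spn (suc R)
      span-covRad-small R R≤c covers t hole = P.At.covRad-certified {ω = proj₁ base} (proj₂ base) {suc c} D-free (sym q≡3)
        (ℕₚ.≤-trans R≤c (ℕₚ.m≤n+m (suc c) 6)) (coversAll-sound (systems (suc R) D) covers) (t ∷ []) hole

      span-UPWS-small : ∀ {R} → HasCovRad F Spn R → ∀ D′ γ γ′ → relationHolds R D′ γ γ′ D ≡ true → IsUPWS F Spn
      span-UPWS-small {R} cov D′ γ γ′ holds = P.At.upws-certified {ω = proj₁ base} (proj₂ base) {suc c} D-free (sym q≡3) cov D′ γ γ′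
        (subst (λ q → (ts : Vec (Col (suc c)) 1) → (Σ[ i < suc R ] (γ i ℕ.* evalAt q (systems i D) ts)) ≡
            suc D′ ℕ.+ (Σ[ i < suc R ] (γ′ i ℕ.* evalAt q (systems i D) ts))) (sym q≡3)
          (relationHolds-sound R D′ γ γ′ D holds))

      span-regular-small : ∀ {R t} f → t ≤ R → t ≤ n → profile R t f 3 D ≡ true → Regular F Spn R t
      span-regular-small f t≤R t≤n eq = P.regular t≤n f (P.profile-sound q≡3 {proj₁ base} (proj₂ base) {suc c} D-free f t≤R eq)

      kernel-regular-small : ∀ {R t} f → t ≤ R → t ≤ n → profile R t f 3 H ≡ true → Regular F Ker R t
      kernel-regular-small f t≤R t≤n eq = K.regular t≤n f (K.profile-sound q≡3 {proj₁ base} (proj₂ base) {6} H-free f t≤R eq)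

    span-nine : q ≡ 9 → 3 ≤ n → coversPairs (systems 3 D) ≡ true → (ts : Fin 3 → Vec (Col (suc c)) 2) →
      (∀ p → Evaluates (systems 1 D) (ts p) 0 0) → Evaluates (systems 2 D) (ts 0₃) 0 0 →
      ∀ {y₁ y₂ x₀ x₁ x₂} →
      Evaluates (systems 2 D) (ts 1₃) y₁ 0 → Evaluates (systems 2 D) (ts 2₃) y₂ 0 →
      Evaluates (systems 3 D) (ts 0₃) x₀ 0 → Evaluates (systems 3 D) (ts 1₃) x₁ 0 → Evaluates (systems 3 D) (ts 2₃) x₂ 0 →
      y₁ ℕ.* (x₂ ℕ.+ 0) ℕ.+ x₀ ℕ.* y₂ ≢ x₁ ℕ.* y₂ ℕ.+ x₀ ℕ.* y₁ →
      Params F Spn 6 (suc c) 3 × IsNMDS F Spn × ¬ IsUPWS F Spn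
    span-nine q≡9 3≤n covers ts holes ev-y₀ ev-y₁ ev-y₂ ev-x₀ ev-x₁ ev-x₂ det = span-params cov , span-NMDS ,
      P.At.¬upws-certified {ω = proj₁ base} (proj₂ base) {suc c} D-free {1} (ℕₚ.≤-trans (s≤s z≤n) 3≤n) cov
        ts holes ev-y₀ ev-y₁ ev-y₂ ev-x₀ ev-x₁ ev-x₂ det
      where
      base : ∃ λ (ω : V 2) → Independent ω
      base = ∃-independent 2 (ℕₚ.≤-reflexive (sym q≡9))
      cov : HasCovRad F Spn 3
      cov = P.At.covRad-certified {ω = proj₁ base} (proj₂ base) {suc c} D-free (sym q≡9) 3≤n
        (coversPairs-sound (systems 3 D) covers) (ts 0₃) ev-y₀

-- The punctured Golay codes

systematic₁₀ : ∀ i j → gen10 i (j ↑ˡ 4) ≡ unit j i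
systematic₁₀ = toWitness {a? = Finₚ.all? λ i → Finₚ.all? λ j → gen10 i (j ↑ˡ 4) Fin.≟ unit j i} tt

-- The circles are the 30 plane sections of the quadric with four points, the blocks of the
-- inversive plane of order 3; the hexads are their complements.
certificate₁₀ : Certificate (columns gen10) (dualColumns {6} {4} gen10)
certificate₁₀ = record
  { hexads = 29
  ; independents = 180
  ; H-5 = refl , refl , refl
  ; H-6 = refl , refl , refl
  ; H-7 = refl , refl , refl
  ; H-6-total = refl
  ; H-7-total = refl
  ; hexads-maximal = refl
  ; H-free = refl
  ; D-c = refl , refl , refl
  ; circles = 29
  ; circle-free = 179
  ; D-1+c = refl , refl , refl
  ; D-1+c-total = refl
  ; D-free = refl
  ; D-proportional = refl
  ; H-covers = refl
  ; H-hole = refl , refl , refl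
  -- Both points are at distance 4, and `hole₁` is at distance 5. The two sides of `p-det` are 1269
  -- and 1350.
  ; p₁ = 1₃ ∷ 1₃ ∷ 0₃ ∷ 0₃ ∷ 2₃ ∷ 2₃ ∷ []
  ; p₂ = 0₃ ∷ 0₃ ∷ 1₃ ∷ 1₃ ∷ 1₃ ∷ 1₃ ∷ []
  ; y₁ = 15 ; y₂ = 9 ; x₀ = 36 ; x₁ = 90 ; x₂ = 63
  ; p-holes = λ { 0₃ → refl , refl , refl ; 1₃ → refl , refl , refl ; 2₃ → refl , refl , refl }
  ; p-y₁ = refl , refl , refl
  ; p-y₂ = refl , refl , refl
  ; p-x₀ = refl , refl , refl
  ; p-x₁ = refl , refl , refl
  ; p-x₂ = refl , refl , refl
  ; p-det = λ ()
  ; a₁ = 11 ; a₂ = 19 ; k = 1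
  ; pp-holes = λ { 0₃ → refl , refl , refl ; 1₃ → refl , refl , refl ; 2₃ → refl , refl , refl }
  ; pp-y₀ = refl , refl , refl
  ; pp-y₁ = refl , refl , refl
  ; pp-y₂ = refl , refl , refl
  ; pp-x₀ = refl , refl , refl
  ; pp-x₁ = refl , refl , refl
  ; pp-x₂ = refl , refl , refl
  }

systematic₉ : ∀ i j → gen9 i (j ↑ˡ 3) ≡ unit j i
systematic₉ = toWitness {a? = Finₚ.all? λ i → Finₚ.all? λ j → gen9 i (j ↑ˡ 3) Fin.≟ unit j i} tt

-- The circles are the 12 lines of AG(2,3), the hexads their complements.
certificate₉ : Certificate (columns gen9) (dualColumns {6} {3} gen9)
certificate₉ = record
  { hexads = 11
  ; independents = 72
  ; H-5 = refl , refl , refl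
  ; H-6 = refl , refl , refl
  ; H-7 = refl , refl , refl
  ; H-6-total = refl
  ; H-7-total = refl
  ; hexads-maximal = refl
  ; H-free = refl
  ; D-c = refl , refl , refl
  ; circles = 11
  ; circle-free = 71
  ; D-1+c = refl , refl , refl
  ; D-1+c-total = refl
  ; D-free = refl
  ; D-proportional = refl
  ; H-covers = refl
  ; H-hole = refl , refl , refl
  ; p₁ = 0₃ ∷ 1₃ ∷ 2₃ ∷ 1₃ ∷ 2₃ ∷ 0₃ ∷ []
  ; p₂ = 0₃ ∷ 0₃ ∷ 1₃ ∷ 1₃ ∷ 1₃ ∷ 1₃ ∷ []
  ; y₁ = 9 ; y₂ = 5 ; x₀ = 18 ; x₁ = 45 ; x₂ = 30
  ; p-holes = λ { 0₃ → refl , refl , refl ; 1₃ → refl , refl , refl ; 2₃ → refl , refl , refl }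
  ; p-y₁ = refl , refl , refl
  ; p-y₂ = refl , refl , refl
  ; p-x₀ = refl , refl , refl
  ; p-x₁ = refl , refl , refl
  ; p-x₂ = refl , refl , refl
  ; p-det = λ ()
  ; a₁ = 3 ; a₂ = 10 ; k = 0
  ; pp-holes = λ { 0₃ → refl , refl , refl ; 1₃ → refl , refl , refl ; 2₃ → refl , refl , refl }
  ; pp-y₀ = refl , refl , refl
  ; pp-y₁ = refl , refl , refl
  ; pp-y₂ = refl , refl , refl
  ; pp-x₀ = refl , refl , refl
  ; pp-x₁ = refl , refl , refl
  ; pp-x₂ = refl , refl , refl
  }

systematic₈ : ∀ i j → gen8 i (j ↑ˡ 2) ≡ unit j i
systematic₈ = toWitness {a? = Finₚ.all? λ i → Finₚ.all? λ j → gen8 i (j ↑ˡ 2) Fin.≟ unit j i} tt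

-- The circles are the 4 pairs of columns that represent the same point, the hexads their
-- complements.
certificate₈ : Certificate (columns gen8) (dualColumns {6} {2} gen8)
certificate₈ = record
  { hexads = 3
  ; independents = 24
  ; H-5 = refl , refl , refl
  ; H-6 = refl , refl , refl
  ; H-7 = refl , refl , refl
  ; H-6-total = refl
  ; H-7-total = refl
  ; hexads-maximal = refl
  ; H-free = refl
  ; D-c = refl , refl , refl
  ; circles = 3
  ; circle-free = 23
  ; D-1+c = refl , refl , refl
  ; D-1+c-total = refl
  ; D-free = refl
  ; D-proportional = refl
  ; H-covers = refl
  ; H-hole = refl , refl , refl
  ; p₁ = 0₃ ∷ 0₃ ∷ 1₃ ∷ 1₃ ∷ 1₃ ∷ 1₃ ∷ []
  ; p₂ = 0₃ ∷ 0₃ ∷ 1₃ ∷ 2₃ ∷ 2₃ ∷ 1₃ ∷ []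
  ; y₁ = 3 ; y₂ = 5 ; x₀ = 8 ; x₁ = 14 ; x₂ = 20
  ; p-holes = λ { 0₃ → refl , refl , refl ; 1₃ → refl , refl , refl ; 2₃ → refl , refl , refl }
  ; p-y₁ = refl , refl , refl
  ; p-y₂ = refl , refl , refl
  ; p-x₀ = refl , refl , refl
  ; p-x₁ = refl , refl , refl
  ; p-x₂ = refl , refl , refl
  ; p-det = λ ()
  ; a₁ = 0 ; a₂ = 7 ; k = 0
  ; pp-holes = λ { 0₃ → refl , refl , refl ; 1₃ → refl , refl , refl ; 2₃ → refl , refl , refl }
  ; pp-y₀ = refl , refl , refl
  ; pp-y₁ = refl , refl , refl
  ; pp-y₂ = refl , refl , refl
  ; pp-x₀ = refl , refl , refl
  ; pp-x₁ = refl , refl , refl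
  ; pp-x₂ = refl , refl , refl
  }

row : List ℕ → ℕ → ℕ
row [] i = 0
row (x ∷ xs) zero = x
row (x ∷ xs) (suc i) = row xs i

table : List (List ℕ) → ℕ → ℕ → ℕ
table [] d i = 0
table (r ∷ rs) zero i = row r i
table (r ∷ rs) (suc d) i = table rs d i

module Golay (F : FiniteField) (char3 : Char3 F) where
  open Field F
  open Ternary F char3
  open Syndromes F char3
  open Points F char3
  open Codes F char3
  open Systematic F char3
  open Certificates F char3
  open Families F char3
  open Duality F char3

  module F₁₀ = Family certificate₁₀ {G10⊥ F} {G10 F} (kernel-dim gen10 systematic₁₀) (span-dim gen10 systematic₁₀)
    (kernel-check gen10) (span-check gen10 systematic₁₀) (kernel-dual-check gen10 systematic₁₀) (span-dual-check gen10)
  module F₉ = Family certificate₉ {G9⊥ F} {G9 F} (kernel-dim gen9 systematic₉) (span-dim gen9 systematic₉)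
    (kernel-check gen9) (span-check gen9 systematic₉) (kernel-dual-check gen9 systematic₉) (span-dual-check gen9)
  module F₈ = Family certificate₈ {G8⊥ F} {G8 F} (kernel-dim gen8 systematic₈) (span-dim gen8 systematic₈)
    (kernel-check gen8) (span-check gen8 systematic₈) (kernel-dual-check gen8 systematic₈) (span-dual-check gen8)

  weight-one : ∀ {r n} (hs : Vec (Col r) n) e → wt e ≡ 1 →
    ∃ λ j → ∃ λ a → a ≢ 0# × syndrome hs e ≈ syndrome (lookup hs j ∷ []) (λ _ → a)
  weight-one (h ∷ hs) e eq with e zero ≟ 0#
  ... | yes e₀≡0 = let j , a , a≢0 , eq′ = weight-one hs (e ∘ suc) eq in suc j , a , a≢0 ,
          λ i → trans (cong₂ _+_ (trans (cong (lookup h i ·_) e₀≡0) (·-zeroʳ (lookup h i))) (eq′ i)) (+-identityˡ _)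
  ... | no e₀≢0 = zero , e zero , e₀≢0 , λ i → cong (lookup h i · e zero +_)
          (trans (syndrome-cong hs (dist≡0⇒≈ (e ∘ suc) (zeroV F) (ℕₚ.suc-injective eq)) i) (syndrome-zeroV hs i))

  module _ {r n : ℕ} {C : Code F n} {hs : Vec (Col r) n} (check : ParityCheck C hs) where
    open Certified check

    -- At distance 1 the syndrome is a nonzero multiple of a column. A single nonzero element is
    -- independent over 𝔽₃, so the evaluation works for every `q`.
    S-distance-one : ∀ {a} → (∀ j → Evaluates (systems 1 hs) (lookup hs j ∷ []) a 0) →
      ∀ v → 1 ≤ n → S 0 v ≡ 0 → S 1 v ≢ 0 → S 1 v ≡ a
    S-distance-one {a} ev v 1≤n S₀≡0 S₁≢0 = trans (total-cong (systems 1 hs) {t = syndrome (lookup hs j ∷ []) (λ _ → x)}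
        (λ i → trans (sym (trans (syndrome-- hs v c i) (trans (cong (λ z → syndrome hs v i - z) (ParityCheck.annihilates check c∈C i))
          (x-0≡x _)))) (eq i)))
      (trans (total≡evalAt {ω = λ _ → x} (nonzero-independent x≢0) (systems 1 hs) (lookup hs j ∷ []))
        (trans (evalAt-evaluates q (systems 1 hs) (lookup hs j ∷ []) (ev j)) (ℕₚ.+-identityʳ a)))
      where
      close : ∃ λ c → mem C c × dist F v c ≤ 1
      close = S≢0⇒close 1 v S₁≢0
      c : V n
      c = proj₁ close
      c∈C : mem C c
      c∈C = proj₁ (proj₂ close)
      d≡1 : dist F v c ≡ 1
      d≡1 = ℕₚ.≤-antisym (proj₂ (proj₂ close)) (ℕₚ.n≢0⇒n>0 λ d≡0 →
        close⇒S≢0 {0} {v} z≤n c∈C (ℕₚ.≤-reflexive d≡0) S₀≡0)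
      error : ∃ λ j → ∃ λ a → a ≢ 0# × syndrome hs (λ i → v i - c i) ≈ syndrome (lookup hs j ∷ []) (λ _ → a)
      error = weight-one hs (λ i → v i - c i) (trans (sym (dist≡wt v c)) d≡1)
      j = proj₁ error
      x = proj₁ (proj₂ error)
      x≢0 = proj₁ (proj₂ (proj₂ error))
      eq = proj₂ (proj₂ (proj₂ error))

    S-distance-zero : ∀ v → S 0 v ≢ 0 → ∀ i → S i v ≡ S₀ i
    S-distance-zero v S≢0 i = S-codeword i (in-code (S≢0⇒close 0 v S≢0))
      where
      in-code : (∃ λ c → mem C c × dist F v c ≤ 0) → mem C v
      in-code (c , c∈C , d≤0) = resp C (sym ∘ dist≡0⇒≈ v c (ℕₚ.n≤0⇒n≡0 d≤0)) c∈C

  G8-large : 9 ≤ q → HasCovRad F (G8 F) 2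
  -- With independent coefficients the two unit vectors give a point of the line that is not
  -- rational over 𝔽₃, hence no multiple of a column.
  G8-large 9≤q = F₈.span-covRad {ω = proj₁ base} (proj₂ base) ((0₃ ∷ 1₃ ∷ []) ∷ (1₃ ∷ 0₃ ∷ []) ∷ []) (refl , refl , refl)
    where
    base : ∃ λ (ω : V 2) → Independent ω
    base = ∃-independent 2 9≤q

  G9-large : 9 ≤ q → HasCovRad F (G9 F) 3
  -- The two vectors span the line at infinity, the only line of PG(2,3) not spanned by two points
  -- of AG(2,3).
  G9-large 9≤q = F₉.span-covRad {ω = proj₁ base} (proj₂ base) ((0₃ ∷ 1₃ ∷ 2₃ ∷ []) ∷ (1₃ ∷ 0₃ ∷ 1₃ ∷ []) ∷ []) (refl , refl , refl)
    where
    base : ∃ λ (ω : V 2) → Independent ω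
    base = ∃-independent 2 9≤q

  G10-large : 27 ≤ q → HasCovRad F (G10 F) 4
  -- The three vectors span a tangent plane of the quadric. It meets the quadric in one point, so no
  -- three columns span it.
  G10-large 27≤q = F₁₀.span-covRad {ω = proj₁ base} (proj₂ base)
    ((0₃ ∷ 0₃ ∷ 0₃ ∷ 1₃ ∷ []) ∷ (0₃ ∷ 1₃ ∷ 2₃ ∷ 0₃ ∷ []) ∷ (1₃ ∷ 0₃ ∷ 1₃ ∷ 0₃ ∷ []) ∷ []) (refl , refl , refl)
    where
    base : ∃ λ (ω : V 3) → Independent ω
    base = ∃-independent 3 27≤q

  G8-small : q ≡ 3 → HasCovRad F (G8 F) 1
  G8-small q≡3 = F₈.span-covRad-small q≡3 0 (s≤s z≤n) refl (0₃ ∷ 1₃ ∷ []) (refl , refl , refl)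

  G9-small : q ≡ 3 → HasCovRad F (G9 F) 2
  G9-small q≡3 = F₉.span-covRad-small q≡3 1 (s≤s (s≤s z≤n)) refl (0₃ ∷ 1₃ ∷ 2₃ ∷ []) (refl , refl , refl)

  G10-small : q ≡ 3 → HasCovRad F (G10 F) 2
  G10-small q≡3 = F₁₀.span-covRad-small q≡3 1 (s≤s (s≤s z≤n)) refl (0₃ ∷ 0₃ ∷ 1₃ ∷ 1₃ ∷ []) (refl , refl , refl)

  G8-regular-small : q ≡ 3 → IsCompletelyRegular F (G8 F)
  G8-regular-small q≡3 = 1 , G8-small q≡3 ,
    F₈.span-regular-small q≡3 {1} {1} (table ((1 ∷ 8 ∷ []) ∷ (0 ∷ 2 ∷ []) ∷ [])) ℕₚ.≤-refl (s≤s z≤n) refl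

  G9-regular-small : q ≡ 3 → IsCompletelyRegular F (G9 F)
  G9-regular-small q≡3 = 2 , G9-small q≡3 ,
    -- An affine point lies on 4 affine lines, a point at infinity on 3, and each line has 3 pairs
    -- of points: this gives 12 and 9.
    F₉.span-regular-small q≡3 {2} {2} (table ((1 ∷ 9 ∷ 36 ∷ []) ∷ (0 ∷ 1 ∷ 12 ∷ []) ∷ (0 ∷ 0 ∷ 9 ∷ []) ∷ []))
      ℕₚ.≤-refl (s≤s (s≤s z≤n)) refl

  G10⊥-regular-small : q ≡ 3 → IsTRegular F (G10⊥ F) 2
  G10⊥-regular-small q≡3 = 5 , proj₂ (proj₂ (proj₁ (F₁₀.kernel-small q≡3))) , s≤s (s≤s z≤n) ,
    -- Row 0 consists of binomial coefficients since the minimum distance is 6. In row 1 the words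
    -- of weight 6 first show at index 5: 144 is 126 plus the 18 dependent 6-sets through a column.
    F₁₀.kernel-regular-small q≡3 {5} {2} (table
      ((1 ∷ 10 ∷ 45 ∷ 120 ∷ 210 ∷ 252 ∷ []) ∷ (0 ∷ 1 ∷ 9 ∷ 36 ∷ 84 ∷ 144 ∷ []) ∷ (0 ∷ 0 ∷ 1 ∷ 8 ∷ 33 ∷ 96 ∷ []) ∷ []))
      (s≤s (s≤s z≤n)) (s≤s (s≤s z≤n)) refl

  -- The syndromes cannot be listed here. At distances 1 and 2 the moment `S 1` is 2 and 0, and
  -- `span-relation` then yields `S 2`; distance 0 is `S-distance-zero`.
  G8-regular-large : 9 ≤ q → IsCompletelyRegular F (G8 F)
  G8-regular-large 9≤q = 2 , G8-large 9≤q , regular {2} {2} (s≤s (s≤s z≤n)) f shells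
    where
    open Certified (span-check gen8 systematic₈)
    f : ℕ → ℕ → ℕ
    f 0 i = S₀ i
    -- The 24 independent pairs of columns give one solution each, and the pair of columns
    -- proportional to the syndrome gives `q`.
    f 1 i = row (0 ∷ 2 ∷ 24 ℕ.+ q ∷ []) i
    f _ i = row (0 ∷ 0 ∷ 24 ∷ []) i
    single : ∀ j → Evaluates (systems 1 (dualColumns {6} {2} gen8)) (lookup (dualColumns {6} {2} gen8) j ∷ []) 2 0
    single j = refl , toWitness {a? = Finₚ.all? λ j →
        hits 0 (systems 1 (dualColumns {6} {2} gen8)) (lookup (dualColumns {6} {2} gen8) j ∷ []) ℕ.≟ 2} tt j ,
      toWitness {a? = Finₚ.all? λ j →
        hits 1 (systems 1 (dualColumns {6} {2} gen8)) (lookup (dualColumns {6} {2} gen8) j ∷ []) ℕ.≟ 0} tt j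
    S-two : ∀ v {y} → S 1 v ≡ y ℕ.* 2 → S 2 v ≡ 24 ℕ.+ q ℕ.* y
    S-two v {y} eq = ℕₚ.*-cancelˡ-≡ (S 2 v) (24 ℕ.+ q ℕ.* y) 2 (begin
      2 ℕ.* S 2 v               ≡⟨ F₈.span-relation v ⟩
      48 ℕ.+ q ℕ.* S 1 v        ≡⟨ cong (λ z → 48 ℕ.+ q ℕ.* z) eq ⟩
      48 ℕ.+ q ℕ.* (y ℕ.* 2)    ≡⟨ cong (48 ℕ.+_) (trans (sym (ℕₚ.*-assoc q y 2)) (ℕₚ.*-comm (q ℕ.* y) 2)) ⟩
      48 ℕ.+ 2 ℕ.* (q ℕ.* y)    ≡⟨ ℕₚ.*-distribˡ-+ 2 24 (q ℕ.* y) ⟨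
      2 ℕ.* (24 ℕ.+ q ℕ.* y)    ∎)
      where open ≡-Reasoning
    shells : ∀ v d → d ≤ 2 → (∀ i → i < d → S i v ≡ 0) → S d v ≢ 0 → ∀ i → i ≤ 2 → S i v ≡ f d i
    shells v 0 _ _ ne i _ = S-distance-zero (span-check gen8 systematic₈) v ne i
    shells v 1 _ empty ne 0 _ = empty 0 (s≤s z≤n)
    shells v 1 _ empty ne 1 _ = S-distance-one (span-check gen8 systematic₈) single v (s≤s z≤n) (empty 0 (s≤s z≤n)) ne
    shells v 1 _ empty ne 2 _ = trans (S-two v {1} (S-distance-one (span-check gen8 systematic₈) single v (s≤s z≤n) (empty 0 (s≤s z≤n)) ne))
      (cong (24 ℕ.+_) (ℕₚ.*-identityʳ q))
    shells v 2 _ empty ne 0 _ = empty 0 (s≤s z≤n)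
    shells v 2 _ empty ne 1 _ = empty 1 (s≤s (s≤s z≤n))
    shells v 2 _ empty ne 2 _ = trans (S-two v {0} (empty 1 (s≤s (s≤s z≤n)))) (cong (24 ℕ.+_) (ℕₚ.*-zeroʳ q))
    shells v (suc (suc (suc d))) (s≤s (s≤s ())) _ _ _ _
    shells v _ _ _ _ (suc (suc (suc i))) (s≤s (s≤s ()))

  -- A tangent, an external and a secant line of the quadric. They lie in 3, 2 and 4 planes that
  -- meet the quadric in four points, and each such plane accounts for four triples: hence 12, 8 and
  -- 16. The first two syndromes are both at distance 3 with different numbers of nearest codewords,
  -- which no UPWS relation allows.
  points₉ : Fin 3 → Vec (Col 4) 2
  points₉ 0₃ = (0₃ ∷ 0₃ ∷ 0₃ ∷ 1₃ ∷ []) ∷ (0₃ ∷ 1₃ ∷ 2₃ ∷ 0₃ ∷ []) ∷ []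
  points₉ 1₃ = (0₃ ∷ 0₃ ∷ 1₃ ∷ 1₃ ∷ []) ∷ (0₃ ∷ 1₃ ∷ 0₃ ∷ 2₃ ∷ []) ∷ []
  points₉ 2₃ = (0₃ ∷ 0₃ ∷ 0₃ ∷ 1₃ ∷ []) ∷ (0₃ ∷ 0₃ ∷ 1₃ ∷ 0₃ ∷ []) ∷ []

  G10-nine : q ≡ 9 → Params F (G10 F) 6 4 3 × IsNMDS F (G10 F) × ¬ IsUPWS F (G10 F)
  G10-nine q≡9 = F₁₀.span-nine q≡9 (s≤s (s≤s (s≤s z≤n))) refl points₉
    (λ { 0₃ → refl , refl , refl ; 1₃ → refl , refl , refl ; 2₃ → refl , refl , refl })
    (refl , refl , refl) {0} {1} {12} {8} {16} (refl , refl , refl) (refl , refl , refl)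
    (refl , refl , refl) (refl , refl , refl) (refl , refl , refl) (λ ())

  -- In the number z of zeros of a dual word, 6 C(z,4) - 3 C(z,3) + C(z,2) = z(z-1)(z-3)(z-4)/4. It
  -- is nonnegative at integers, vanishes at z = 4 and z = 1, the nonzero words of `G10⊥`, which
  -- makes the bound tight, and is 945 at z = 10.
  G10-minimal : q ≡ 3 → ∀ (C : Code F 10) → IsLinear F C → HasDim F C 6 → HasMinDist F C 4 → A F 4 (G10 F) ≤ A F 4 C
  G10-minimal q≡3 C linear dim minDist = linear-programming-bound C linear {6} {3} refl dim minDist 6 3 1 945 (A F 4 (G10 F))
    (toWitness {a? = Finₚ.all? λ _ → _ ≤? _} tt)
    (subst₂ (λ q a → 6 ℕ.* (210 ℕ.+ a) ℕ.+ 1 ℕ.* (q ^ 2 ℕ.* 45) ≤ 3 ℕ.* (q ^ 1 ℕ.* 120) ℕ.+ 945)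
      (sym q≡3) (ℕₚ.+-cancelˡ-≡ 210 60 _ (F₁₀.span-A q≡3)) (toWitness {a? = _ ≤? _} tt))

  -- The polynomial is 3 C(z,3) - 4 C(z,2) + 3 z = z(z-3)(z-4)/2. The nonzero words of `G9⊥` have z
  -- = 3 or z = 0, and its value at z = 9 is 135.
  G9-minimal : q ≡ 3 → ∀ (C : Code F 9) → IsLinear F C → HasDim F C 6 → HasMinDist F C 3 → A F 3 (G9 F) ≤ A F 3 C
  G9-minimal q≡3 C linear dim minDist = linear-programming-bound C linear {6} {2} refl dim minDist 3 4 3 135 (A F 3 (G9 F))
    (toWitness {a? = Finₚ.all? λ _ → _ ≤? _} tt)
    (subst₂ (λ q a → 3 ℕ.* (84 ℕ.+ a) ℕ.+ 3 ℕ.* (q ^ 2 ℕ.* 9) ≤ 4 ℕ.* (q ^ 1 ℕ.* 36) ℕ.+ 135)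
      (sym q≡3) (ℕₚ.+-cancelˡ-≡ 84 24 _ (F₉.span-A q≡3)) (toWitness {a? = _ ≤? _} tt))

  -- The polynomial is C(z,2) - z + 1 = (z-1)(z-2)/2. The nonzero words of `G8⊥` have z = 2, and its
  -- value at z = 8 is 21.
  G8-minimal : q ≡ 3 → ∀ (C : Code F 8) → IsLinear F C → HasDim F C 6 → HasMinDist F C 2 → A F 2 (G8 F) ≤ A F 2 C
  G8-minimal q≡3 C linear dim minDist = linear-programming-bound C linear {6} {1} refl dim minDist 1 1 1 21 (A F 2 (G8 F))
    (toWitness {a? = Finₚ.all? λ _ → _ ≤? _} tt)
    (subst₂ (λ q a → 1 ℕ.* (28 ℕ.+ a) ℕ.+ 1 ℕ.* (q ^ 2 ℕ.* 1) ≤ 1 ℕ.* (q ^ 1 ℕ.* 8) ℕ.+ 21)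
      (sym q≡3) (ℕₚ.+-cancelˡ-≡ 28 8 _ (F₈.span-A q≡3)) (toWitness {a? = _ ≤? _} tt))

theorem4p5 : ∀ (m : ℕ) → 1 ≤ m →
    ∀ (F : FiniteField) → order F ≡ 3 ^ m → Char3 F →
    ((m ≡ 1 → Params F (G10 F) 6 4 2 × IsUPWS F (G10 F) × IsNMDS F (G10 F)) ×
    (3 ≤ m → Params F (G10 F) 6 4 4 × IsUPWS F (G10 F) × IsNMDS F (G10 F)) ×
    (m ≡ 1 → Params F (G9 F) 6 3 2 × IsUPWS F (G9 F) × IsNMDS F (G9 F)) ×
    (2 ≤ m → Params F (G9 F) 6 3 3 × IsUPWS F (G9 F) × IsNMDS F (G9 F)) ×
    (m ≡ 1 → Params F (G8 F) 6 2 1 × IsUPWS F (G8 F) × IsNMDS F (G8 F)) ×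
    (2 ≤ m → Params F (G8 F) 6 2 2 × IsUPWS F (G8 F) × IsNMDS F (G8 F))) ×
    ((IsCompletelyRegular F (G8 F) × IsNMDS F (G8 F)) ×
    (m ≡ 1 → IsCompletelyRegular F (G9 F) × IsNMDS F (G9 F)) ×
    (m ≡ 1 → IsTRegular F (G10⊥ F) 2)) ×
    ((m ≡ 1 → Params F (G10⊥ F) 4 6 5 × IsNMDS F (G10⊥ F) × ¬ IsUPWS F (G10⊥ F)) ×
    (2 ≤ m → Params F (G10⊥ F) 4 6 6 × IsNMDS F (G10⊥ F) × ¬ IsUPWS F (G10⊥ F)) ×
    (m ≡ 1 → Params F (G9⊥ F) 3 6 5 × IsNMDS F (G9⊥ F) × ¬ IsUPWS F (G9⊥ F)) ×
    (2 ≤ m → Params F (G9⊥ F) 3 6 6 × IsNMDS F (G9⊥ F) × ¬ IsUPWS F (G9⊥ F)) ×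
    (m ≡ 1 → Params F (G8⊥ F) 2 6 5 × IsNMDS F (G8⊥ F) × ¬ IsUPWS F (G8⊥ F)) ×
    (2 ≤ m → Params F (G8⊥ F) 2 6 6 × IsNMDS F (G8⊥ F) × ¬ IsUPWS F (G8⊥ F)) ×
    (m ≡ 2 → Params F (G10 F) 6 4 3 × IsNMDS F (G10 F) × ¬ IsUPWS F (G10 F))) ×
    ((toℚ (A F 6 (G10⊥ F)) ≡ Amax 10 4 (3 ^ m)) ×
    (toℚ (A F 6 (G9⊥ F)) ≡ Amax 9 3 (3 ^ m)) ×
    (toℚ (A F 6 (G8⊥ F)) ≡ Amax 8 2 (3 ^ m)) ×
    (m ≡ 1 → ∀ (C : Code F 10) → IsLinear F C → HasDim F C 6 → HasMinDist F C 4 →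
    A F 4 (G10 F) ≤ A F 4 C) ×
    (m ≡ 1 → ∀ (C : Code F 9) → IsLinear F C → HasDim F C 6 → HasMinDist F C 3 →
    A F 3 (G9 F) ≤ A F 3 C) ×
    (m ≡ 1 → ∀ (C : Code F 8) → IsLinear F C → HasDim F C 6 → HasMinDist F C 2 →
    A F 2 (G8 F) ≤ A F 2 C)) ×
    (A F 7 (G10⊥ F) ≡ 0 × A F 7 (G9⊥ F) ≡ 0 × A F 7 (G8⊥ F) ≡ 0)
theorem4p5 m 1≤m F q≡3^m char3 =
  ( (λ m≡1 → F₁₀.span-params (G10-small (three m≡1)) ,
      -- At distances 0, 1, 2 the moments S 0, S 1, S 2 are (1, 10, 45), (0, 1, 9), (0, 0, 3), as a
      -- point off the quadric lies on three secants; all satisfy 18 S 0 + S 2 = 3 + 6 S 1.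
      F₁₀.span-UPWS-small (three m≡1) {2} (G10-small (three m≡1)) 2 (row (18 ∷ 0 ∷ 1 ∷ [])) (row (0 ∷ 6 ∷ [])) refl , F₁₀.span-NMDS)
  , (λ 3≤m → F₁₀.span-params (G10-large (power 3≤m)) , F₁₀.span-UPWS (G10-large (power 3≤m)) , F₁₀.span-NMDS)
  , (λ m≡1 → F₉.span-params (G9-small (three m≡1)) ,
      -- The relation S 2 = 9 + 3 S 1 holds for all rows of the table in `G9-regular-small`.
      F₉.span-UPWS-small (three m≡1) {2} (G9-small (three m≡1)) 8 (row (0 ∷ 0 ∷ 1 ∷ [])) (row (0 ∷ 3 ∷ [])) refl , F₉.span-NMDS)
  , (λ 2≤m → F₉.span-params (G9-large (power 2≤m)) , F₉.span-UPWS (G9-large (power 2≤m)) , F₉.span-NMDS)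
  , (λ m≡1 → F₈.span-params (G8-small (three m≡1)) ,
      F₈.span-UPWS-small (three m≡1) {1} (G8-small (three m≡1)) 1 (row (0 ∷ 1 ∷ [])) (row (6 ∷ [])) refl , F₈.span-NMDS)
  , (λ 2≤m → F₈.span-params (G8-large (power 2≤m)) , F₈.span-UPWS (G8-large (power 2≤m)) , F₈.span-NMDS)
  ) ,
  ( (G8-regular , F₈.span-NMDS)
  , (λ m≡1 → G9-regular-small (three m≡1) , F₉.span-NMDS)
  , (λ m≡1 → G10⊥-regular-small (three m≡1))
  ) ,
  ( (λ m≡1 → F₁₀.kernel-small (three m≡1)) , (λ 2≤m → F₁₀.kernel-large (power 2≤m))
  , (λ m≡1 → F₉.kernel-small (three m≡1)) , (λ 2≤m → F₉.kernel-large (power 2≤m))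
  , (λ m≡1 → F₈.kernel-small (three m≡1)) , (λ 2≤m → F₈.kernel-large (power 2≤m))
  , (λ m≡2 → G10-nine (trans q≡3^m (cong (3 ^_) m≡2)))
  ) ,
  ( trans F₁₀.kernel-A₆ (cong (Amax 10 4) q≡3^m)
  , trans F₉.kernel-A₆ (cong (Amax 9 3) q≡3^m)
  , trans F₈.kernel-A₆ (cong (Amax 8 2) q≡3^m)
  , (λ m≡1 → G10-minimal (three m≡1)) , (λ m≡1 → G9-minimal (three m≡1)) , (λ m≡1 → G8-minimal (three m≡1))
  ) ,
  (F₁₀.kernel-A₇ , F₉.kernel-A₇ , F₈.kernel-A₇)
  where
  open Golay F char3
  three : m ≡ 1 → order F ≡ 3
  three m≡1 = trans q≡3^m (cong (3 ^_) m≡1)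
  power : ∀ {k} → k ≤ m → 3 ^ k ≤ order F
  power {k} k≤m = subst (3 ^ k ≤_) (sym q≡3^m) (ℕₚ.^-monoʳ-≤ 3 k≤m)
  G8-regular : IsCompletelyRegular F (G8 F)
  G8-regular with ℕₚ.m≤n⇒m<n∨m≡n 1≤m
  ... | inj₁ 2≤m = G8-regular-large (power 2≤m)
  ... | inj₂ 1≡m = G8-regular-small (three (sym 1≡m))
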